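{- If the color classes form a laminar family, then each of the problems Exact-Simultaneous-Dipaths, Exact-Simultaneous-Paths, Superset-Simultaneous-Dipaths, and Superset-Simultaneous-Paths is polynomial-time solvable.
   Context: Directed problems: the input is a positive integer $k$, a digraph $D=(V,A)$ with $A=A_1\cup\cdots\cup A_k$ (the color classes $A_i$ are not necessarily disjoint), two distinct vertices $s,t\in V$, and a conservative cost function $c\colon A\to\mathbb{R}$ (no directed cycle of negative total cost). In Exact-Simultaneous-Dipaths (respectively Superset-Simultaneous-Dipaths), the task is to find $A'\subseteq A$ of minimum cost $\sum_{a\in A'}c(a)$ such that $A'\cap A_i$ is exactly the arc set of (respectively contains the arc set of) an $s$-$t$ dipath for all $i\in\{1,\ldots,k\}$, or to determine that no such $A'$ exists. Undirected problems: the input is a positive integer $k$, an undirected graph $G=(V,E)$ with $E=E_1\cup\cdots\cup E_k$ (color classes $E_i$, not necessarily disjoint), two distinct vertices $s,t\in V$, and a nonnegative cost function $c\colon E\to\mathbb{R}_+$. In Exact-Simultaneous-Paths (respectively Superset-Simultaneous-Paths), the task is to find $E'\subseteq E$ of minimum cost such that $E'\cap E_i$ is exactly the edge set of (respectively contains the edge set of) an $s$-$t$ path for all $i\in\{1,\ldots,k\}$, or to determine that no such $E'$ exists. Paths and dipaths have no repeated vertices. Graphs and digraphs are finite and may have parallel edges or arcs. A set family on a finite ground set is laminar if, for any two of its intersecting sets, one is contained in the other. The number $k$ is part of the input.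
   Formalization: The cost function c is taken to be rational-valued (written in binary in the input) instead of real-valued. -}

module Defs where

open import Data.Bool.Base using (Bool; true; false)
open import Data.Fin.Base using (Fin; zero; toℕ)
open import Data.Fin.Subset using (Subset; _∩_; _⊆_; ⋃; ⊤; ⁅_⁆; Nonempty)
open import Data.Fin.Subset.Properties using (_∈?_)
open import Data.Integer.Base using (ℤ; +_; -[1+_])
open import Data.List.Base using (List; []; _∷_; _++_; map; foldr; filter; allFin; replicate)
open import Data.List.Relation.Unary.Unique.Propositional using (Unique)
open import Data.Maybe.Base using (Maybe; just; nothing)
open import Data.Nat.Base using (ℕ; suc; _+_; _*_; _^_; NonZero)
  renaming (_≤_ to _≤ⁿ_)
open import Data.Nat.Binary.Base using (ℕᵇ; zero; 2[1+_]; 1+[2_]; fromℕ)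
open import Data.Product.Base using (Σ; ∃; ∃-syntax; _×_; _,_; proj₁; proj₂)
open import Data.Rational.Base using (ℚ; 0ℚ; ↥_; ↧ₙ_)
  renaming (_+_ to _+ℚ_; _≤_ to _≤ℚ_)
open import Data.Sum.Base using (_⊎_)
open import Data.Vec.Base using (Vec; lookup; toList; _[_]≔_) renaming (_∷_ to _∷ᵛ_; replicate to replicateᵛ)
open import Relation.Binary.PropositionalEquality.Core using (_≡_; _≢_)
open import Relation.Nullary.Negation.Core using (¬_)

------------------------------------------------------------------------
-- Polynomial time
--
-- The machine model is Jones' WHILE language over binary trees, with
-- finitely many variables.  Jones charges one unit per operation; here an
-- assignment is also charged the size of the tree it stores, so that sharing
-- cannot build exponentially large trees in polynomial time.  With this
-- charge, running times agree with those of multitape Turing machines up to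
-- a polynomial, also for functions and not only for decision problems.

data Tree : Set where
  nil  : Tree
  cons : Tree → Tree → Tree

size : Tree → ℕ
size nil        = 1
size (cons x y) = 1 + size x + size y

hd tl : Tree → Tree
hd nil        = nil
hd (cons x y) = x
tl nil        = nil
tl (cons x y) = y

Store : ℕ → Set
Store r = Vec Tree r

data Expr (r : ℕ) : Set where
  var   : Fin r → Expr r
  nilᵉ  : Expr r
  consᵉ : Fin r → Fin r → Expr r
  hdᵉ   : Fin r → Expr r
  tlᵉ   : Fin r → Expr r

eval : ∀ {r} → Store r → Expr r → Tree
eval σ (var x)     = lookup σ x
eval σ nilᵉ        = nil
eval σ (consᵉ x y) = cons (lookup σ x) (lookup σ y)
eval σ (hdᵉ x)     = hd (lookup σ x)
eval σ (tlᵉ x)     = tl (lookup σ x)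

infix  6 _:=_
infixr 5 _⨾_

data Cmd (r : ℕ) : Set where
  _:=_  : Fin r → Expr r → Cmd r
  _⨾_   : Cmd r → Cmd r → Cmd r
  cond  : Fin r → Cmd r → Cmd r → Cmd r
  while : Fin r → Cmd r → Cmd r

-- Run p σ τ t : started in σ, the command p halts in τ after time t.
-- As a test, nil is false and every other tree is true.

data Run {r : ℕ} : Cmd r → Store r → Store r → ℕ → Set where
  assign : ∀ {x e σ} →
    Run (x := e) σ (σ [ x ]≔ eval σ e) (1 + size (eval σ e))
  seq : ∀ {p q σ τ υ t u} →
    Run p σ τ t → Run q τ υ u → Run (p ⨾ q) σ υ (t + u)
  cond-true : ∀ {x p q σ τ t} →
    lookup σ x ≢ nil → Run p σ τ t → Run (cond x p q) σ τ (1 + t)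
  cond-false : ∀ {x p q σ τ t} →
    lookup σ x ≡ nil → Run q σ τ t → Run (cond x p q) σ τ (1 + t)
  while-stop : ∀ {x p σ} →
    lookup σ x ≡ nil → Run (while x p) σ σ 1
  while-step : ∀ {x p σ τ υ t u} →
    lookup σ x ≢ nil → Run p σ τ t → Run (while x p) τ υ u →
    Run (while x p) σ υ (1 + t + u)

-- The first variable carries the input and the output; all others start at nil.

Program : Set
Program = ∃[ r ] Cmd (suc r)

-- Computes p x y t : on input x, p halts with output y after time t.
Computes : Program → Tree → Tree → ℕ → Set
Computes (r , p) x y t =
  ∃[ τ ] Run p (x ∷ᵛ replicateᵛ r nil) τ t × lookup τ zero ≡ y

record Problem : Set₁ where
  field
    Instance : Set
    encode   : Instance → Tree
    Answer   : Instance → Set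
    encodeᵃ  : ∀ {x} → Answer x → Tree
    Correct  : (x : Instance) → Answer x → Set

PolynomialTimeSolvable : Problem → Set
PolynomialTimeSolvable P =
  ∃[ p ] ∃[ c ] ∃[ d ] ((x : Instance) →
    Σ (Answer x) λ y → Correct x y ×
      ∃[ t ] (Computes p (encode x) (encodeᵃ y) t × t ≤ⁿ c * size (encode x) ^ d))
  where open Problem P

_restrictedTo_ : (P : Problem) → (Problem.Instance P → Set) → Problem
P restrictedTo Q = record
  { Instance = ∃ Q
  ; encode   = λ x → encode (proj₁ x)
  ; Answer   = λ x → Answer (proj₁ x)
  ; encodeᵃ  = encodeᵃ
  ; Correct  = λ x → Correct (proj₁ x)
  }
  where open Problem P

------------------------------------------------------------------------
-- Graphs, walks and paths

-- For a digraph, ends lists (tail , head); for an undirected graph the order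
-- of the two ends is immaterial.  Repeated entries are parallel edges.

record Graph : Set where
  field
    n m  : ℕ
    ends : Vec (Fin n × Fin n) m

  Vertex Edge : Set
  Vertex = Fin n
  Edge   = Fin m

data Orientation : Set where
  directed undirected : Orientation

module _ (G : Graph) where
  open Graph G

  Joins : Orientation → Edge → Vertex → Vertex → Set
  Joins directed   e u v = lookup ends e ≡ (u , v)
  Joins undirected e u v = lookup ends e ≡ (u , v) ⊎ lookup ends e ≡ (v , u)

  data Walk (o : Orientation) : Vertex → Vertex → Set where
    stop : ∀ {u} → Walk o u u
    step : ∀ {u v w} (e : Edge) → Joins o e u v → Walk o v w → Walk o u w

module _ {G : Graph} {o : Orientation} where
  open Graph G

  edges : ∀ {u v} → Walk G o u v → List Edge
  edges stop         = []
  edges (step e _ w) = e ∷ edges w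

  -- All vertices of a walk but the last one.
  departures : ∀ {u v} → Walk G o u v → List Vertex
  departures stop                 = []
  departures (step {u = u} _ _ w) = u ∷ departures w

  vertices : ∀ {u v} → Walk G o u v → List Vertex
  vertices {v = v} w = departures w ++ v ∷ []

  edgeSet : ∀ {u v} → Walk G o u v → Subset m
  edgeSet w = ⋃ (map ⁅_⁆ (edges w))

  IsPath : ∀ {u v} → Walk G o u v → Set
  IsPath w = Unique (vertices w)

-- A loop is a directed cycle of length one.
IsDirectedCycle : ∀ {G v} → Walk G directed v v → Set
IsDirectedCycle w = edges w ≢ [] × Unique (departures w)

------------------------------------------------------------------------
-- Simultaneous path problems

-- Costs are rational, since instances have to be finite strings.

record Input : Set where
  field
    graph : Graph

  open Graph graph public

  field
    k         : ℕ
    ⦃ k≢0 ⦄   : NonZero k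
    colour    : Vec (Subset m) k
    colour-⋃  : ⋃ (toList colour) ≡ ⊤
    s t       : Vertex
    s≢t       : s ≢ t
    cost      : Vec ℚ m

  total : List Edge → ℚ
  total es = foldr _+ℚ_ 0ℚ (map (lookup cost) es)

  totalˢ : Subset m → ℚ
  totalˢ S = total (filter (_∈? S) (allFin m))

Conservative : Input → Set
Conservative I =
  ∀ {v} (w : Walk graph directed v v) → IsDirectedCycle w → 0ℚ ≤ℚ total (edges w)
  where open Input I

NonNegative : Input → Set
NonNegative I = ∀ e → 0ℚ ≤ℚ lookup cost e
  where open Input I

Laminar : Input → Set
Laminar I = ∀ i j → let Aᵢ = lookup colour i; Aⱼ = lookup colour j in
  Nonempty (Aᵢ ∩ Aⱼ) → Aᵢ ⊆ Aⱼ ⊎ Aⱼ ⊆ Aᵢ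
  where open Input I

CostAssumption : Orientation → Input → Set
CostAssumption directed   = Conservative
CostAssumption undirected = NonNegative

data Mode : Set where
  exact superset : Mode

Fits : ∀ {n} → Mode → Subset n → Subset n → Set
Fits exact    B P = B ≡ P
Fits superset B P = P ⊆ B

module _ (mode : Mode) (o : Orientation) (I : Input) where
  open Input I

  Feasible : Subset m → Set
  Feasible A′ = ∀ i →
    Σ (Walk graph o s t) λ w → IsPath w × Fits mode (A′ ∩ lookup colour i) (edgeSet w)

  -- The answer nothing reports that there is no feasible set.
  Solves : Maybe (Subset m) → Set
  Solves (just A′) = Feasible A′ × (∀ B → Feasible B → totalˢ A′ ≤ℚ totalˢ B)
  Solves nothing   = ∀ B → ¬ Feasible B

------------------------------------------------------------------------
-- Encodings
--
-- Costs are written in binary.  Vertices are written in unary; this changes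
-- the length of an instance only polynomially, because the vertex set itself
-- is part of the instance.

encodeList : ∀ {A : Set} → (A → Tree) → List A → Tree
encodeList enc []       = nil
encodeList enc (x ∷ xs) = cons (enc x) (encodeList enc xs)

encodePair : ∀ {A B : Set} → (A → Tree) → (B → Tree) → A × B → Tree
encodePair encA encB (x , y) = cons (encA x) (encB y)

encodeBool : Bool → Tree
encodeBool false = nil
encodeBool true  = cons nil nil

encodeUnary : ℕ → Tree
encodeUnary n = encodeList (λ x → x) (replicate n nil)

encodeFin : ∀ {n} → Fin n → Tree
encodeFin i = encodeUnary (toℕ i)

encodeBinary : ℕᵇ → Tree
encodeBinary zero     = nil
encodeBinary 2[1+ b ] = cons (encodeBool false) (encodeBinary b)
encodeBinary 1+[2 b ] = cons (encodeBool true) (encodeBinary b)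

encodeℤ : ℤ → Tree
encodeℤ (+ n)    = cons (encodeBool false) (encodeBinary (fromℕ n))
encodeℤ -[1+ n ] = cons (encodeBool true) (encodeBinary (fromℕ (suc n)))

encodeℚ : ℚ → Tree
encodeℚ q = cons (encodeℤ (↥ q)) (encodeBinary (fromℕ (↧ₙ q)))

encodeSubset : ∀ {n} → Subset n → Tree
encodeSubset S = encodeList encodeBool (toList S)

encodeMaybe : ∀ {A : Set} → (A → Tree) → Maybe A → Tree
encodeMaybe enc nothing  = nil
encodeMaybe enc (just x) = cons (enc x) nil

encodeInput : Input → Tree
encodeInput I = encodeList (λ x → x)
  ( encodeUnary n
  ∷ encodeList (encodePair encodeFin encodeFin) (toList ends)
  ∷ encodeList encodeSubset (toList colour)
  ∷ encodeFin s
  ∷ encodeFin t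
  ∷ encodeList encodeℚ (toList cost)
  ∷ [])
  where open Input I

------------------------------------------------------------------------

SimultaneousProblem : Mode → Orientation → Problem
SimultaneousProblem mode o = record
  { Instance = ∃ (CostAssumption o)
  ; encode   = λ x → encodeInput (proj₁ x)
  ; Answer   = λ x → Maybe (Subset (Input.m (proj₁ x)))
  ; encodeᵃ  = encodeMaybe encodeSubset
  ; Correct  = λ x → Solves mode o (proj₁ x)
  }

ExactSimultaneousDipaths ExactSimultaneousPaths : Problem
ExactSimultaneousDipaths = SimultaneousProblem exact directed
ExactSimultaneousPaths   = SimultaneousProblem exact undirected

SupersetSimultaneousDipaths SupersetSimultaneousPaths : Problem
SupersetSimultaneousDipaths = SimultaneousProblem superset directed
SupersetSimultaneousPaths   = SimultaneousProblem superset undirected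

LaminarColours : ∀ {P : Input → Set} → ∃ P → Set
LaminarColours x = Laminar (proj₁ x)

{-# OPTIONS --safe #-}
module Submission where

-- Every class contains a minimal one, and by laminarity two minimal classes are
-- equal or disjoint.  For superset, a set is feasible as soon as it contains an
-- s-t path of each minimal class; all edges of negative cost are bought, and
-- with these free of charge, the problem splits into one shortest path problem
-- per minimal class.  For exact, no s-t path properly contains another one, so a
-- solution meets nested classes in the same path; hence if there is a solution
-- at all, the union of shortest paths of the minimal classes is an optimal one.
-- Whether this union is feasible is checked directly.
--
-- Shortest paths are found by the Bellman–Ford algorithm, run backwards from t.
-- Cycles have nonnegative cost, so a cheapest walk with the fewest edges among
-- the cheapest is a path.
--
-- For the running time, programs are built from computations that are closed
-- under composition, pairing, branching, and folds over lists whose intermediate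
-- results stay polynomially bounded.

open import Data.Bool.Base using (Bool; true; false; if_then_else_; _∧_; _∨_; not; T)
open import Data.Bool.ListAction using (all; any)
open import Data.Bool.Properties using (∧-assoc; ∧-identityʳ; ∧-zeroʳ; ∨-assoc; ∨-identityʳ) renaming (_≟_ to _≟ᵇ_)
open import Data.Fin.Base using (Fin; zero; suc; toℕ; fromℕ<)
open import Data.Fin.Properties using (injective⇒≤; toℕ-injective; toℕ<n; toℕ-fromℕ<; ¬∀⟶∃¬) renaming (_≟_ to _≟ᶠ_)
open import Data.Fin.Subset using (Subset; _∩_; _∪_; _⊆_; ⋃; ⁅_⁆; Nonempty; ∣_∣) renaming (_∈_ to _∈ˢ_; _∉_ to _∉ˢ_; ⊥ to ∅)
open import Data.Fin.Subset.Properties using (_⊆?_; ⊆-antisym; ⊆-trans; ⊆-refl; p⊂q⇒∣p∣<∣q∣; x∈⁅x⁆; x∈⁅y⁆⇒x≡y; x∈p∪q⁻; x∈p∪q⁺; x∈p∩q⁺; x∈p∩q⁻; ∉⊥; ∈⊤) renaming (_∈?_ to _∈ˢ?_)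
open import Data.Integer.Base as ℤ using (ℤ; -[1+_]) renaming (+_ to pos)
import Data.Integer.Properties as ℤ
import Data.Integer.Tactic.RingSolver as ℤSolver
import Data.List.Base as List
open import Data.List.Base using (List; []; _∷_; _++_; _ʳ++_; allFin; applyUpTo; downFrom; drop; filter; filterᵇ; foldl; foldr; length; map; replicate; reverse; tabulate; upTo)
open import Data.List.Membership.Propositional using (_∈_; _∉_)
open import Data.List.Membership.Propositional.Properties using (∈-++⁺ˡ; ∈-++⁺ʳ; ∈-allFin; ∈-filter⁺; ∈-filter⁻; ∈-lookup; ∈-map⁺; ∈-map⁻; ∈-upTo⁺; ∈-upTo⁻)
open import Data.List.Properties using (++-assoc; ++-identityʳ; foldl-++; foldl-map; length-++; length-map; length-replicate; length-upTo; map-++; map-cong; map-tabulate; map-upTo; map-∘; reverse-downFrom; reverse-foldl; reverse-involutive; ʳ++-defn)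
open import Data.List.Relation.Unary.All as All using (All; []; _∷_)
import Data.List.Relation.Unary.All.Properties as All
open import Data.List.Relation.Unary.AllPairs using ([]; _∷_)
open import Data.List.Relation.Unary.Any using (here; there)
open import Data.List.Relation.Unary.Unique.Propositional using (Unique)
open import Data.Maybe.Base as Maybe using (Maybe; just; nothing; maybe′)
open import Data.Maybe.Properties using (just-injective)
open import Data.Nat.Base using (ℕ; zero; suc; pred; _+_; _*_; _∸_; _^_; _≤_; _<_; _≡ᵇ_; _<ᵇ_; z≤n; s≤s)
import Data.Nat.Base as ℕ
open import Data.Nat.Binary.Base using (ℕᵇ; zero; 2[1+_]; 1+[2_]; fromℕ) renaming (toℕ to toℕᵇ)
open import Data.Nat.Binary.Properties using (fromℕ-toℕ; toℕ-fromℕ)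
open import Data.Nat.Induction using (<-wellFounded)
open import Data.Nat.Properties
import Data.Nat.Properties as ℕ
open import Data.Nat.Tactic.RingSolver using (solve-∀)
open import Data.Product.Base using (Σ; ∃; ∃₂; _×_; _,_; proj₁; proj₂; swap)
open import Data.Product.Properties using (,-injectiveˡ; ,-injectiveʳ)
open import Data.Rational.Base using (ℚ; mkℚ; 0ℚ; toℚᵘ; ↥_; ↧ₙ_)
import Data.Rational.Base as ℚ
import Data.Rational.Properties as ℚ
open import Data.Rational.Unnormalised.Base as ℚᵘ using (mkℚᵘ; *≡*; *<*) renaming (_≃_ to _≃ᵘ_)
import Data.Rational.Unnormalised.Properties as ℚᵘ
open import Data.Sum.Base using (_⊎_; inj₁; inj₂)
open import Data.Unit.Base using (⊤; tt)
open import Data.Vec.Base as Vec using (Vec; lookup; toList) renaming ([] to []ᵛ; _∷_ to _∷ᵛ_)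
open import Data.Vec.Membership.Propositional.Properties using (∈-toList⁺; ∈-toList⁻)
import Data.Vec.Membership.Propositional.Properties as Vec
open import Data.Vec.Properties using ([]=⇒lookup; lookup⇒[]=; lookup-replicate; lookup-zipWith; lookup∘tabulate; lookup∘update; lookup∘update′) renaming (≡-dec to ≡ᵛ-dec)
import Data.Vec.Relation.Unary.Any as Vec
import Data.Vec.Relation.Unary.Any.Properties as Vec
open import Function.Base using (_∘_; id)
open import Induction.WellFounded using (Acc; acc)
open import Relation.Binary.PropositionalEquality
open import Relation.Nullary using (yes; no; ¬_; contradiction)
open import Relation.Nullary.Decidable using (T?; decidable-stable; _→-dec_)
open import Defs

-- Polynomial domination

-- In the exact case, the path in which a solution `B` meets nested classes is nonempty, because s
-- and t are distinct. So two minimal classes inside one class `C` share an edge of `B` and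
-- coincide, and a class that includes `C` is minimal only if it equals the minimal class below `C`.
-- Hence the computed union meets `C` in the chosen path of a single minimal class. This path is a
-- certificate: the feasibility check compares the intersection with the paths computed for the
-- classes. As the classes cover all edges, `B` also lies within the minimal ones, so its cost
-- splits along them even if some costs are negative.
--
-- Since the machine charges for the size of stored trees, a polynomial number of iterations is not
-- enough: every fold needs a bound on its accumulators. Costs are added as unreduced fractions with
-- numerators and denominators below powers of two; a round of Bellman-Ford raises the exponent by a
-- fixed amount, as all entries are computed from the previous table.

infix 4 _≼_

-- With base `2 + μ i`, which is at least 2, a single exponent absorbs all coefficients: a constant
-- `c` is at most `2 ^ c`, a product adds exponents, and a sum costs one further factor.
record _≼_ {I : Set} (T μ : I → ℕ) : Set where
  constructor dominated
  field
    degree : ℕ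
    bound  : ∀ i → T i ≤ (2 + μ i) ^ degree

open _≼_

module _ {I : Set} {μ : I → ℕ} where

  ≼-const : ∀ c → (λ _ → c) ≼ μ
  ≼-const c = dominated c λ i → ≤-trans (n≤2^n c) (^-monoˡ-≤ c (m≤m+n 2 (μ i)))
    where
    n≤2^n : ∀ n → n ≤ 2 ^ n
    n≤2^n zero    = z≤n
    n≤2^n (suc n) = +-mono-≤ (m^n>0 2 n) (≤-trans (n≤2^n n) (m≤m+n (2 ^ n) 0))

  ≼-refl : μ ≼ μ
  ≼-refl = dominated 1 λ i → ≤-trans (m≤n+m (μ i) 2) (≤-reflexive (sym (*-identityʳ _)))

  ≼-≤ : ∀ {T U : I → ℕ} → (∀ i → T i ≤ U i) → U ≼ μ → T ≼ μ
  ≼-≤ T≤U (dominated d b) = dominated d λ i → ≤-trans (T≤U i) (b i)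

  ≼-≤ʳ : ∀ {ν T : I → ℕ} → (∀ i → ν i ≤ μ i) → T ≼ ν → T ≼ μ
  ≼-≤ʳ ν≤μ (dominated d b) = dominated d λ i →
    ≤-trans (b i) (^-monoˡ-≤ d (+-monoʳ-≤ 2 (ν≤μ i)))

  ≼-* : ∀ {T U : I → ℕ} → T ≼ μ → U ≼ μ → (λ i → T i * U i) ≼ μ
  ≼-* (dominated d b) (dominated e c) = dominated (d + e) λ i →
    ≤-trans (*-mono-≤ (b i) (c i)) (≤-reflexive (sym (^-distribˡ-+-* (2 + μ i) d e)))

  ≼-+ : ∀ {T U : I → ℕ} → T ≼ μ → U ≼ μ → (λ i → T i + U i) ≼ μ
  ≼-+ (dominated d b) (dominated e c) = dominated (1 + (d + e)) λ i →
    let N = 2 + μ i in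
    ≤-trans (+-mono-≤ (≤-trans (b i) (^-monoʳ-≤ N (m≤m+n d e)))
                      (≤-trans (c i) (^-monoʳ-≤ N (m≤n+m e d))))
            (≤-trans (≤-reflexive (double (N ^ (d + e)))) (*-monoˡ-≤ (N ^ (d + e)) (m≤m+n 2 (μ i))))
    where
    double : ∀ x → x + x ≡ 2 * x
    double x = cong (x +_) (sym (+-identityʳ x))

  ≼-^ : ∀ {T : I → ℕ} d → T ≼ μ → (λ i → T i ^ d) ≼ μ
  ≼-^ d (dominated e c) = dominated (e * d) λ i →
    ≤-trans (^-monoˡ-≤ d (c i)) (≤-reflexive (^-*-assoc (2 + μ i) e d))

  ≼-trans : ∀ {ν T : I → ℕ} → T ≼ ν → ν ≼ μ → T ≼ μ
  ≼-trans (dominated d b) ν≼μ = ≼-≤ b (≼-^ d (≼-+ (≼-const 2) ν≼μ))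

≼-reindex : ∀ {I J : Set} {μ T : I → ℕ} (h : J → I) → T ≼ μ → (T ∘ h) ≼ (μ ∘ h)
≼-reindex h (dominated d b) = dominated d (b ∘ h)

-- Computations on four registers; names of rules for them end in C

pattern result   = zero
pattern stack = suc zero
pattern tmp   = suc (suc zero)
pattern aux   = suc (suc (suc zero))

registers : Tree → Tree → Tree → Tree → Store 4
registers a s b c = a ∷ᵛ s ∷ᵛ b ∷ᵛ c ∷ᵛ []ᵛ

Within : ∀ {r} → Cmd r → Store r → Store r → ℕ → Set
Within p σ τ N = ∃ λ t → Run p σ τ t × t ≤ N

assignment : ∀ {r x e} {σ : Store r} → Within (x := e) σ _ (1 + size (eval σ e))
assignment = _ , assign , ≤-refl

module _ {r} {σ τ : Store r} where

  infixr 5 _▸_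
  _▸_ : ∀ {υ p q M N} → Within p σ τ M → Within q τ υ N → Within (p ⨾ q) σ υ (M + N)
  (_ , r , t≤M) ▸ (_ , r′ , u≤N) = _ , seq r r′ , +-mono-≤ t≤M u≤N

  within-≤ : ∀ {p M N} → M ≤ N → Within p σ τ M → Within p σ τ N
  within-≤ M≤N (t , r , t≤M) = t , r , ≤-trans t≤M M≤N

size-positive : ∀ x → 1 ≤ size x
size-positive nil        = s≤s z≤n
size-positive (cons x y) = s≤s z≤n

-- Every assignment pays for the tree it stores, so a register outgrows its initial size by at most
-- the elapsed time. This turns time bounds into size bounds, which composition needs: the second
-- computation is timed on the output of the first.
Run-size : ∀ {r p t} {σ τ : Store r} → Run p σ τ t → ∀ i → size (lookup τ i) ≤ size (lookup σ i) + t
Run-size {σ = σ} (assign {x} {e}) i with i ≟ᶠ x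
... | yes refl rewrite lookup∘update i σ (eval σ e) =
  ≤-trans (n≤1+n _) (m≤n+m _ (size (lookup σ i)))
... | no i≢x rewrite lookup∘update′ i≢x σ (eval σ e) = m≤m+n _ _
Run-size {σ = σ} (seq {t = t} r r′) i =
  ≤-trans (Run-size r′ i) (≤-trans (+-monoˡ-≤ _ (Run-size r i))
    (≤-reflexive (+-assoc (size (lookup σ i)) t _)))
Run-size (cond-true _ r)  i = ≤-trans (Run-size r i) (+-monoʳ-≤ _ (n≤1+n _))
Run-size (cond-false _ r) i = ≤-trans (Run-size r i) (+-monoʳ-≤ _ (n≤1+n _))
Run-size (while-stop _) i = m≤m+n _ 1
Run-size {σ = σ} (while-step {t = t} _ r r′) i =
  ≤-trans (Run-size r′ i) (≤-trans (+-monoˡ-≤ _ (Run-size r i))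
    (≤-trans (≤-reflexive (+-assoc (size (lookup σ i)) t _)) (+-monoʳ-≤ _ (n≤1+n _))))

-- The register stack is preserved, so that a computation can be used as a
-- subroutine; tmp and aux are scratch.
record Computable {X : Set} (e f : X → Tree) : Set where
  field
    code      : Cmd 4
    time      : X × Tree → ℕ
    time-poly : time ≼ λ (x , s) → size (e x) + size s
    run       : ∀ x s b c → ∃₂ λ b′ c′ →
                Within code (registers (e x) s b c) (registers (f x) s b′ c′) (time (x , s))

open Computable

module _ {X : Set} where

  input : (X → Tree) → X × Tree → ℕ
  input e (x , s) = size (e x) + size s

  input-tree : ∀ (e : X → Tree) → (λ (x , s) → size (e x)) ≼ input e
  input-tree e = ≼-≤ (λ (x , s) → m≤m+n (size (e x)) (size s)) ≼-refl

  input-stack : ∀ (e : X → Tree) → (λ (x , s) → size s) ≼ input e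
  input-stack e = ≼-≤ (λ (x , s) → m≤n+m (size s) (size (e x))) ≼-refl

  output-size : ∀ {e f : X → Tree} → Computable e f → (size ∘ f) ≼ (size ∘ e)
  output-size {e} {f} F = ≼-≤ bounded
    -- The run is taken with the empty stack, of size 1, so that the bound depends on the input
    -- alone.
    (≼-+ ≼-refl (≼-trans (≼-reindex (λ x → x , nil) (time-poly F)) (≼-+ ≼-refl (≼-const 1))))
    where
    bounded : ∀ x → size (f x) ≤ size (e x) + time F (x , nil)
    bounded x with run F x nil nil nil
    ... | _ , _ , _ , r , t≤ = ≤-trans (Run-size r result) (+-monoʳ-≤ (size (e x)) t≤)

  output-input : ∀ {e f : X → Tree} → Computable e f → (λ (x , s) → size (f x)) ≼ input e
  output-input {e} F = ≼-trans (≼-reindex proj₁ (output-size F)) (input-tree e)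

  reindexC : ∀ {Y : Set} {e f : X → Tree} (h : Y → X) → Computable e f → Computable (e ∘ h) (f ∘ h)
  reindexC h F = record
    { code = code F ; time = λ (y , s) → time F (h y , s)
    ; time-poly = ≼-reindex (λ (y , s) → h y , s) (time-poly F)
    ; run = λ y → run F (h y) }

  extC : ∀ {e e′ f f′ : X → Tree} → (∀ x → e x ≡ e′ x) → (∀ x → f x ≡ f′ x) →
         Computable e f → Computable e′ f′
  extC {e} {e′} {f} {f′} e≗ f≗ F = record
    { code = code F ; time = time F
    ; time-poly = ≼-≤ʳ (λ (x , s) → ≤-reflexive (cong (λ z → size z + size s) (e≗ x))) (time-poly F)
    ; run = λ x s b c → subst₂ (λ u v → ∃₂ λ b′ c′ →
        Within (code F) (registers u s b c) (registers v s b′ c′) (time F (x , s))) (e≗ x) (f≗ x) (run F x s b c) }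

  idC : ∀ {e : X → Tree} → Computable e e
  idC {e} = record
    { code = result := var result ; time = λ (x , s) → 1 + size (e x)
    ; time-poly = ≼-+ (≼-const 1) (input-tree e)
    ; run = λ x s b c → _ , _ , assignment }

  nilC : ∀ {e : X → Tree} → Computable e (λ _ → nil)
  nilC = record
    { code = result := nilᵉ ; time = λ _ → 2 ; time-poly = ≼-const 2
    ; run = λ x s b c → _ , _ , assignment }

  size-hd : ∀ x → size (hd x) ≤ size x
  size-hd nil        = ≤-refl
  size-hd (cons x y) = ≤-trans (m≤m+n _ _) (n≤1+n _)

  size-tl : ∀ x → size (tl x) ≤ size x
  size-tl nil        = ≤-refl
  size-tl (cons x y) = ≤-trans (m≤n+m _ (size x)) (n≤1+n _)

  hdC : ∀ {e : X → Tree} → Computable e (hd ∘ e)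
  hdC {e} = record
    { code = result := hdᵉ result ; time = λ (x , s) → 1 + size (hd (e x))
    ; time-poly = ≼-+ (≼-const 1) (≼-≤ (λ (x , s) → size-hd (e x)) (input-tree e))
    ; run = λ x s b c → _ , _ , assignment }

  tlC : ∀ {e : X → Tree} → Computable e (tl ∘ e)
  tlC {e} = record
    { code = result := tlᵉ result ; time = λ (x , s) → 1 + size (tl (e x))
    ; time-poly = ≼-+ (≼-const 1) (≼-≤ (λ (x , s) → size-tl (e x)) (input-tree e))
    ; run = λ x s b c → _ , _ , assignment }

  infixr 5 _then_
  _then_ : ∀ {e f g : X → Tree} → Computable e f → Computable f g → Computable e g
  _then_ {e} F G = record
    { code = code F ⨾ code G ; time = λ i → time F i + time G i
    ; time-poly = ≼-+ (time-poly F) (≼-trans (time-poly G) (≼-+ (output-input F) (input-stack e)))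
    ; run = λ x s b c → let b′ , c′ , r = run F x s b c in
                        let b″ , c″ , r′ = run G x s b′ c′ in b″ , c″ , r ▸ r′ }

  -- `code F` overwrites `result`, so the input waits on the stack and is then exchanged for `f x`,
  -- which waits there during `code G`. A push stores, and pays for, the whole stack; this is why
  -- `time` depends on the stack too.
  pairC : ∀ {e f g : X → Tree} → Computable e f → Computable e g →
          Computable e (λ x → cons (f x) (g x))
  pairC {e} {f} {g} F G = record
    { code = stack := consᵉ result stack ⨾ code F
           ⨾ tmp := hdᵉ stack ⨾ stack := tlᵉ stack ⨾ stack := consᵉ result stack ⨾ result := var tmp
           ⨾ code G
           ⨾ tmp := hdᵉ stack ⨾ stack := tlᵉ stack ⨾ result := consᵉ tmp result
    -- Inferred; the ten summands in `time-poly` follow the commands of `code` in order.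
    ; time = _
    ; time-poly =
        ≼-+ (≼-+ (≼-const 1) (≼-+ (≼-+ (≼-const 1) (input-tree e)) (input-stack e)))
        (≼-+ (≼-trans (≼-reindex (λ (x , s) → x , cons (e x) s) (time-poly F))
                (≼-+ (input-tree e) (≼-+ (≼-+ (≼-const 1) (input-tree e)) (input-stack e))))
        (≼-+ (≼-+ (≼-const 1) (input-tree e))
        (≼-+ (≼-+ (≼-const 1) (input-stack e))
        (≼-+ (≼-+ (≼-const 1) (≼-+ (≼-+ (≼-const 1) (output-input F)) (input-stack e)))
        (≼-+ (≼-+ (≼-const 1) (input-tree e))
        (≼-+ (≼-trans (≼-reindex (λ (x , s) → x , cons (f x) s) (time-poly G))
                (≼-+ (input-tree e) (≼-+ (≼-+ (≼-const 1) (output-input F)) (input-stack e))))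
        (≼-+ (≼-+ (≼-const 1) (output-input F))
        (≼-+ (≼-+ (≼-const 1) (input-stack e))
        (≼-+ (≼-const 1) (≼-+ (≼-+ (≼-const 1) (output-input F)) (output-input G)))))))))))
    ; run = λ x s b c →
        let b₁ , c₁ , r₁ = run F x (cons (e x) s) b c in
        let b₂ , c₂ , r₂ = run G x (cons (f x) s) (e x) c₁ in
        _ , _ , assignment ▸ r₁ ▸ assignment ▸ assignment ▸ assignment ▸ assignment
              ▸ r₂ ▸ assignment ▸ assignment ▸ assignment }

  -- The domain of each branch consists of the inputs that reach it, so a branch may rely on the
  -- outcome of the test, as in `maybeP`. Its `time` then takes that proof as an argument; the total
  -- time uses the polynomial bound `N` instead, which does not.
  branchC : ∀ {e m g : X → Tree} → Computable e m →
            Computable {Σ X λ x → m x ≢ nil} (e ∘ proj₁) (g ∘ proj₁) →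
            Computable {Σ X λ x → m x ≡ nil} (e ∘ proj₁) (g ∘ proj₁) →
            Computable e g
  branchC {e} {m} {g} M P Q = record
    { code = stack := consᵉ result stack ⨾ code M
           ⨾ tmp := var result ⨾ result := hdᵉ stack ⨾ stack := tlᵉ stack
           ⨾ cond tmp (code P) (code Q)
    ; time = λ (x , s) → (1 + (1 + size (e x) + size s)) + (time M (x , cons (e x) s)
           + ((1 + size (m x)) + ((1 + size (e x)) + ((1 + size s) + (1 + (N P x s + N Q x s))))))
    ; time-poly =
        ≼-+ (≼-+ (≼-const 1) (≼-+ (≼-+ (≼-const 1) (input-tree e)) (input-stack e)))
        (≼-+ (≼-trans (≼-reindex (λ (x , s) → x , cons (e x) s) (time-poly M))
                (≼-+ (input-tree e) (≼-+ (≼-+ (≼-const 1) (input-tree e)) (input-stack e))))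
        (≼-+ (≼-+ (≼-const 1) (output-input M))
        (≼-+ (≼-+ (≼-const 1) (input-tree e))
        (≼-+ (≼-+ (≼-const 1) (input-stack e))
        (≼-+ (≼-const 1) (≼-+ (N-poly P) (N-poly Q)))))))
    ; run = λ x s b c →
        let b₁ , c₁ , r₁ = run M x (cons (e x) s) b c in
        let b₂ , c₂ , r₂ = test x s (m x) c₁ refl in
        b₂ , c₂ , (assignment ▸ r₁ ▸ assignment ▸ assignment ▸ assignment ▸ r₂) }
    where
    N : ∀ {D : X → Set} → Computable {Σ X D} (e ∘ proj₁) (g ∘ proj₁) → X → Tree → ℕ
    N F x s = (2 + (size (e x) + size s)) ^ degree (time-poly F)
    N-poly : ∀ {D : X → Set} (F : Computable {Σ X D} (e ∘ proj₁) (g ∘ proj₁)) →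
             (λ (x , s) → N F x s) ≼ input e
    N-poly F = ≼-^ (degree (time-poly F)) (≼-+ (≼-const 2) ≼-refl)
    test : ∀ x s z c → m x ≡ z → ∃₂ λ b′ c′ →
      Within (cond tmp (code P) (code Q)) (registers (e x) s z c) (registers (g x) s b′ c′)
        (1 + (N P x s + N Q x s))
    test x s nil c eq = let b′ , c′ , t , r , t≤ = run Q (x , eq) s nil c in
      b′ , c′ , 1 + t , cond-false refl r ,
        s≤s (≤-trans t≤ (≤-trans (bound (time-poly Q) ((x , eq) , s)) (m≤n+m _ (N P x s))))
    test x s z@(cons _ _) c eq =
      let neq = λ eq′ → cons≢nil (trans (sym eq) eq′) in
      let b′ , c′ , t , r , t≤ = run P (x , neq) s z c in
      b′ , c′ , 1 + t , cond-true cons≢nil r ,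
        s≤s (≤-trans t≤ (≤-trans (bound (time-poly P) ((x , neq) , s)) (m≤m+n _ (N Q x s))))
      where
      cons≢nil : ∀ {y z} → cons y z ≢ nil
      cons≢nil ()

-- Loops over lists

module _ {X E A : Set} {γ : X → Tree} {encE : E → Tree} {encA : A → Tree}
         (l : X → List E) (a₀ : X → A) (step : X → E → A → A) where

  Prefix : Set
  Prefix = Σ X λ x → Σ (List E) λ l₁ → Σ (List E) λ l₂ → l₁ ++ l₂ ≡ l x

  private
    L : List E → Tree
    L = encodeList encE

    partialFold : X → List E → A
    partialFold x = foldl (λ a e → step x e a) (a₀ x)

    foldInput : X → Tree
    foldInput x = cons (γ x) (cons (L (l x)) (encA (a₀ x)))

    stepInput : X × E × A → Tree
    stepInput (x , e , a) = cons (γ x) (cons (encE e) (encA a))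

    suffix-size : ∀ l₁ l₂ → size (L l₂) ≤ size (L (l₁ ++ l₂))
    suffix-size []       l₂ = ≤-refl
    suffix-size (e ∷ l₁) l₂ = ≤-trans (suffix-size l₁ l₂) (m≤n+m _ (1 + size (encE e)))

    length-size : ∀ l → length l ≤ size (L l)
    length-size []      = z≤n
    length-size (e ∷ l) = s≤s (≤-trans (length-size l) (m≤n+m _ (size (encE e))))

    -- One quantity `Q` dominates each assignment of the loop body. The slacks `δ` and `ε` turn the
    -- bounds on the remaining list and on the accumulator into equations, so that the inequalities
    -- reduce to ring identities.
    module Costs (a e r γ′ s δ ε : ℕ) where
      Q = 3 + (γ′ + ((1 + e + r) + δ) + (a + ε) + s)

      c₁ : 1 + e ≤ Q
      c₁ = subst (1 + e ≤_) (lemma e r a γ′ s δ ε) (m≤m+n _ (3 + γ′ + r + δ + a + ε + s))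
        where lemma : ∀ e r a γ′ s δ ε → 1 + e + (3 + γ′ + r + δ + a + ε + s) ≡ 3 + (γ′ + ((1 + e + r) + δ) + (a + ε) + s)
              lemma = solve-∀
      c₂ : 1 + (1 + e + a) ≤ Q
      c₂ = subst (1 + (1 + e + a) ≤_) (lemma e r a γ′ s δ ε) (m≤m+n _ (2 + γ′ + r + δ + ε + s))
        where lemma : ∀ e r a γ′ s δ ε → 1 + (1 + e + a) + (2 + γ′ + r + δ + ε + s) ≡ 3 + (γ′ + ((1 + e + r) + δ) + (a + ε) + s)
              lemma = solve-∀
      c₃ : 1 + r ≤ Q
      c₃ = subst (1 + r ≤_) (lemma e r a γ′ s δ ε) (m≤m+n _ (3 + γ′ + e + δ + a + ε + s))
        where lemma : ∀ e r a γ′ s δ ε → 1 + r + (3 + γ′ + e + δ + a + ε + s) ≡ 3 + (γ′ + ((1 + e + r) + δ) + (a + ε) + s)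
              lemma = solve-∀
      c₄ : 1 + (1 + γ′ + s) ≤ Q
      c₄ = subst (1 + (1 + γ′ + s) ≤_) (lemma e r a γ′ s δ ε) (m≤m+n _ (2 + e + r + δ + a + ε))
        where lemma : ∀ e r a γ′ s δ ε → 1 + (1 + γ′ + s) + (2 + e + r + δ + a + ε) ≡ 3 + (γ′ + ((1 + e + r) + δ) + (a + ε) + s)
              lemma = solve-∀
      c₅ : 1 + γ′ ≤ Q
      c₅ = ≤-trans (s≤s (≤-trans (m≤m+n γ′ s) (n≤1+n _))) c₄
      c₆ : 1 + (1 + γ′ + (1 + e + a)) ≤ Q
      c₆ = subst (1 + (1 + γ′ + (1 + e + a)) ≤_) (lemma e r a γ′ s δ ε) (m≤m+n _ (1 + r + δ + ε + s))
        where lemma : ∀ e r a γ′ s δ ε → 1 + (1 + γ′ + (1 + e + a)) + (1 + r + δ + ε + s) ≡ 3 + (γ′ + ((1 + e + r) + δ) + (a + ε) + s)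
              lemma = solve-∀
      c₇ : 1 + (1 + r + (1 + γ′ + s)) ≤ Q
      c₇ = subst (1 + (1 + r + (1 + γ′ + s)) ≤_) (lemma e r a γ′ s δ ε) (m≤m+n _ (1 + e + δ + a + ε))
        where lemma : ∀ e r a γ′ s δ ε → 1 + (1 + r + (1 + γ′ + s)) + (1 + e + δ + a + ε) ≡ 3 + (γ′ + ((1 + e + r) + δ) + (a + ε) + s)
              lemma = solve-∀

  -- A polynomial-time step may still double its accumulator in every iteration. Hence
  -- `prefix-bound`, which concerns only the accumulators that really occur, namely those after a
  -- prefix of the given list.
  foldC : Computable stepInput (λ (x , e , a) → encA (step x e a)) →
          (λ ((x , l₁ , _) : Prefix) → size (encA (partialFold x l₁))) ≼ (λ (x , _) → size (foldInput x)) →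
          Computable foldInput (λ x → encA (foldl (λ a e → step x e a) (a₀ x) (l x)))
  foldC S prefix-bound = record
    { code = tmp := hdᵉ result ⨾ aux := tlᵉ result ⨾ stack := consᵉ tmp stack
           ⨾ tmp := hdᵉ aux ⨾ result := tlᵉ aux ⨾ stack := consᵉ tmp stack
           ⨾ while tmp body ⨾ stack := tlᵉ stack ⨾ stack := tlᵉ stack
    ; time = _
    ; time-poly =
        ≼-+ (≼-+ (≼-const 1) γ≼)
        (≼-+ (≼-+ (≼-const 1) (≼-+ (≼-+ (≼-const 1) L≼) a≼))
        (≼-+ (≼-+ (≼-const 1) (≼-+ (≼-+ (≼-const 1) γ≼) s≼))
        (≼-+ (≼-+ (≼-const 1) L≼)
        (≼-+ (≼-+ (≼-const 1) a≼)
        (≼-+ (≼-+ (≼-const 1) (≼-+ (≼-+ (≼-const 1) L≼) (≼-+ (≼-+ (≼-const 1) γ≼) s≼)))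
        (≼-+ loopTime≼
        (≼-+ (≼-+ (≼-const 1) (≼-+ (≼-+ (≼-const 1) γ≼) s≼))
        (≼-+ (≼-const 1) s≼))))))))
    ; run = λ x s b c → let c′ , r = loop x s [] (l x) refl (cons (L (l x)) (encA (a₀ x))) in
        nil , c′ ,
        (assignment ▸ assignment ▸ assignment ▸ assignment ▸ assignment ▸ assignment ▸
         r ▸ assignment ▸ assignment) }
    where
    -- Invariant at the test: `result` holds the accumulator, the stack holds the remaining list
    -- above `γ x`, and `tmp` is a copy of that list. The original is kept on the stack because
    -- `code S` may destroy `tmp` and `aux`.
    body : Cmd 4
    body = aux := hdᵉ tmp ⨾ result := consᵉ aux result ⨾ tmp := tlᵉ tmp
         ⨾ stack := tlᵉ stack ⨾ aux := hdᵉ stack ⨾ result := consᵉ aux result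
         ⨾ stack := consᵉ tmp stack ⨾ code S ⨾ tmp := hdᵉ stack

    d = degree (time-poly S)
    α : X → ℕ
    α x = (2 + size (foldInput x)) ^ degree prefix-bound
    Q K loopTime : X × Tree → ℕ
    Q (x , s) = 3 + (size (γ x) + size (L (l x)) + α x + size s)
    -- Eight assignments cost at most `Q` each; the input of `S` and the stack during its run have
    -- size at most `Q` each.
    K i = 8 * Q i + (2 + (Q i + Q i)) ^ d
    loopTime (x , s) = 1 + size (L (l x)) * (1 + K (x , s))

    μ = input foldInput
    γ≼ : (λ (x , s) → size (γ x)) ≼ μ
    γ≼ = ≼-≤ (λ (x , s) → ≤-trans (m≤m+n _ _) (n≤1+n _)) (input-tree foldInput)
    L≼ : (λ (x , s) → size (L (l x))) ≼ μ
    L≼ = ≼-≤ (λ (x , s) → ≤-trans (≤-trans (m≤m+n _ _) (n≤1+n _)) (≤-trans (m≤n+m _ (size (γ x))) (n≤1+n _))) (input-tree foldInput)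
    a≼ : (λ (x , s) → size (encA (a₀ x))) ≼ μ
    a≼ = ≼-≤ (λ (x , s) → ≤-trans (≤-trans (m≤n+m _ (size (L (l x)))) (n≤1+n _)) (≤-trans (m≤n+m _ (size (γ x))) (n≤1+n _))) (input-tree foldInput)
    s≼ : (λ (x , s) → size s) ≼ μ
    s≼ = (input-stack foldInput)
    α≼ : (λ (x , s) → α x) ≼ μ
    α≼ = ≼-^ (degree prefix-bound) (≼-+ (≼-const 2) (input-tree foldInput))
    Q≼ : Q ≼ μ
    Q≼ = ≼-+ (≼-const 3) (≼-+ (≼-+ (≼-+ γ≼ L≼) α≼) s≼)
    K≼ : K ≼ μ
    K≼ = ≼-+ (≼-* (≼-const 8) Q≼) (≼-^ d (≼-+ (≼-const 2) (≼-+ Q≼ Q≼)))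
    loopTime≼ : loopTime ≼ μ
    loopTime≼ = ≼-+ (≼-const 1) (≼-* L≼ (≼-+ (≼-const 1) K≼))

    nonempty : ∀ {x y} → cons x y ≢ nil
    nonempty ()

    iteration : ∀ x s l₁ e l₂ → l₁ ++ e ∷ l₂ ≡ l x → ∀ c → ∃ λ c′ →
      Within body (registers (encA (partialFold x l₁)) (cons (L (e ∷ l₂)) (cons (γ x) s)) (L (e ∷ l₂)) c)
                  (registers (encA (step x e (partialFold x l₁))) (cons (L l₂) (cons (γ x) s)) (L l₂) c′)
                  (K (x , s))
    iteration x s l₁ e l₂ eq c =
      let a = partialFold x l₁
          b₁ , c₁ , r = run S (x , e , a) (cons (L l₂) (cons (γ x) s)) (L l₂) (γ x) in
      c₁ , within-≤ total (assignment ▸ assignment ▸ assignment ▸ assignment ▸ assignment ▸ assignment ▸ assignment ▸ r ▸ assignment)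
      where
      a′ = size (encA (partialFold x l₁))
      δ = m≤n⇒∃[o]m+o≡n (≤-trans (suffix-size l₁ (e ∷ l₂)) (≤-reflexive (cong (size ∘ L) eq)))
      ε = m≤n⇒∃[o]m+o≡n (bound prefix-bound (x , l₁ , e ∷ l₂ , eq))
      module C = Costs a′ (size (encE e)) (size (L l₂)) (size (γ x)) (size s) (proj₁ δ) (proj₁ ε)
      Q≡ : C.Q ≡ Q (x , s)
      Q≡ = cong₂ (λ u v → 3 + (size (γ x) + u + v + size s)) (proj₂ δ) (proj₂ ε)
      q : ∀ {n} → n ≤ C.Q → n ≤ Q (x , s)
      q n≤ = ≤-trans n≤ (≤-reflexive Q≡)
      stepTime : time S ((x , e , partialFold x l₁) , cons (L l₂) (cons (γ x) s)) ≤ (2 + (Q (x , s) + Q (x , s))) ^ d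
      stepTime = ≤-trans (bound (time-poly S) _)
        (^-monoˡ-≤ d (+-monoʳ-≤ 2 (+-mono-≤ (≤-trans (n≤1+n _) (q C.c₆)) (≤-trans (n≤1+n _) (q C.c₇)))))
      assoc : ∀ q p → q + (q + (q + (q + (q + (q + (q + (p + q))))))) ≡ 8 * q + p
      assoc = solve-∀
      total = ≤-trans (+-mono-≤ (q C.c₁) (+-mono-≤ (q C.c₂) (+-mono-≤ (q C.c₃) (+-mono-≤ (q C.c₄)
                (+-mono-≤ (q C.c₅) (+-mono-≤ (q C.c₆) (+-mono-≤ (q C.c₇) (+-mono-≤ stepTime (q C.c₃)))))))))
              (≤-reflexive (assoc (Q (x , s)) _))

    loop′ : ∀ x s l₁ l₂ → l₁ ++ l₂ ≡ l x → ∀ c → ∃ λ c′ →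
      Within (while tmp body)
        (registers (encA (partialFold x l₁)) (cons (L l₂) (cons (γ x) s)) (L l₂) c)
        (registers (encA (partialFold x (l x))) (cons nil (cons (γ x) s)) nil c′)
        (1 + length l₂ * (1 + K (x , s)))
    loop′ x s l₁ [] eq c rewrite trans (sym (++-identityʳ l₁)) eq = c , 1 , while-stop refl , ≤-refl
    loop′ x s l₁ (e ∷ l₂) eq c =
      let c₁ , t , r , t≤ = iteration x s l₁ e l₂ eq c
          snoc = foldl-++ (λ a e → step x e a) (a₀ x) l₁ (e ∷ [])
          c₂ , u , r′ , u≤ = loop′ x s (l₁ ++ e ∷ []) l₂ (trans (++-assoc l₁ (e ∷ []) l₂) eq) c₁ in
      c₂ , 1 + t + u ,
      while-step nonempty r (subst (λ a → Run (while tmp body) (registers (encA a) (cons (L l₂) (cons (γ x) s)) (L l₂) c₁)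
        (registers (encA (partialFold x (l x))) (cons nil (cons (γ x) s)) nil c₂) u) snoc r′) ,
      ≤-trans (+-mono-≤ (s≤s t≤) u≤) (≤-reflexive (+-suc (1 + K (x , s)) _))

    loop : ∀ x s l₁ l₂ → l₁ ++ l₂ ≡ l x → ∀ c → ∃ λ c′ →
      Within (while tmp body)
        (registers (encA (partialFold x l₁)) (cons (L l₂) (cons (γ x) s)) (L l₂) c)
        (registers (encA (partialFold x (l x))) (cons nil (cons (γ x) s)) nil c′)
        (loopTime (x , s))
    loop x s l₁ l₂ eq c = let c′ , r = loop′ x s l₁ l₂ eq c in
      c′ , within-≤ (s≤s (*-monoˡ-≤ (1 + K (x , s)) (≤-trans (length-size l₂)
        (≤-trans (suffix-size l₁ l₂) (≤-reflexive (cong (size ∘ L) eq)))))) r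

-- Typed computations; names of rules for them end in P

infixr 6 _⊗_

-- Numbers of type unary are encoded in unary, those of type nat in binary.
data Ty : Set where
  unit bool unary nat : Ty
  _⊗_                 : Ty → Ty → Ty
  list maybe          : Ty → Ty

⟦_⟧ : Ty → Set
⟦ unit ⟧    = ⊤
⟦ bool ⟧    = Bool
⟦ unary ⟧   = ℕ
⟦ nat ⟧     = ℕ
⟦ σ ⊗ τ ⟧   = ⟦ σ ⟧ × ⟦ τ ⟧
⟦ list σ ⟧  = List ⟦ σ ⟧
⟦ maybe σ ⟧ = Maybe ⟦ σ ⟧

enc : ∀ τ → ⟦ τ ⟧ → Tree
enc unit      = λ _ → nil
enc bool      = encodeBool
enc unary     = encodeUnary
enc nat       = λ n → encodeBinary (fromℕ n)
enc (σ ⊗ τ)   = encodePair (enc σ) (enc τ)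
enc (list σ)  = encodeList (enc σ)
enc (maybe σ) = encodeMaybe (enc σ)

record PolyTime {σ τ : Ty} (f : ⟦ σ ⟧ → ⟦ τ ⟧) : Set where
  constructor polyTime
  field
    computable : Computable (enc σ) (enc τ ∘ f)

open PolyTime

# : ∀ {τ} → ⟦ τ ⟧ → ℕ
# {τ} x = size (enc τ x)

PolyTime₂ : ∀ {σ₁ σ₂ τ} → (⟦ σ₁ ⟧ → ⟦ σ₂ ⟧ → ⟦ τ ⟧) → Set
PolyTime₂ {σ₁} {σ₂} {τ} f = PolyTime {σ₁ ⊗ σ₂} {τ} λ (x , y) → f x y

constC : ∀ {X : Set} {e : X → Tree} t → Computable e (λ _ → t)
constC nil        = nilC
constC (cons x y) = pairC (constC x) (constC y)

module _ {Γ : Ty} where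

  varP : PolyTime {Γ} {Γ} λ x → x
  varP = polyTime idC

  infixr 9 _∘P_
  _∘P_ : ∀ {σ τ} {g : ⟦ σ ⟧ → ⟦ τ ⟧} {f : ⟦ Γ ⟧ → ⟦ σ ⟧} →
         PolyTime {σ} {τ} g → PolyTime {Γ} {σ} f → PolyTime {Γ} {τ} λ x → g (f x)
  _∘P_ {f = f} (polyTime G) (polyTime F) = polyTime (F then reindexC f G)

  infixr 4 _,P_
  _,P_ : ∀ {σ τ} {f : ⟦ Γ ⟧ → ⟦ σ ⟧} {g : ⟦ Γ ⟧ → ⟦ τ ⟧} →
         PolyTime {Γ} {σ} f → PolyTime {Γ} {τ} g → PolyTime {Γ} {σ ⊗ τ} λ x → f x , g x
  polyTime F ,P polyTime G = polyTime (pairC F G)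

  extP : ∀ {τ} {f g : ⟦ Γ ⟧ → ⟦ τ ⟧} → (∀ x → f x ≡ g x) → PolyTime {Γ} {τ} f → PolyTime {Γ} {τ} g
  extP {τ} f≗g (polyTime F) = polyTime (extC (λ _ → refl) (λ x → cong (enc τ) (f≗g x)) F)

  fstP : ∀ {σ τ} {f : ⟦ Γ ⟧ → ⟦ σ ⊗ τ ⟧} → PolyTime {Γ} {σ ⊗ τ} f → PolyTime {Γ} {σ} λ x → proj₁ (f x)
  fstP (polyTime F) = polyTime (F then hdC)

  sndP : ∀ {σ τ} {f : ⟦ Γ ⟧ → ⟦ σ ⊗ τ ⟧} → PolyTime {Γ} {σ ⊗ τ} f → PolyTime {Γ} {τ} λ x → proj₂ (f x)
  sndP (polyTime F) = polyTime (F then tlC)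

  constP : ∀ {τ} (v : ⟦ τ ⟧) → PolyTime {Γ} {τ} λ _ → v
  constP {τ} v = polyTime (constC (enc τ v))

  consP : ∀ {τ} {f : ⟦ Γ ⟧ → ⟦ τ ⟧} {g : ⟦ Γ ⟧ → List ⟦ τ ⟧} →
          PolyTime {Γ} {τ} f → PolyTime {Γ} {list τ} g → PolyTime {Γ} {list τ} λ x → f x ∷ g x
  consP (polyTime F) (polyTime G) = polyTime (pairC F G)

  justP : ∀ {τ} {f : ⟦ Γ ⟧ → ⟦ τ ⟧} → PolyTime {Γ} {τ} f → PolyTime {Γ} {maybe τ} λ x → just (f x)
  justP (polyTime F) = polyTime (pairC F nilC)

  sucP : {f : ⟦ Γ ⟧ → ℕ} → PolyTime {Γ} {unary} f → PolyTime {Γ} {unary} λ x → suc (f x)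
  sucP (polyTime F) = polyTime (pairC nilC F)

  ifP : ∀ {τ} {b : ⟦ Γ ⟧ → Bool} {f g : ⟦ Γ ⟧ → ⟦ τ ⟧} →
        PolyTime {Γ} {bool} b → PolyTime {Γ} {τ} f → PolyTime {Γ} {τ} g →
        PolyTime {Γ} {τ} λ x → if b x then f x else g x
  ifP {τ} {b} {f} {g} (polyTime B) (polyTime F) (polyTime G) = polyTime (branchC B
    (extC (λ _ → refl) (λ (x , ≢nil) → on-true (b x) ≢nil) (reindexC proj₁ F))
    (extC (λ _ → refl) (λ (x , ≡nil) → on-false (b x) ≡nil) (reindexC proj₁ G)))
    where
    on-true : ∀ {y z} b → encodeBool b ≢ nil → enc τ y ≡ enc τ (if b then y else z)
    on-true true  _    = refl
    on-true false ≢nil = contradiction refl ≢nil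
    on-false : ∀ {y z} b → encodeBool b ≡ nil → enc τ z ≡ enc τ (if b then y else z)
    on-false false _ = refl

  -- `F` runs only where the encoding of `m x` differs from `nil`. This excludes `nothing`, and the
  -- head of the encoding of `just y` is the encoding of `y`.
  maybeP : ∀ {σ τ} {f : ⟦ Γ ⊗ σ ⟧ → ⟦ τ ⟧} {g : ⟦ Γ ⟧ → ⟦ τ ⟧} {m : ⟦ Γ ⟧ → Maybe ⟦ σ ⟧} →
           PolyTime {Γ ⊗ σ} {τ} f → PolyTime {Γ} {τ} g → PolyTime {Γ} {maybe σ} m →
           PolyTime {Γ} {τ} λ x → maybe′ (λ y → f (x , y)) (g x) (m x)
  maybeP {σ} {τ} {f} {g} {m} (polyTime F) (polyTime G) (polyTime M) = polyTime (branchC M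
    (pairC idC (reindexC proj₁ M then hdC) then
      extC (λ (x , p) → input≡ x (m x) p) (λ (x , p) → on-just x (m x) p)
        (reindexC (λ (x , p) → x , value (m x) p) F))
    (extC (λ _ → refl) (λ (x , p) → on-nothing x (m x) p) (reindexC proj₁ G)))
    where
    value : ∀ m → enc (maybe σ) m ≢ nil → ⟦ σ ⟧
    value (just y) _ = y
    value nothing  p = contradiction refl p
    input≡ : ∀ x m p → enc (Γ ⊗ σ) (x , value m p) ≡ cons (enc Γ x) (hd (enc (maybe σ) m))
    input≡ x (just y) _ = refl
    input≡ x nothing  p = contradiction refl p
    on-just : ∀ x m p → enc τ (f (x , value m p)) ≡ enc τ (maybe′ (λ y → f (x , y)) (g x) m)
    on-just x (just y) _ = refl
    on-just x nothing  p = contradiction refl p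
    on-nothing : ∀ x m → enc (maybe σ) m ≡ nil → enc τ (g x) ≡ enc τ (maybe′ (λ y → f (x , y)) (g x) m)
    on-nothing x nothing _ = refl

uncons : ∀ {A : Set} → List A → Maybe (A × List A)
uncons []       = nothing
uncons (x ∷ xs) = just (x , xs)

tail′ : ∀ {A : Set} → List A → List A
tail′ = drop 1

head′ : ∀ {A : Set} → A → List A → A
head′ d []      = d
head′ d (x ∷ _) = x

isEmpty : ∀ {A : Set} → List A → Bool
isEmpty []      = true
isEmpty (_ ∷ _) = false

module _ {Γ : Ty} where

  unconsP : ∀ {σ} {f : ⟦ Γ ⟧ → List ⟦ σ ⟧} → PolyTime {Γ} {list σ} f →
            PolyTime {Γ} {maybe (σ ⊗ list σ)} λ x → uncons (f x)
  unconsP {σ} {f} (polyTime F) = polyTime (branchC F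
    (extC (λ _ → refl) (λ (x , p) → on-cons (f x) p) (reindexC proj₁ (pairC F nilC)))
    (extC (λ _ → refl) (λ (x , p) → on-nil (f x) p) nilC))
    where
    on-cons : ∀ l → enc (list σ) l ≢ nil → cons (enc (list σ) l) nil ≡ enc (maybe (σ ⊗ list σ)) (uncons l)
    on-cons []      p = contradiction refl p
    on-cons (_ ∷ _) _ = refl
    on-nil : ∀ l → enc (list σ) l ≡ nil → nil ≡ enc (maybe (σ ⊗ list σ)) (uncons l)
    on-nil [] _ = refl

  tailP : ∀ {σ} {f : ⟦ Γ ⟧ → List ⟦ σ ⟧} → PolyTime {Γ} {list σ} f →
          PolyTime {Γ} {list σ} λ x → tail′ (f x)
  tailP {σ} {f} (polyTime F) = polyTime (F then extC (λ _ → refl) (λ x → lemma (f x)) tlC)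
    where
    lemma : ∀ l → tl (enc (list σ) l) ≡ enc (list σ) (tail′ l)
    lemma []      = refl
    lemma (_ ∷ _) = refl

  headP : ∀ {σ} {d : ⟦ Γ ⟧ → ⟦ σ ⟧} {f : ⟦ Γ ⟧ → List ⟦ σ ⟧} → PolyTime {Γ} {σ} d → PolyTime {Γ} {list σ} f →
          PolyTime {Γ} {σ} λ x → head′ (d x) (f x)
  headP {d = d} {f} D F = extP (λ x → lemma (d x) (f x)) (maybeP (fstP (sndP varP)) D (unconsP F))
    where
    lemma : ∀ {A : Set} d (l : List A) → maybe′ proj₁ d (uncons l) ≡ head′ d l
    lemma d []      = refl
    lemma d (_ ∷ _) = refl

  isEmptyP : ∀ {σ} {f : ⟦ Γ ⟧ → List ⟦ σ ⟧} → PolyTime {Γ} {list σ} f →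
             PolyTime {Γ} {bool} λ x → isEmpty (f x)
  isEmptyP {f = f} F = extP (λ x → lemma (f x)) (maybeP (constP false) (constP true) (unconsP F))
    where
    lemma : ∀ {A : Set} (l : List A) → maybe′ (λ _ → false) true (uncons l) ≡ isEmpty l
    lemma []      = refl
    lemma (_ ∷ _) = refl

  foldP : ∀ {σ τ} {l : ⟦ Γ ⟧ → List ⟦ σ ⟧} {a : ⟦ Γ ⟧ → ⟦ τ ⟧} {f : ⟦ Γ ⊗ σ ⊗ τ ⟧ → ⟦ τ ⟧} →
          PolyTime {Γ ⊗ σ ⊗ τ} {τ} f → PolyTime {Γ} {τ} a → PolyTime {Γ} {list σ} l →
          (λ ((x , l₁ , _) : Σ ⟦ Γ ⟧ λ x → Σ (List ⟦ σ ⟧) λ l₁ → Σ (List ⟦ σ ⟧) λ l₂ → l₁ ++ l₂ ≡ l x) →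
            # {τ} (foldl (λ a e → f (x , e , a)) (a x) l₁)) ≼ (λ (x , _) → # {Γ} x) →
          PolyTime {Γ} {τ} λ x → foldl (λ a e → f (x , e , a)) (a x) (l x)
  foldP {l = l} {a} {f} (polyTime F) (polyTime A) (polyTime L) bounded = polyTime
    (pairC idC (pairC L A) then
      foldC l a (λ x e a → f (x , e , a)) F
        (≼-≤ʳ (λ (x , _) → ≤-trans (m≤m+n _ _) (n≤1+n _)) bounded))

tail-# : ∀ {σ} (l : List ⟦ σ ⟧) → # {list σ} (tail′ l) ≤ # {list σ} l
tail-# []      = ≤-refl
tail-# {σ} (x ∷ l) = m≤n+m _ (1 + # {σ} x)

bool-# : ∀ b → # {bool} b ≤ 3
bool-# true  = ≤-refl
bool-# false = s≤s z≤n

length-# : ∀ {σ} (l : List ⟦ σ ⟧) → length l ≤ # {list σ} l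
length-# {σ} []      = z≤n
length-# {σ} (e ∷ l) = s≤s (≤-trans (length-# {σ} l) (m≤n+m _ (size (enc σ e))))

prefix-# : ∀ {σ} (l₁ l₂ : List ⟦ σ ⟧) → # {list σ} l₁ ≤ # {list σ} (l₁ ++ l₂)
prefix-# {σ} []       l₂ = size-positive (enc (list σ) l₂)
prefix-# {σ} (x ∷ l₁) l₂ = s≤s (+-monoʳ-≤ (size (enc σ x)) (prefix-# {σ} l₁ l₂))

module _ {Γ : Ty} where

  -- If the increment of a step depends on the context and the element but not on the accumulator,
  -- the accumulator grows at most linearly in the length of the list. `U x` bounds all increments
  -- at once, since no element is larger than the list.
  foldAdditiveP : ∀ {σ τ} {l : ⟦ Γ ⟧ → List ⟦ σ ⟧} {a : ⟦ Γ ⟧ → ⟦ τ ⟧} {f : ⟦ Γ ⊗ σ ⊗ τ ⟧ → ⟦ τ ⟧}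
    {T : ⟦ Γ ⊗ σ ⟧ → ℕ} → T ≼ # {Γ ⊗ σ} → (∀ x e a → # {τ} (f (x , e , a)) ≤ # {τ} a + T (x , e)) →
    PolyTime {Γ ⊗ σ ⊗ τ} {τ} f → PolyTime {Γ} {τ} a → PolyTime {Γ} {list σ} l →
    PolyTime {Γ} {τ} λ x → foldl (λ a e → f (x , e , a)) (a x) (l x)
  foldAdditiveP {σ} {τ} {l} {a} {f} {T} T≼ grows F A L = foldP F A L
    (≼-≤ total (≼-reindex {T = λ x → # {τ} (a x) + # {list σ} (l x) * U x} proj₁
      (≼-+ A≼ (≼-* L≼ (≼-^ (degree T≼) (≼-+ (≼-const 2) (≼-+ (≼-const 1) (≼-+ ≼-refl L≼))))))))
    where
    A≼ : (λ x → # {τ} (a x)) ≼ # {Γ}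
    A≼ = output-size (computable A)
    L≼ : (λ x → # {list σ} (l x)) ≼ # {Γ}
    L≼ = output-size (computable L)
    U : ⟦ Γ ⟧ → ℕ
    U x = (2 + (1 + (# {Γ} x + # {list σ} (l x)))) ^ degree T≼
    go : ∀ x b l₁ → # {list σ} l₁ ≤ # {list σ} (l x) →
         # {τ} (foldl (λ a e → f (x , e , a)) b l₁) ≤ # {τ} b + length l₁ * U x
    go x b []       _  = m≤m+n _ _
    go x b (e ∷ l₁) l≤ = ≤-trans (go x (f (x , e , b)) l₁ (≤-trans (m≤n+m _ (1 + size (enc σ e))) l≤))
      (≤-trans (+-monoˡ-≤ (length l₁ * U x) (≤-trans (grows x e b) (+-monoʳ-≤ (# {τ} b)
          (≤-trans (bound T≼ (x , e)) (^-monoˡ-≤ (degree T≼) (+-monoʳ-≤ 3 (+-monoʳ-≤ (# {Γ} x)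
            (≤-trans (≤-trans (m≤m+n _ _) (n≤1+n _)) l≤))))))))
        (≤-reflexive (+-assoc (# {τ} b) (U x) (length l₁ * U x))))
    total : ∀ ((x , l₁ , l₂ , eq) : Σ ⟦ Γ ⟧ λ x → Σ (List ⟦ σ ⟧) λ l₁ → Σ (List ⟦ σ ⟧) λ l₂ → l₁ ++ l₂ ≡ l x) →
      # {τ} (foldl (λ a e → f (x , e , a)) (a x) l₁) ≤ # {τ} (a x) + # {list σ} (l x) * U x
    total (x , l₁ , l₂ , eq) = ≤-trans (go x (a x) l₁ l₁≤)
      (+-monoʳ-≤ (# {τ} (a x)) (*-monoˡ-≤ (U x) (≤-trans (length-# {σ} l₁) l₁≤)))
      where l₁≤ = ≤-trans (prefix-# {σ} l₁ l₂) (≤-reflexive (cong (# {list σ}) eq))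

-- Operations on lists and unary numbers

nth : ∀ {A : Set} → A → List A → ℕ → A
nth d l i = head′ d (drop i l)

module _ {Γ : Ty} where

  andP : {f g : ⟦ Γ ⟧ → Bool} → PolyTime {Γ} {bool} f → PolyTime {Γ} {bool} g → PolyTime {Γ} {bool} λ x → f x ∧ g x
  andP {f} {g} F G = extP (λ x → lemma (f x) (g x)) (ifP F G (constP false))
    where
    lemma : ∀ a b → (if a then b else false) ≡ a ∧ b
    lemma true  _ = refl
    lemma false _ = refl

  orP : {f g : ⟦ Γ ⟧ → Bool} → PolyTime {Γ} {bool} f → PolyTime {Γ} {bool} g → PolyTime {Γ} {bool} λ x → f x ∨ g x
  orP {f} {g} F G = extP (λ x → lemma (f x) (g x)) (ifP F (constP true) G)
    where
    lemma : ∀ a b → (if a then true else b) ≡ a ∨ b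
    lemma true  _ = refl
    lemma false _ = refl

module _ {Γ : Ty} where

  notP : {f : ⟦ Γ ⟧ → Bool} → PolyTime {Γ} {bool} f → PolyTime {Γ} {bool} λ x → not (f x)
  notP {f} F = extP (λ x → lemma (f x)) (ifP F (constP false) (constP true))
    where
    lemma : ∀ a → (if a then false else true) ≡ not a
    lemma true  = refl
    lemma false = refl

private module _ {Γ σ τ : Ty} where

  elementP : PolyTime {Γ ⊗ σ ⊗ τ} {σ} λ (x , e , a) → e
  elementP = fstP (sndP varP)

  accumulatorP : PolyTime {Γ ⊗ σ ⊗ τ} {τ} λ (x , e , a) → a
  accumulatorP = sndP (sndP varP)

  itemP : PolyTime {Γ ⊗ σ ⊗ τ} {Γ ⊗ σ} λ (x , e , a) → x , e
  itemP = fstP varP ,P elementP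

module _ {Γ σ : Ty} {l : ⟦ Γ ⟧ → List ⟦ σ ⟧} (L : PolyTime {Γ} {list σ} l) where

  -- A left fold that prepends builds a reversed list; `mapP` and `++P` therefore reverse once more.
  ʳ++P : {l′ : ⟦ Γ ⟧ → List ⟦ σ ⟧} → PolyTime {Γ} {list σ} l′ → PolyTime {Γ} {list σ} λ x → l x ʳ++ l′ x
  ʳ++P L′ = foldAdditiveP {T = λ (x , e) → 1 + # {σ} e}
    (≼-+ (≼-const 1) (≼-≤ (λ (x , e) → ≤-trans (m≤n+m _ (# {Γ} x)) (n≤1+n _)) ≼-refl))
    (λ x e a → ≤-reflexive (+-comm (1 + # {σ} e) (# {list σ} a)))
    (consP elementP accumulatorP) L′ L

  reverseP : PolyTime {Γ} {list σ} λ x → reverse (l x)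
  reverseP = ʳ++P (constP [])

module _ {Γ σ : Ty} {l : ⟦ Γ ⟧ → List ⟦ σ ⟧} (L : PolyTime {Γ} {list σ} l) where

  mapP : ∀ {τ} {f : ⟦ Γ ⊗ σ ⟧ → ⟦ τ ⟧} → PolyTime {Γ ⊗ σ} {τ} f → PolyTime {Γ} {list τ} λ x → map (λ y → f (x , y)) (l x)
  mapP {τ} {f} F = extP (λ x → trans (cong reverse (lemma (λ y → f (x , y)) (l x) []))
      (trans (cong reverse (ʳ++-defn (map (λ y → f (x , y)) (l x))))
      (trans (cong reverse (++-identityʳ (reverse (map (λ y → f (x , y)) (l x))))) (reverse-involutive (map (λ y → f (x , y)) (l x))))))
    (reverseP (foldAdditiveP {T = λ p → 1 + # {τ} (f p)}
      (≼-+ (≼-const 1) (output-size (computable F)))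
      (λ x e a → ≤-reflexive (+-comm (1 + # {τ} (f (x , e))) (# {list τ} a)))
      (consP (F ∘P itemP) accumulatorP) (constP []) L))
    where
    lemma : ∀ {A B : Set} (g : A → B) xs rest → foldl (λ a e → g e ∷ a) rest xs ≡ map g xs ʳ++ rest
    lemma g []       rest = refl
    lemma g (x ∷ xs) rest = lemma g xs (g x ∷ rest)

  allP : {p : ⟦ Γ ⊗ σ ⟧ → Bool} → PolyTime {Γ ⊗ σ} {bool} p → PolyTime {Γ} {bool} λ x → all (λ y → p (x , y)) (l x)
  allP {p} P = extP (λ x → lemma (λ y → p (x , y)) true (l x))
    (foldAdditiveP {T = λ _ → 3} (≼-const 3)
      (λ x e a → ≤-trans (bool-# (a ∧ p (x , e))) (m≤n+m _ (# {bool} a)))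
      (andP accumulatorP (P ∘P itemP)) (constP true) L)
    where
    lemma : ∀ {A : Set} (q : A → Bool) a xs → foldl (λ a e → a ∧ q e) a xs ≡ a ∧ all q xs
    lemma q a []       = sym (∧-identityʳ a)
    lemma q a (x ∷ xs) = trans (lemma q (a ∧ q x) xs) (∧-assoc a (q x) (all q xs))

module _ {Γ σ : Ty} {l : ⟦ Γ ⟧ → List ⟦ σ ⟧} (L : PolyTime {Γ} {list σ} l) where

  anyP : {p : ⟦ Γ ⊗ σ ⟧ → Bool} → PolyTime {Γ ⊗ σ} {bool} p → PolyTime {Γ} {bool} λ x → any (λ y → p (x , y)) (l x)
  anyP {p} P = extP (λ x → lemma (λ y → p (x , y)) (l x)) (notP (allP L (notP P)))
    where
    lemma : ∀ {A : Set} (q : A → Bool) xs → not (all (not ∘ q) xs) ≡ any q xs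
    lemma q []       = refl
    lemma q (x ∷ xs) with q x
    ... | true  = refl
    ... | false = lemma q xs

  ++P : {l′ : ⟦ Γ ⟧ → List ⟦ σ ⟧} → PolyTime {Γ} {list σ} l′ → PolyTime {Γ} {list σ} λ x → l x ++ l′ x
  ++P {l′} L′ = extP (λ x → trans (ʳ++-defn (reverse (l x))) (cong (_++ l′ x) (reverse-involutive (l x))))
    (ʳ++P (reverseP L) L′)

module _ {Γ : Ty} where

  unitsP : {f : ⟦ Γ ⟧ → ℕ} → PolyTime {Γ} {unary} f → PolyTime {Γ} {list unit} λ x → replicate (f x) tt
  unitsP {f} (polyTime F) = polyTime (extC (λ _ → refl) (λ x → lemma (f x)) F)
    where
    lemma : ∀ n → enc unary n ≡ enc (list unit) (replicate n tt)
    lemma zero    = refl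
    lemma (suc n) = cong (cons nil) (lemma n)

module _ {Γ : Ty} where

  lengthP : ∀ {σ} {l : ⟦ Γ ⟧ → List ⟦ σ ⟧} → PolyTime {Γ} {list σ} l → PolyTime {Γ} {unary} λ x → length (l x)
  lengthP {l = l} L = extP (λ x → trans (lemma (l x) 0) (+-identityʳ _)) (foldAdditiveP {T = λ _ → 2} (≼-const 2)
      (λ x e a → ≤-reflexive (+-comm 2 (# {unary} a))) (sucP (sndP (sndP varP))) (constP 0) L)
    where
    lemma : ∀ {A : Set} (xs : List A) a → foldl (λ a _ → suc a) a xs ≡ length xs + a
    lemma []       a = refl
    lemma (x ∷ xs) a = trans (lemma xs (suc a)) (+-suc (length xs) a)

module _ {Γ : Ty} where

  predP : {f : ⟦ Γ ⟧ → ℕ} → PolyTime {Γ} {unary} f → PolyTime {Γ} {unary} λ x → pred (f x)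
  predP {f} F = extP (λ x → lemma (f x)) (lengthP (tailP (unitsP F)))
    where
    lemma : ∀ n → length (tail′ (replicate n tt)) ≡ pred n
    lemma zero    = refl
    lemma (suc n) = length-replicate n

  isZeroP : {f : ⟦ Γ ⟧ → ℕ} → PolyTime {Γ} {unary} f → PolyTime {Γ} {bool} λ x → f x ≡ᵇ 0
  isZeroP {f} F = extP (λ x → lemma (f x)) (isEmptyP (unitsP F))
    where
    lemma : ∀ n → isEmpty (replicate n tt) ≡ (n ≡ᵇ 0)
    lemma zero    = refl
    lemma (suc n) = refl

unary-# : ∀ n → # {unary} n ≡ 1 + 2 * n
unary-# zero    = refl
unary-# (suc n) = trans (cong (2 +_) (unary-# n)) (lemma n)
  where lemma : ∀ n → 2 + (1 + 2 * n) ≡ 1 + 2 * suc n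
        lemma = solve-∀

module _ {Γ : Ty} where

  +P : {f g : ⟦ Γ ⟧ → ℕ} → PolyTime {Γ} {unary} f → PolyTime {Γ} {unary} g → PolyTime {Γ} {unary} λ x → f x + g x
  +P {f} {g} F G = extP (λ x → lemma (f x) (g x)) (foldAdditiveP {T = λ _ → 2} (≼-const 2)
      (λ x e a → ≤-reflexive (+-comm 2 (# {unary} a))) (sucP (sndP (sndP varP))) G (unitsP F))
    where
    lemma : ∀ m n → foldl (λ a _ → suc a) n (replicate m tt) ≡ m + n
    lemma zero    n = refl
    lemma (suc m) n = trans (lemma m (suc n)) (+-suc m n)

module _ {Γ : Ty} where

  ∸P : {f g : ⟦ Γ ⟧ → ℕ} → PolyTime {Γ} {unary} f → PolyTime {Γ} {unary} g → PolyTime {Γ} {unary} λ x → f x ∸ g x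
  ∸P {f} {g} F G = extP (λ x → lemma (f x) (g x)) (foldAdditiveP {T = λ _ → 0} (≼-const 0)
      (λ x e a → ≤-trans (≤-reflexive (unary-# (pred a))) (≤-trans (s≤s (*-monoʳ-≤ 2 (pred[n]≤n {a})))
        (≤-reflexive (trans (sym (unary-# a)) (sym (+-identityʳ _))))))
      (predP (sndP (sndP varP))) F (unitsP G))
    where
    lemma : ∀ m n → foldl (λ a _ → pred a) m (replicate n tt) ≡ m ∸ n
    lemma m zero    = refl
    lemma zero    (suc n) = trans (lemma zero n) (0∸n≡0 n)
    lemma (suc m) (suc n) = lemma m n

  ≡ᵇP : {f g : ⟦ Γ ⟧ → ℕ} → PolyTime {Γ} {unary} f → PolyTime {Γ} {unary} g → PolyTime {Γ} {bool} λ x → f x ≡ᵇ g x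
  ≡ᵇP {f} {g} F G = extP (λ x → lemma (f x) (g x)) (andP (isZeroP (∸P F G)) (isZeroP (∸P G F)))
    where
    lemma : ∀ m n → ((m ∸ n) ≡ᵇ 0) ∧ ((n ∸ m) ≡ᵇ 0) ≡ (m ≡ᵇ n)
    lemma zero    zero    = refl
    lemma zero    (suc n) = refl
    lemma (suc m) zero    = refl
    lemma (suc m) (suc n) = lemma m n

  dropP : ∀ {σ} {i : ⟦ Γ ⟧ → ℕ} {l : ⟦ Γ ⟧ → List ⟦ σ ⟧} → PolyTime {Γ} {unary} i → PolyTime {Γ} {list σ} l →
          PolyTime {Γ} {list σ} λ x → drop (i x) (l x)
  dropP {σ} {i} {l} I L = extP (λ x → lemma (i x) (l x)) (foldAdditiveP {T = λ _ → 0} (≼-const 0)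
      (λ x e a → ≤-trans (tail-# {σ} a) (m≤m+n _ 0)) (tailP (sndP (sndP varP))) L (unitsP I))
    where
    lemma : ∀ {A : Set} n (l : List A) → foldl (λ a _ → tail′ a) l (replicate n tt) ≡ drop n l
    lemma zero    l       = refl
    lemma (suc n) []      = lemma-[] n
      where lemma-[] : ∀ {A : Set} n → foldl (λ (a : List A) _ → tail′ a) [] (replicate n tt) ≡ []
            lemma-[] zero    = refl
            lemma-[] (suc n) = lemma-[] n
    lemma (suc n) (x ∷ l) = lemma n l

  nthP : ∀ {σ} {d : ⟦ Γ ⟧ → ⟦ σ ⟧} {i : ⟦ Γ ⟧ → ℕ} {l : ⟦ Γ ⟧ → List ⟦ σ ⟧} →
         PolyTime {Γ} {σ} d → PolyTime {Γ} {list σ} l → PolyTime {Γ} {unary} i →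
         PolyTime {Γ} {σ} λ x → nth (d x) (l x) (i x)
  nthP D L I = headP D (dropP I L)

  -- The counter is part of the accumulator and is itself prepended to the list, so the growth of a
  -- step is not independent of the accumulator. Instead, `count` gives the state after every prefix
  -- explicitly, for the size bound as well as for the result.
  upToP : {f : ⟦ Γ ⟧ → ℕ} → PolyTime {Γ} {unary} f → PolyTime {Γ} {list unary} λ x → upTo (f x)
  upToP {f} F = extP (λ x → trans (cong (reverse ∘ proj₂) (trans (count (units x) 0) (cong (λ k → k , downFrom k) (trans (+-identityʳ _) (length-replicate (f x))))))
                      (reverse-downFrom (f x)))
    (reverseP (sndP (foldP {τ = unary ⊗ list unary} (sucP counterP ,P consP counterP (sndP (sndP (sndP varP))))
      (constP (0 , [])) UnitsP bounded)))
    where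
    units : ⟦ Γ ⟧ → List ⊤
    units x = replicate (f x) tt
    UnitsP = unitsP F
    counterP : PolyTime {Γ ⊗ unit ⊗ unary ⊗ list unary} {unary} λ (x , e , c , l) → c
    counterP = fstP (sndP (sndP varP))
    count : ∀ (l : List ⊤) k → foldl (λ (c , out) _ → suc c , c ∷ out) (k , downFrom k) l ≡ (length l + k , downFrom (length l + k))
    count []      k = refl
    count (_ ∷ l) k = trans (count l (suc k)) (cong (λ k → k , downFrom k) (+-suc (length l) k))
    downFrom-# : ∀ b k → k ≤ b → # {list unary} (downFrom k) ≤ 1 + k * (1 + # {unary} b)
    downFrom-# b zero    _   = ≤-refl
    downFrom-# b (suc k) k<b = s≤s (≤-trans
      (+-mono-≤ (≤-trans (≤-reflexive (unary-# k)) (≤-trans (s≤s (*-monoʳ-≤ 2 (≤-trans (n≤1+n k) k<b))) (≤-reflexive (sym (unary-# b)))))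
        (downFrom-# b k (≤-trans (n≤1+n k) k<b)))
      (≤-reflexive (+-suc (# {unary} b) (k * (1 + # {unary} b)))))
    bounded = ≼-≤ (λ (x , l₁ , l₂ , eq) → subst (λ z → # {unary ⊗ list unary} z ≤ 1 + (# {unary} (f x) + (1 + # {unary} (f x) * (1 + # {unary} (f x))))) (sym (count l₁ 0))
        (let n = f x
             k≤n : length l₁ + 0 ≤ n
             k≤n = ≤-trans (≤-reflexive (+-identityʳ _)) (≤-trans (m≤m+n _ (length l₂))
               (≤-reflexive (trans (sym (length-++ l₁)) (trans (cong length eq) (length-replicate n))))) in
         s≤s (+-mono-≤
           (≤-trans (≤-reflexive (unary-# (length l₁ + 0))) (≤-trans (s≤s (*-monoʳ-≤ 2 k≤n)) (≤-reflexive (sym (unary-# n)))))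
           (≤-trans (downFrom-# n (length l₁ + 0) k≤n) (s≤s (*-monoˡ-≤ (1 + # {unary} n)
             (≤-trans k≤n (≤-trans (≤-trans (m≤m+n n (n + 0)) (n≤1+n _)) (≤-reflexive (sym (unary-# n)))))))))))
      (≼-reindex {T = λ x → 1 + (# {unary} (f x) + (1 + # {unary} (f x) * (1 + # {unary} (f x))))} proj₁
        (≼-+ (≼-const 1) (≼-+ N (≼-+ (≼-const 1) (≼-* N (≼-+ (≼-const 1) N))))))
      where N = output-size (computable F)

-- Binary arithmetic

-- As in ℕᵇ, the digits are 1 (true) and 2 (false), least significant first; in
-- this bijective numeration every list of digits is a numeral.
digit : Bool → ℕ
digit true  = 1
digit false = 2

value : List Bool → ℕ
value []      = 0
value (x ∷ l) = digit x + 2 * value l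

toBits : ℕᵇ → List Bool
toBits zero     = []
toBits 2[1+ b ] = false ∷ toBits b
toBits 1+[2 b ] = true ∷ toBits b

fromBits : List Bool → ℕᵇ
fromBits []          = zero
fromBits (false ∷ l) = 2[1+ fromBits l ]
fromBits (true  ∷ l) = 1+[2 fromBits l ]

bits : ℕ → List Bool
bits n = toBits (fromℕ n)

toℕ-fromBits : ∀ l → toℕᵇ (fromBits l) ≡ value l
toℕ-fromBits []          = refl
toℕ-fromBits (false ∷ l) = trans (cong (λ v → 2 * suc v) (toℕ-fromBits l)) (*-suc 2 (value l))
toℕ-fromBits (true  ∷ l) = cong (λ v → suc (2 * v)) (toℕ-fromBits l)

encode-toBits : ∀ b → encodeBinary b ≡ enc (list bool) (toBits b)
encode-toBits zero     = refl
encode-toBits 2[1+ b ] = cong (cons nil) (encode-toBits b)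
encode-toBits 1+[2 b ] = cong (cons (cons nil nil)) (encode-toBits b)

encode-fromBits : ∀ l → enc (list bool) l ≡ encodeBinary (fromBits l)
encode-fromBits []          = refl
encode-fromBits (false ∷ l) = cong (cons nil) (encode-fromBits l)
encode-fromBits (true  ∷ l) = cong (cons (cons nil nil)) (encode-fromBits l)

encode-value : ∀ l → enc (list bool) l ≡ enc nat (value l)
encode-value l = trans (encode-fromBits l)
  (cong encodeBinary (trans (sym (fromℕ-toℕ (fromBits l))) (cong fromℕ (toℕ-fromBits l))))

toℕ-toBits : ∀ b → value (toBits b) ≡ toℕᵇ b
toℕ-toBits zero     = refl
toℕ-toBits 2[1+ b ] = trans (cong (λ v → 2 + 2 * v) (toℕ-toBits b)) (sym (*-suc 2 (toℕᵇ b)))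
toℕ-toBits 1+[2 b ] = cong (λ v → suc (2 * v)) (toℕ-toBits b)

value-bits : ∀ n → value (bits n) ≡ n
value-bits n = trans (toℕ-toBits (fromℕ n)) (toℕ-fromℕ n)

bits-# : ∀ l → # {list bool} l ≤ 1 + 4 * length l
bits-# []          = ≤-refl
bits-# (true  ∷ l) = ≤-trans (+-monoʳ-≤ 4 (bits-# l)) (≤-reflexive (lemma (length l)))
  where lemma : ∀ n → 4 + (1 + 4 * n) ≡ 1 + 4 * suc n
        lemma = solve-∀
bits-# (false ∷ l) = ≤-trans (+-monoʳ-≤ 2 (bits-# l)) (≤-trans (m≤n+m _ 2) (≤-reflexive (lemma (length l))))
  where lemma : ∀ n → 4 + (1 + 4 * n) ≡ 1 + 4 * suc n
        lemma = solve-∀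

length-bound : ∀ l → 2 ^ length l ≤ 1 + value l
length-bound []      = ≤-refl
length-bound (x ∷ l) = ≤-trans (*-monoʳ-≤ 2 (length-bound l))
  (≤-trans (≤-reflexive (*-suc 2 (value l))) (s≤s (+-monoˡ-≤ (2 * value l) (positive x))))
  where positive : ∀ x → 1 ≤ digit x
        positive true  = s≤s z≤n
        positive false = s≤s z≤n

value-bound : ∀ l → 2 + value l ≤ 2 ^ suc (length l)
value-bound []      = ≤-refl
value-bound (x ∷ l) = ≤-trans (+-monoʳ-≤ 2 (+-monoˡ-≤ (2 * value l) (small x)))
  (≤-trans (≤-reflexive (lemma (value l))) (*-monoʳ-≤ 2 (value-bound l)))
  where lemma : ∀ n → 2 + (2 + 2 * n) ≡ 2 * (2 + n)
        lemma = solve-∀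
        small : ∀ x → digit x ≤ 2
        small true  = s≤s z≤n
        small false = ≤-refl

-- A digit takes at most four nodes, three for its Boolean and one for the `cons`, and a numeral
-- with nonzero digits has no padding. Together with `nat-value`, this lets sizes be bounded through
-- magnitudes, whose binary exponents add under multiplication.
nat-size : ∀ {n b} → n < 2 ^ b → # {nat} n ≤ 1 + 4 * b
nat-size {n} {b} n<2^b = ≤-trans (≤-reflexive (cong size (encode-toBits (fromℕ n)))) (≤-trans (bits-# (bits n))
  (s≤s (*-monoʳ-≤ 4 (^-cancelˡ-≤ 2 {length (bits n)} {b} ≤-refl (≤-trans (length-bound (bits n)) (≤-trans (≤-reflexive (cong suc (value-bits n))) n<2^b))))))
  where
  ^-cancelˡ-≤ : ∀ m {a b} → 2 ≤ m → m ^ a ≤ m ^ b → a ≤ b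
  ^-cancelˡ-≤ m {a} {b} 2≤m le with a ≤? b
  ... | yes a≤b = a≤b
  ... | no  a≰b = contradiction le (<⇒≱ (^-monoʳ-< m 2≤m (≰⇒> a≰b)))

nat-value : ∀ n → n < 2 ^ # {nat} n
nat-value n = ≤-trans (≤-trans (n≤1+n _) (≤-trans (≤-reflexive (cong (2 +_) (sym (value-bits n)))) (value-bound (bits n))))
  (^-monoʳ-≤ 2 (≤-trans (length< (bits n)) (≤-reflexive (cong size (sym (encode-toBits (fromℕ n)))))))
  where
  length< : ∀ l → suc (length l) ≤ # {list bool} l
  length< []      = ≤-refl
  length< (x ∷ l) = s≤s (≤-trans (length< l) (m≤n+m _ (# {bool} x)))

module _ {Γ : Ty} where

  -- A number and its list of digits have the same encoding, so this conversion and `valueP` run the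
  -- given code unchanged.
  bitsP : {f : ⟦ Γ ⟧ → ℕ} → PolyTime {Γ} {nat} f → PolyTime {Γ} {list bool} λ x → bits (f x)
  bitsP {f} (polyTime F) = polyTime (extC (λ _ → refl) (λ x → encode-toBits (fromℕ (f x))) F)

  valueP : {f : ⟦ Γ ⟧ → List Bool} → PolyTime {Γ} {list bool} f → PolyTime {Γ} {nat} λ x → value (f x)
  valueP {f} (polyTime F) = polyTime (extC (λ _ → refl) (λ x → encode-value (f x)) F)

-- The remaining digits of the second summand, the carry, and the digits of
-- the sum in reverse order.
AddState : Set
AddState = List Bool × ℕ × List Bool

-- Entry `s` of `carries` and of `outputs` decomposes a column sum as `s` = digit + 2 * carry. With
-- digits 1 and 2 the sum ranges over 1 to 6 and the carry over 0 to 2; entry 0 is a filler.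
carries : List ℕ
carries = 0 ∷ 0 ∷ 0 ∷ 1 ∷ 1 ∷ 2 ∷ 2 ∷ []

outputs : List Bool
outputs = true ∷ true ∷ false ∷ true ∷ false ∷ true ∷ false ∷ []

headDigit : List Bool → ℕ
headDigit l = nth 0 (map digit l) 0

addDigit : Bool → AddState → AddState
addDigit x (b , c , out) = let s = digit x + (c + headDigit b) in
  tail′ b , nth 0 carries s , nth true outputs s ∷ out

addDigits : List Bool → AddState → AddState
addDigits l z = foldl (λ z x → addDigit x z) z l

flush : AddState → List Bool
flush (_ , c , out) = reverse (if c ≡ᵇ 0 then out else nth true outputs c ∷ out)

-- The first pass uses up `a` and may leave a tail of `b`. The second pass adds that tail, now in
-- the role of the first summand, to the carry alone.
addBits : List Bool → List Bool → List Bool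
addBits a b = let z = addDigits a (b , 0 , []) in flush (addDigits (proj₁ z) ([] , proj₂ z))

-- The value of the digits in out, least significant last, followed by a
-- numeral of value n.
shift : List Bool → ℕ → ℕ
shift []        n = n
shift (x ∷ out) n = shift out (digit x + 2 * n)

shift-value : ∀ out r → value (out ʳ++ r) ≡ shift out (value r)
shift-value []        r = refl
shift-value (x ∷ out) r = shift-value out (x ∷ r)

-- `a` is the value of the digits still to be read. The total of the carry, the rest of the second
-- summand and the unread digits, placed above the digits already output, is invariant.
addDigit-correct : ∀ x b c out a → c ≤ 2 → let (b′ , c′ , out′) = addDigit x (b , c , out) in
  c′ ≤ 2 × shift out′ (c′ + value b′ + a) ≡ shift out (c + value b + (digit x + 2 * a))
addDigit-correct x b c out a c≤2 =
  proj₁ (table s (s≤6 x c≤2 (headDigit≤2 b)) (s≥1 x)) ,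
  cong (shift out) (trans (lemma₁ (digit (nth true outputs s)) (nth 0 carries s) (value (tail′ b)) a)
    (trans (cong (_+ 2 * (value (tail′ b) + a)) (proj₂ (table s (s≤6 x c≤2 (headDigit≤2 b)) (s≥1 x))))
    (trans (lemma₂ (digit x) c (headDigit b) (value (tail′ b)) a)
    (cong (λ v → c + v + (digit x + 2 * a)) (sym (split b))))))
  where
  s = digit x + (c + headDigit b)
  split : ∀ b → value b ≡ headDigit b + 2 * value (tail′ b)
  split []      = refl
  split (x ∷ b) = refl
  digit≤2 : ∀ x → digit x ≤ 2
  digit≤2 true  = s≤s z≤n
  digit≤2 false = ≤-refl
  headDigit≤2 : ∀ b → headDigit b ≤ 2
  headDigit≤2 []      = z≤n
  headDigit≤2 (x ∷ b) = digit≤2 x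
  s≤6 : ∀ x {c d} → c ≤ 2 → d ≤ 2 → digit x + (c + d) ≤ 6
  s≤6 x c≤2 d≤2 = +-mono-≤ (digit≤2 x) (+-mono-≤ c≤2 d≤2)
  s≥1 : ∀ x {n} → 1 ≤ digit x + n
  s≥1 true  = s≤s z≤n
  s≥1 false = s≤s z≤n
  table : ∀ s → s ≤ 6 → 1 ≤ s → nth 0 carries s ≤ 2 × digit (nth true outputs s) + 2 * nth 0 carries s ≡ s
  table 1 _ _ = z≤n , refl
  table 2 _ _ = z≤n , refl
  table 3 _ _ = s≤s z≤n , refl
  table 4 _ _ = s≤s z≤n , refl
  table 5 _ _ = s≤s (s≤s z≤n) , refl
  table 6 _ _ = s≤s (s≤s z≤n) , refl
  table (suc (suc (suc (suc (suc (suc (suc _))))))) (s≤s (s≤s (s≤s (s≤s (s≤s (s≤s ())))))) _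
  lemma₁ : ∀ d c b a → d + 2 * (c + b + a) ≡ d + 2 * c + 2 * (b + a)
  lemma₁ = solve-∀
  lemma₂ : ∀ x c h b a → x + (c + h) + 2 * (b + a) ≡ c + (h + 2 * b) + (x + 2 * a)
  lemma₂ = solve-∀

addDigits-correct : ∀ l b c out → c ≤ 2 → let (b′ , c′ , out′) = addDigits l (b , c , out) in
  c′ ≤ 2 × shift out′ (c′ + value b′) ≡ shift out (c + value b + value l)
addDigits-correct []      b c out c≤2 = c≤2 , cong (shift out) (sym (+-identityʳ _))
addDigits-correct (x ∷ l) b c out c≤2 =
  let c′≤2 , eq = addDigit-correct x b c out (value l) c≤2
      c″≤2 , eq′ = addDigits-correct l _ _ _ c′≤2 in
  c″≤2 , trans eq′ eq

flush-correct : ∀ c out → c ≤ 2 → value (flush ([] , c , out)) ≡ shift out c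
flush-correct 0 out _ = shift-value out []
flush-correct 1 out _ = shift-value (true ∷ out) []
flush-correct 2 out _ = shift-value (false ∷ out) []
flush-correct (suc (suc (suc _))) out (s≤s (s≤s ()))

addBits-correct : ∀ a b → value (addBits a b) ≡ value a + value b
addBits-correct a b =
  let b′ , c′ , out′ = addDigits a (b , 0 , [])
      b″ , c″ , out″ = addDigits b′ ([] , c′ , out′)
      c′≤2 , eq = addDigits-correct a b 0 [] z≤n
      c″≤2 , eq′ = addDigits-correct b′ [] c′ out′ c′≤2
      empty = drained b′ c′ out′ in
  trans (cong (λ l → value (flush (l , c″ , out″))) empty)
  (trans (flush-correct c″ out″ c″≤2)
  (trans (cong (shift out″) (sym (trans (cong (λ l → c″ + value l) empty) (+-identityʳ c″))))
  (trans eq′ (trans (cong (λ v → shift out′ (v + value b′)) (+-identityʳ c′))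
  (trans eq (+-comm (value b) (value a)))))))
  where
  drained : ∀ l c out → proj₁ (addDigits l ([] , c , out)) ≡ []
  drained []      c out = refl
  drained (x ∷ l) c out = drained l _ _

addStateTy : Ty
addStateTy = list bool ⊗ unary ⊗ list bool

module _ {Γ : Ty} where

  digitP : {f : ⟦ Γ ⟧ → Bool} → PolyTime {Γ} {bool} f → PolyTime {Γ} {unary} λ x → digit (f x)
  digitP {f} F = extP (λ x → lemma (f x)) (ifP F (constP 1) (constP 2))
    where lemma : ∀ b → (if b then 1 else 2) ≡ digit b
          lemma true  = refl
          lemma false = refl

module _ {Γ : Ty} where

  addDigitP : PolyTime {Γ ⊗ bool ⊗ addStateTy} {addStateTy} λ (_ , x , z) → addDigit x z
  addDigitP = tailP B ,P nthP (constP 0) (constP carries) S ,P consP (nthP (constP true) (constP outputs) S) (sndP (sndP Z))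
    where
    Z : PolyTime {Γ ⊗ bool ⊗ addStateTy} {addStateTy} λ (_ , x , z) → z
    Z = sndP (sndP varP)
    B = fstP Z
    S = +P (digitP (fstP (sndP varP))) (+P (fstP (sndP Z)) (nthP (constP 0) (mapP B (digitP (sndP varP))) (constP 0)))

  addDigit-size : ∀ x z → # {addStateTy} (addDigit x z) ≤ # {addStateTy} z + 8
  addDigit-size x (b , c , out) = ≤-trans
    (s≤s (+-mono-≤ (tail-# {bool} b) (s≤s (+-mono-≤ (≤-trans (carry-# s) (+-monoˡ-≤ 4 (size-positive (enc unary c)))) (s≤s (+-monoˡ-≤ _ (bool-# (nth true outputs s))))))))
    (≤-reflexive (lemma (# {list bool} b) (# {unary} c) (# {list bool} out)))
    where
    s = digit x + (c + headDigit b)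
    carry-# : ∀ s → # {unary} (nth 0 carries s) ≤ 5
    carry-# 0 = s≤s z≤n
    carry-# 1 = s≤s z≤n
    carry-# 2 = s≤s z≤n
    carry-# 3 = s≤s (s≤s (s≤s z≤n))
    carry-# 4 = s≤s (s≤s (s≤s z≤n))
    carry-# 5 = ≤-refl
    carry-# 6 = ≤-refl
    carry-# (suc (suc (suc (suc (suc (suc (suc zero))))))) = s≤s z≤n
    carry-# (suc (suc (suc (suc (suc (suc (suc (suc _)))))))) = s≤s z≤n
    lemma : ∀ b c o → suc (b + suc ((c + 4) + suc (3 + o))) ≡ suc (b + suc (c + o)) + 8
    lemma = solve-∀

  addDigitsP : {l : ⟦ Γ ⟧ → List Bool} {z : ⟦ Γ ⟧ → AddState} → PolyTime {Γ} {list bool} l → PolyTime {Γ} {addStateTy} z →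
               PolyTime {Γ} {addStateTy} λ x → addDigits (l x) (z x)
  addDigitsP L Z = foldAdditiveP {T = λ _ → 8} (≼-const 8) (λ _ → addDigit-size) addDigitP Z L

module _ {Γ : Ty} where

  +ⁿP : {f g : ⟦ Γ ⟧ → ℕ} → PolyTime {Γ} {nat} f → PolyTime {Γ} {nat} g → PolyTime {Γ} {nat} λ x → f x + g x
  +ⁿP {f} {g} F G = extP (λ x → trans (addBits-correct (bits (f x)) (bits (g x))) (cong₂ _+_ (value-bits (f x)) (value-bits (g x))))
    (valueP (reverseP (ifP (isZeroP C) O (consP (nthP (constP true) (constP outputs) C) O))))
    where
    Z = addDigitsP (bitsP F) (bitsP G ,P constP 0 ,P constP [])
    Z′ = addDigitsP (fstP Z) (constP [] ,P sndP Z)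
    C = fstP (sndP Z′)
    O = sndP (sndP Z′)

mulBits : List Bool → ℕ → ℕ
mulBits a n = foldl (λ r x → (r + r) + (if x then n else n + n)) 0 (reverse a)

mulBits-correct : ∀ a n → mulBits a n ≡ value a * n
mulBits-correct a n = trans (reverse-foldl _ 0 a) (go a)
  where
  lemma₁ : ∀ v n → (v * n + v * n) + n ≡ (1 + 2 * v) * n
  lemma₁ = solve-∀
  lemma₂ : ∀ v n → (v * n + v * n) + (n + n) ≡ (2 + 2 * v) * n
  lemma₂ = solve-∀
  go : ∀ a → foldr (λ x r → (r + r) + (if x then n else n + n)) 0 a ≡ value a * n
  go []          = refl
  go (true  ∷ a) = trans (cong (λ r → (r + r) + n) (go a)) (lemma₁ (value a) n)
  go (false ∷ a) = trans (cong (λ r → (r + r) + (n + n)) (go a)) (lemma₂ (value a) n)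

-- Passing to successors turns a Horner step into a factor of at most `2 * suc n`. So the
-- intermediate results are bounded by powers of it, and their numerals stay polynomially long.
mul-growth : ∀ n l r → suc (foldl (λ r x → (r + r) + (if x then n else n + n)) r l) ≤ suc r * (2 * suc n) ^ length l
mul-growth n []      r = ≤-reflexive (sym (*-identityʳ (suc r)))
mul-growth n (x ∷ l) r = ≤-trans (mul-growth n l _) (≤-trans
  (*-monoˡ-≤ ((2 * suc n) ^ length l) (≤-trans (s≤s (+-monoʳ-≤ (r + r) (small x))) (≤-trans (m≤m+n _ (1 + 2 * (r * n))) (≤-reflexive (lemma r n)))))
  (≤-reflexive (*-assoc (suc r) (2 * suc n) _)))
  where
  small : ∀ x → (if x then n else n + n) ≤ n + n
  small true  = m≤m+n n n
  small false = ≤-refl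
  lemma : ∀ r n → suc ((r + r) + (n + n)) + (1 + 2 * (r * n)) ≡ suc r * (2 * suc n)
  lemma = solve-∀

module _ {Γ : Ty} where

  *ⁿP : {f g : ⟦ Γ ⟧ → ℕ} → PolyTime {Γ} {nat} f → PolyTime {Γ} {nat} g → PolyTime {Γ} {nat} λ x → f x * g x
  *ⁿP {f} {g} F G = extP (λ x → trans (mulBits-correct (bits (f x)) (g x)) (cong (_* g x) (value-bits (f x))))
    (foldP {τ = nat} (+ⁿP (+ⁿP R R) (ifP (fstP (sndP varP)) N (+ⁿP N N))) (constP 0) L bounded)
    where
    R : PolyTime {Γ ⊗ bool ⊗ nat} {nat} λ (_ , _ , r) → r
    R = sndP (sndP varP)
    N : PolyTime {Γ ⊗ bool ⊗ nat} {nat} λ (x , _ , _) → g x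
    N = G ∘P fstP varP
    L : PolyTime {Γ} {list bool} λ x → reverse (bits (f x))
    L = reverseP (bitsP F)
    small : ∀ x l₁ l₂ → l₁ ++ l₂ ≡ reverse (bits (f x)) →
            # {nat} (foldl (λ r b → (r + r) + (if b then g x else g x + g x)) 0 l₁) ≤ 1 + 4 * ((1 + # {nat} (g x)) * # {list bool} (reverse (bits (f x))))
    small x l₁ l₂ eq = nat-size {b = (1 + # {nat} (g x)) * # {list bool} (reverse (bits (f x)))} (≤-trans (mul-growth (g x) l₁ 0) (≤-trans (≤-reflexive (*-identityˡ _))
      (≤-trans (^-monoˡ-≤ (length l₁) (*-monoʳ-≤ 2 (nat-value (g x))))
      (≤-trans (^-monoʳ-≤ (2 ^ suc (# {nat} (g x))) ⦃ m^n≢0 2 (suc (# {nat} (g x))) ⦄ (≤-trans (length-# {bool} l₁) (≤-trans (prefix-# {bool} l₁ l₂) (≤-reflexive (cong (# {list bool}) eq)))))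
        (≤-reflexive (^-*-assoc 2 (suc (# {nat} (g x))) (# {list bool} (reverse (bits (f x))))))))))
    bounded = ≼-≤ (λ (x , l₁ , l₂ , eq) → small x l₁ l₂ eq)
      (≼-reindex {T = λ x → 1 + 4 * ((1 + # {nat} (g x)) * # {list bool} (reverse (bits (f x))))} proj₁
        (≼-+ (≼-const 1) (≼-* (≼-const 4) (≼-* (≼-+ (≼-const 1) (output-size (computable G))) (output-size (computable L))))))

-- Comparison from the least significant digit on: c tells whether the digits
-- read so far make the first number smaller.
compareDigit : Bool → List Bool × Bool → List Bool × Bool
compareDigit x (b , c) = tail′ b , not (isEmpty b) ∧ (if head′ true b then x ∧ c else x ∨ c)

lessBits : List Bool → List Bool × Bool → Bool
lessBits a z = let z′ = foldl (λ z x → compareDigit x z) z a in not (isEmpty (proj₁ z′)) ∨ proj₂ z′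

carryIn : Bool → ℕ
carryIn true  = 1
carryIn false = 0

T-extensional : ∀ {a b} → (T a → T b) → (T b → T a) → a ≡ b
T-extensional {true}  {true}  _ _ = refl
T-extensional {false} {false} _ _ = refl
T-extensional {true}  {false} f _ = contradiction tt f
T-extensional {false} {true}  _ g = contradiction tt g

<ᵇ-cong : ∀ m n o p → (m < n → o < p) → (o < p → m < n) → (m <ᵇ n) ≡ (o <ᵇ p)
<ᵇ-cong m n o p f g = T-extensional (λ t → <⇒<ᵇ (f (<ᵇ⇒< m n t))) (λ t → <⇒<ᵇ (g (<ᵇ⇒< o p t)))

-- `c` is the verdict on the lower digits. If they make the first number smaller, equality of the
-- remaining digits is good enough, which amounts to adding 1 on the right.
lessBits-correct : ∀ a b c → lessBits a (b , c) ≡ (value a <ᵇ value b + carryIn c)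
lessBits-correct [] []          true  = refl
lessBits-correct [] []          false = refl
lessBits-correct [] (true  ∷ b) c     = refl
lessBits-correct [] (false ∷ b) c     = refl
lessBits-correct (x ∷ a) [] c = trans (lessBits-correct a [] false)
  (<ᵇ-cong (value a) 0 (digit x + 2 * value a) (carryIn c) (λ ()) (λ lt → contradiction lt (≤⇒≯ (carry≤ x c))))
  where
  carry≤ : ∀ x c → carryIn c ≤ digit x + 2 * value a
  carry≤ x     false = z≤n
  carry≤ true  true  = s≤s z≤n
  carry≤ false true  = s≤s z≤n
lessBits-correct (x ∷ a) (y ∷ b) c = digits x y c
  where
  u = value a
  v = value b
  double≤ : u ≤ v → 2 * u ≤ 2 * v
  double≤ = *-monoʳ-≤ 2
  halve≤ : 2 * u ≤ 2 * v → u ≤ v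
  halve≤ = *-cancelˡ-≤ 2
  odd≤ : 2 * u ≤ 1 + 2 * v → u ≤ v
  odd≤ le with u ≤? v
  ... | yes u≤v = u≤v
  ... | no  u≰v = contradiction le (<⇒≱ (≤-trans (≤-reflexive (sym (*-suc 2 v))) (*-monoʳ-≤ 2 (≰⇒> u≰v))))
  drop0 : ∀ {m} n → m < n + 0 → m < n
  drop0 {m} n = subst (m <_) (+-identityʳ n)
  add0 : ∀ {m} n → m < n → m < n + 0
  add0 {m} n = subst (m <_) (sym (+-identityʳ n))
  drop1 : ∀ {m} n → m < n + 1 → m ≤ n
  drop1 {m} n lt = ≤-pred (subst (m <_) (+-comm n 1) lt)
  add1 : ∀ {m} n → m ≤ n → m < n + 1
  add1 {m} n le = subst (m <_) (+-comm 1 n) (s≤s le)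
  same : ∀ c → (2 * u <ᵇ 2 * v + carryIn c) ≡ (u <ᵇ v + carryIn c)
  same true  = <ᵇ-cong (2 * u) (2 * v + 1) u (v + 1)
    (λ lt → add1 v (halve≤ (drop1 (2 * v) lt))) (λ lt → add1 (2 * v) (double≤ (drop1 v lt)))
  same false = <ᵇ-cong (2 * u) (2 * v + 0) u (v + 0)
    (λ lt → add0 v (*-cancelˡ-< 2 u v (drop0 (2 * v) lt))) (λ lt → add0 (2 * v) (*-monoʳ-< 2 (drop0 v lt)))
  less : ∀ c → (2 * u <ᵇ suc (2 * v + carryIn c)) ≡ (u <ᵇ v + 1)
  less true  = <ᵇ-cong (2 * u) (suc (2 * v + 1)) u (v + 1)
    (λ lt → add1 v (odd≤ (subst (2 * u ≤_) (+-comm (2 * v) 1) (≤-pred lt))))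
    (λ lt → s≤s (≤-trans (double≤ (drop1 v lt)) (m≤m+n (2 * v) 1)))
  less false = <ᵇ-cong (2 * u) (suc (2 * v + 0)) u (v + 1)
    (λ lt → add1 v (halve≤ (subst (2 * u ≤_) (+-identityʳ (2 * v)) (≤-pred lt))))
    (λ lt → s≤s (≤-trans (double≤ (drop1 v lt)) (m≤m+n (2 * v) 0)))
  greater : ∀ c → (suc (2 * u) <ᵇ 2 * v + carryIn c) ≡ (u <ᵇ v + 0)
  greater true  = <ᵇ-cong (suc (2 * u)) (2 * v + 1) u (v + 0)
    (λ lt → add0 v (*-cancelˡ-< 2 u v (drop1 (2 * v) lt))) (λ lt → add1 (2 * v) (*-monoʳ-< 2 (drop0 v lt)))
  greater false = <ᵇ-cong (suc (2 * u)) (2 * v + 0) u (v + 0)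
    (λ lt → add0 v (*-cancelˡ-< 2 u v (≤-trans (n≤1+n _) (drop0 (2 * v) lt))))
    (λ lt → add0 (2 * v) (≤-trans (≤-reflexive (sym (*-suc 2 u))) (*-monoʳ-≤ 2 (drop0 v lt))))
  digits : ∀ x y c → lessBits (x ∷ a) (y ∷ b , c) ≡ (digit x + 2 * u <ᵇ digit y + 2 * v + carryIn c)
  digits true  true  c = trans (lessBits-correct a b c) (sym (same c))
  digits false false c = trans (lessBits-correct a b c) (sym (same c))
  digits true  false c = trans (lessBits-correct a b true) (sym (less c))
  digits false true  c = trans (lessBits-correct a b false) (sym (greater c))

module _ {Γ : Ty} where

  <ᵇP : {f g : ⟦ Γ ⟧ → ℕ} → PolyTime {Γ} {nat} f → PolyTime {Γ} {nat} g → PolyTime {Γ} {bool} λ x → f x <ᵇ g x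
  <ᵇP {f} {g} F G = extP (λ x → trans (lessBits-correct (bits (f x)) (bits (g x)) false)
      (cong₂ _<ᵇ_ (value-bits (f x)) (trans (+-identityʳ _) (value-bits (g x)))))
    (orP (notP (isEmptyP (fstP Z))) (sndP Z))
    where
    B : PolyTime {Γ ⊗ bool ⊗ list bool ⊗ bool} {list bool} λ (_ , _ , b , _) → b
    B = fstP (sndP (sndP varP))
    C : PolyTime {Γ ⊗ bool ⊗ list bool ⊗ bool} {bool} λ (_ , _ , _ , c) → c
    C = sndP (sndP (sndP varP))
    X : PolyTime {Γ ⊗ bool ⊗ list bool ⊗ bool} {bool} λ (_ , x , _) → x
    X = fstP (sndP varP)
    Z : PolyTime {Γ} {list bool ⊗ bool} λ x → foldl (λ z x → compareDigit x z) (bits (g x) , false) (bits (f x))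
    Z = foldAdditiveP {T = λ _ → 3} (≼-const 3)
      (λ { _ x z@(b , c) → ≤-trans (s≤s (+-mono-≤ (tail-# {bool} b) (bool-# (proj₂ (compareDigit x z)))))
         (+-monoˡ-≤ 3 (m≤m+n (1 + # {list bool} b) (# {bool} c))) })
      (tailP B ,P andP (notP (isEmptyP B)) (ifP (headP (constP true) B) (andP X C) (orP X C)))
      (bitsP G ,P constP false) (bitsP F)

-- The algorithm

rational weight partialPath instanceTy : Ty
rational    = (bool ⊗ nat) ⊗ nat
weight      = nat ⊗ nat ⊗ nat
partialPath = weight ⊗ list bool
-- The final `unit` is the `nil` that ends the list of fields in `encodeInput`.
instanceTy  = unary ⊗ list (unary ⊗ unary) ⊗ list (list bool) ⊗ unary ⊗ unary ⊗ list rational ⊗ unit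

-- The weight (p , q , d) stands for the rational number (p − q) / d.
Weight PartialPath RawInstance RawArc : Set
Weight      = ⟦ weight ⟧
PartialPath = ⟦ partialPath ⟧
RawInstance = ⟦ instanceTy ⟧
RawArc      = ℕ × ℕ × ℕ

addWeight : Weight → Weight → Weight
addWeight (p , q , d) (p′ , q′ , d′) = p * d′ + p′ * d , q * d′ + q′ * d , d * d′

-- Denominators are cleared and the subtrahends moved to the other side, so that only natural
-- numbers are compared.
lessWeight : Weight → Weight → Bool
lessWeight (p , q , d) (p′ , q′ , d′) = p * d′ + q′ * d <ᵇ p′ * d + q * d′

cheaper : Maybe PartialPath → Maybe PartialPath → Bool
cheaper π ρ = maybe′ (λ y → maybe′ (λ z → lessWeight (proj₁ y) (proj₁ z)) true ρ) false π

better : Maybe PartialPath → Maybe PartialPath → Maybe PartialPath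
better π ρ = if cheaper π ρ then π else ρ

module _ (x : RawInstance) where

  vertexCount source target : ℕ
  vertexCount = proj₁ x
  source      = proj₁ (proj₂ (proj₂ (proj₂ x)))
  target      = proj₁ (proj₂ (proj₂ (proj₂ (proj₂ x))))

  endpoints : List (ℕ × ℕ)
  endpoints = proj₁ (proj₂ x)

  classes : List (List Bool)
  classes = proj₁ (proj₂ (proj₂ x))

  rationals : List ⟦ rational ⟧
  rationals = proj₁ (proj₂ (proj₂ (proj₂ (proj₂ (proj₂ x)))))

  vertexIndices edgeIndices : List ℕ
  vertexIndices = upTo vertexCount
  edgeIndices   = upTo (length endpoints)

  emptyBits : List Bool
  emptyBits = map (λ _ → false) edgeIndices

  insertBits : ℕ → List Bool → List Bool
  insertBits e S = map (λ i → (e ≡ᵇ i) ∨ nth false S i) edgeIndices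

  unionBits interBits : List Bool → List Bool → List Bool
  unionBits S S′ = map (λ i → nth false S i ∨ nth false S′ i) edgeIndices
  interBits S S′ = map (λ i → nth false S i ∧ nth false S′ i) edgeIndices

  subBits : List Bool → List Bool → Bool
  subBits S S′ = all (λ i → not (nth false S i) ∨ nth false S′ i) edgeIndices

  minimal : List Bool → Bool
  minimal C = all (λ D → not (subBits D C) ∨ subBits C D) classes

  rationalAt : ℕ → ⟦ rational ⟧
  rationalAt = nth ((false , 0) , 1) rationals

  rawArcs : Orientation → List RawArc
  rawArcs directed   = map (λ e → e , nth (0 , 0) endpoints e) edgeIndices
  rawArcs undirected = rawArcs directed ++ map (λ e → e , swap (nth (0 , 0) endpoints e)) edgeIndices

  initialTable : List (Maybe PartialPath)
  initialTable = map (λ v → if v ≡ᵇ target then just ((0 , 0 , 1) , emptyBits) else nothing) vertexIndices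

-- For superset, negative costs count as zero: such edges are bought anyway.
edgeWeight : Mode → ⟦ rational ⟧ → Weight
edgeWeight exact    ((neg , k) , d) = if neg then (0 , k , d) else (k , 0 , d)
edgeWeight superset ((neg , k) , d) = if neg then (0 , 0 , d) else (k , 0 , d)

isSuperset : Mode → Bool
isSuperset exact    = false
isSuperset superset = true

free : Mode → ⟦ rational ⟧ → Bool
free exact    _               = false
free superset ((neg , _) , _) = neg

module _ (mode : Mode) (o : Orientation) (x : RawInstance) where

  extend : ℕ → Maybe PartialPath → Maybe PartialPath
  extend e = maybe′ (λ π → just (addWeight (edgeWeight mode (rationalAt x e)) (proj₁ π) , insertBits x e (proj₂ π))) nothing

  candidate : List Bool → List (Maybe PartialPath) → ℕ → RawArc → Maybe PartialPath
  candidate C T v (e , u , u′) = if nth false C e ∧ (u ≡ᵇ v) then extend e (nth nothing T u′) else nothing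

  relax : List Bool → List (Maybe PartialPath) → ℕ → Maybe PartialPath
  relax C T v = foldl (λ π a → better (candidate C T v a) π) (nth nothing T v) (rawArcs x o)

  relaxAll : List Bool → List (Maybe PartialPath) → List (Maybe PartialPath)
  relaxAll C T = map (relax C T) (vertexIndices x)

  -- A path has at most as many edges as there are vertices, hence the number of rounds;
  -- `vertexIndices x` merely counts them.
  table : List Bool → List (Maybe PartialPath)
  table C = foldl (λ T _ → relaxAll C T) (initialTable x) (vertexIndices x)

  shortest : List Bool → Maybe (List Bool)
  shortest C = maybe′ (λ π → just (proj₂ π)) nothing (nth nothing (table C) (source x))

  baseBits : List Bool
  baseBits = map (λ e → free mode (rationalAt x e)) (edgeIndices x)

  addClass : List Bool → List Bool → List Bool
  addClass A C = if minimal x C then maybe′ (unionBits x A) A (shortest C) else A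

  solution : List Bool
  solution = foldl addClass baseBits (classes x)

  fits : List Bool → List Bool → Bool
  fits B P = subBits x P B ∧ (isSuperset mode ∨ subBits x B P)

  -- Instead of recognising paths, the test looks for a class `D` whose computed path fits the part
  -- of `A` in `C`. By `feasible-complete`, such a `D` exists for the computed solution whenever
  -- there is any feasible set: a minimal class below `C`.
  feasible : List Bool → Bool
  feasible A = all (λ C → any (λ D → maybe′ (fits (interBits x A C)) false (shortest D)) (classes x)) (classes x)

  solve : Maybe (List Bool)
  solve = if feasible solution then just solution else nothing

-- Running time of the algorithm

module _ {Γ : Ty} where

  infix 20 ↑_
  ↑_ : ∀ {σ τ} {f : ⟦ Γ ⟧ → ⟦ τ ⟧} → PolyTime {Γ} {τ} f → PolyTime {Γ ⊗ σ} {τ} λ (γ , _) → f γ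
  ↑ F = F ∘P fstP varP

  varP₀ : ∀ {σ} → PolyTime {Γ ⊗ σ} {σ} λ (_ , y) → y
  varP₀ = sndP varP

  varP₁ : ∀ {σ τ} → PolyTime {(Γ ⊗ σ) ⊗ τ} {σ} λ ((_ , y) , _) → y
  varP₁ = sndP (fstP varP)

module _ {Γ : Ty} {v w : ⟦ Γ ⟧ → Weight} (V : PolyTime {Γ} {weight} v) (W : PolyTime {Γ} {weight} w) where

  addWeightP : PolyTime {Γ} {weight} λ γ → addWeight (v γ) (w γ)
  addWeightP = +ⁿP (*ⁿP (fstP V) D′) (*ⁿP (fstP W) D) ,P +ⁿP (*ⁿP (fstP (sndP V)) D′) (*ⁿP (fstP (sndP W)) D) ,P *ⁿP D D′
    where D = sndP (sndP V)
          D′ = sndP (sndP W)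

  lessWeightP : PolyTime {Γ} {bool} λ γ → lessWeight (v γ) (w γ)
  lessWeightP = <ᵇP (+ⁿP (*ⁿP (fstP V) D′) (*ⁿP (fstP (sndP W)) D)) (+ⁿP (*ⁿP (fstP W) D) (*ⁿP (fstP (sndP V)) D′))
    where D = sndP (sndP V)
          D′ = sndP (sndP W)

module _ {Γ : Ty} {π ρ : ⟦ Γ ⟧ → Maybe PartialPath}
         (Π : PolyTime {Γ} {maybe partialPath} π) (R : PolyTime {Γ} {maybe partialPath} ρ) where

  cheaperP : PolyTime {Γ} {bool} λ γ → cheaper (π γ) (ρ γ)
  cheaperP = maybeP (maybeP (lessWeightP (fstP varP₁) (fstP varP₀)) (constP true) (↑ R)) (constP false) Π

  betterP : PolyTime {Γ} {maybe partialPath} λ γ → better (π γ) (ρ γ)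
  betterP = ifP cheaperP Π R

module _ {Γ : Ty} {x : ⟦ Γ ⟧ → RawInstance} (X : PolyTime {Γ} {instanceTy} x) where

  vertexCountP : PolyTime {Γ} {unary} λ γ → vertexCount (x γ)
  vertexCountP = fstP X

  endpointsP : PolyTime {Γ} {list (unary ⊗ unary)} λ γ → endpoints (x γ)
  endpointsP = fstP (sndP X)

  classesP : PolyTime {Γ} {list (list bool)} λ γ → classes (x γ)
  classesP = fstP (sndP (sndP X))

  sourceP : PolyTime {Γ} {unary} λ γ → source (x γ)
  sourceP = fstP (sndP (sndP (sndP X)))

  targetP : PolyTime {Γ} {unary} λ γ → target (x γ)
  targetP = fstP (sndP (sndP (sndP (sndP X))))

  rationalsP : PolyTime {Γ} {list rational} λ γ → rationals (x γ)
  rationalsP = fstP (sndP (sndP (sndP (sndP (sndP X)))))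

  vertexIndicesP : PolyTime {Γ} {list unary} λ γ → vertexIndices (x γ)
  vertexIndicesP = upToP vertexCountP

  edgeIndicesP : PolyTime {Γ} {list unary} λ γ → edgeIndices (x γ)
  edgeIndicesP = upToP (lengthP endpointsP)

  emptyBitsP : PolyTime {Γ} {list bool} λ γ → emptyBits (x γ)
  emptyBitsP = mapP edgeIndicesP (constP false)

  insertBitsP : ∀ {e S} → PolyTime {Γ} {unary} e → PolyTime {Γ} {list bool} S →
                PolyTime {Γ} {list bool} λ γ → insertBits (x γ) (e γ) (S γ)
  insertBitsP E S = mapP edgeIndicesP (orP (≡ᵇP (↑ E) varP₀) (nthP (constP false) (↑ S) varP₀))

  module _ {S S′} (P : PolyTime {Γ} {list bool} S) (P′ : PolyTime {Γ} {list bool} S′) where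

    private
      bit : PolyTime {Γ ⊗ unary} {bool} λ (γ , i) → nth false (S γ) i
      bit = nthP (constP false) (↑ P) varP₀

      bit′ : PolyTime {Γ ⊗ unary} {bool} λ (γ , i) → nth false (S′ γ) i
      bit′ = nthP (constP false) (↑ P′) varP₀

    unionBitsP : PolyTime {Γ} {list bool} λ γ → unionBits (x γ) (S γ) (S′ γ)
    unionBitsP = mapP edgeIndicesP (orP bit bit′)

    interBitsP : PolyTime {Γ} {list bool} λ γ → interBits (x γ) (S γ) (S′ γ)
    interBitsP = mapP edgeIndicesP (andP bit bit′)

    subBitsP : PolyTime {Γ} {bool} λ γ → subBits (x γ) (S γ) (S′ γ)
    subBitsP = allP edgeIndicesP (orP (notP bit) bit′)

  rationalAtP : ∀ {e} → PolyTime {Γ} {unary} e → PolyTime {Γ} {rational} λ γ → rationalAt (x γ) (e γ)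
  rationalAtP E = nthP (constP _) rationalsP E

  rawArcsP : ∀ o → PolyTime {Γ} {list (unary ⊗ unary ⊗ unary)} λ γ → rawArcs (x γ) o
  rawArcsP directed   = mapP edgeIndicesP (varP₀ ,P nthP (constP _) (↑ endpointsP) varP₀)
  rawArcsP undirected = ++P (rawArcsP directed)
    (mapP edgeIndicesP (varP₀ ,P sndP ends ,P fstP ends))
    where ends : PolyTime {Γ ⊗ unary} {unary ⊗ unary} λ (γ , e) → nth (0 , 0) (endpoints (x γ)) e
          ends = nthP (constP _) (↑ endpointsP) varP₀

module _ {Γ : Ty} {x : ⟦ Γ ⟧ → RawInstance} (X : PolyTime {Γ} {instanceTy} x) where

  minimalP : ∀ {C} → PolyTime {Γ} {list bool} C → PolyTime {Γ} {bool} λ γ → minimal (x γ) (C γ)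
  minimalP C = allP (classesP X) (orP (notP (subBitsP (↑ X) varP₀ (↑ C))) (subBitsP (↑ X) (↑ C) varP₀))

  initialTableP : PolyTime {Γ} {list (maybe partialPath)} λ γ → initialTable (x γ)
  initialTableP = mapP (vertexIndicesP X) (ifP (≡ᵇP varP₀ (↑ targetP X))
    (justP (constP _ ,P emptyBitsP (↑ X))) (constP nothing))

edgeWeightP : ∀ {Γ} mode {r : ⟦ Γ ⟧ → ⟦ rational ⟧} → PolyTime {Γ} {rational} r → PolyTime {Γ} {weight} λ γ → edgeWeight mode (r γ)
edgeWeightP exact    R = ifP (fstP (fstP R)) (constP 0 ,P sndP (fstP R) ,P sndP R) (sndP (fstP R) ,P constP 0 ,P sndP R)
edgeWeightP superset R = ifP (fstP (fstP R)) (constP 0 ,P constP 0 ,P sndP R) (sndP (fstP R) ,P constP 0 ,P sndP R)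

freeP : ∀ {Γ} mode {r : ⟦ Γ ⟧ → ⟦ rational ⟧} → PolyTime {Γ} {rational} r → PolyTime {Γ} {bool} λ γ → free mode (r γ)
freeP exact    R = constP false
freeP superset R = fstP (fstP R)

-- Sizes of the tables of partial paths

nth-All : ∀ {A : Set} {P : A → Set} {d l} → P d → All P l → ∀ i → P (nth d l i)
nth-All pd []       zero    = pd
nth-All pd []       (suc i) = pd
nth-All pd (p ∷ ps) zero    = p
nth-All pd (p ∷ ps) (suc i) = nth-All pd ps i

map-All : ∀ {A B : Set} {P : B → Set} {f : A → B} → (∀ y → P (f y)) → ∀ l → All P (map f l)
map-All pf []      = []
map-All pf (y ∷ l) = pf y ∷ map-All pf l

All-# : ∀ {σ b} {l : List ⟦ σ ⟧} → All (λ y → # {σ} y ≤ b) l → # {list σ} l ≤ 1 + length l * (1 + b)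
All-# []       = ≤-refl
All-# {σ} {b} {y ∷ l} (p ∷ ps) = s≤s (≤-trans (+-mono-≤ p (All-# {σ} ps)) (≤-reflexive (+-suc b _)))

Below : ℕ → Weight → Set
Below b (p , q , d) = p < 2 ^ b × q < 2 ^ b × d < 2 ^ b

data Bounded (b s : ℕ) : Maybe PartialPath → Set where
  nothing : Bounded b s nothing
  just    : ∀ {w S} → Below b w → # {list bool} S ≤ s → Bounded b s (just (w , S))

Below-weaken : ∀ {b c} → b ≤ c → ∀ w → Below b w → Below c w
Below-weaken b≤c w (p , q , d) = ≤-trans p 2^ , ≤-trans q 2^ , ≤-trans d 2^
  where 2^ = ^-monoʳ-≤ 2 b≤c

Bounded-weaken : ∀ {b c s π} → b ≤ c → Bounded b s π → Bounded c s π
Bounded-weaken b≤c nothing         = nothing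
Bounded-weaken b≤c (just {w} lt S) = just (Below-weaken b≤c w lt) S

-- Exponents add under cross multiplication, and the sum of two products takes one more bit.
addWeight-Below : ∀ b c v w → Below b v → Below c w → Below (suc (b + c)) (addWeight v w)
addWeight-Below b c (p , q , d) (p′ , q′ , d′) (p< , q< , d<) (p′< , q′< , d′<) =
  sum (product p< d′<) (subst (p′ * d <_) (*-comm (2 ^ c) (2 ^ b)) (product p′< d<)) ,
  sum (product q< d′<) (subst (q′ * d <_) (*-comm (2 ^ c) (2 ^ b)) (product q′< d<)) ,
  ≤-trans (product d< d′<) (≤-trans (≤-reflexive (sym (^-distribˡ-+-* 2 b c))) (^-monoʳ-≤ 2 (n≤1+n (b + c))))
  where
  product : ∀ {i j k l} → i < k → j < l → i * j < k * l
  product {i} {j} i<k j<l = ≤-trans (s≤s (≤-trans (m≤m+n (i * j) (i + j)) (≤-reflexive (lemma i j)))) (*-mono-≤ i<k j<l)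
    where lemma : ∀ i j → i * j + (i + j) ≡ j + i * suc j
          lemma = solve-∀
  sum : ∀ {i j} → i < 2 ^ b * 2 ^ c → j < 2 ^ b * 2 ^ c → i + j < 2 ^ suc (b + c)
  sum i< j< = ≤-trans (+-mono-<-≤ i< (<⇒≤ j<)) (≤-reflexive (trans (cong₂ _+_ e e) (cong (2 ^ (b + c) +_) (sym (+-identityʳ _)))))
    where e = sym (^-distribˡ-+-* 2 b c)

partialPathBound : ℕ → ℕ → ℕ
partialPathBound b s = 1 + (1 + (1 + (1 + 4 * b) + (1 + (1 + 4 * b) + (1 + 4 * b))) + s) + 1

Bounded-# : ∀ {b s π} → Bounded b s π → # {maybe partialPath} π ≤ partialPathBound b s
Bounded-# nothing = s≤s z≤n
Bounded-# {b} (just (p , q , d) S) = s≤s (+-monoˡ-≤ 1 (s≤s (+-mono-≤ (s≤s (+-mono-≤ (nat-size {b = b} p) (s≤s (+-mono-≤ (nat-size {b = b} q) (nat-size {b = b} d))))) S)))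

better-Bounded : ∀ {b s} π ρ → Bounded b s π → Bounded b s ρ → Bounded b s (better π ρ)
better-Bounded π ρ P R with cheaper π ρ
... | true  = P
... | false = R

module _ (mode : Mode) (o : Orientation) (x : RawInstance) where

  -- The second summand of `costBits` covers the default value of `rationalAt`. In `setSize`, a
  -- Boolean takes at most three nodes and its `cons` one more.
  costBits setSize : ℕ
  costBits = # {list rational} (rationals x) + # {rational} ((false , 0) , 1)
  setSize  = 1 + length (endpoints x) * 4

  set-# : ∀ f → # {list bool} (map f (edgeIndices x)) ≤ setSize
  set-# f = ≤-trans (All-# {bool} (map-All (bool-# ∘ f) (edgeIndices x)))
    (≤-reflexive (cong (λ k → 1 + k * 4) (trans (length-map f (edgeIndices x)) (length-upTo (length (endpoints x))))))

  rationalAt-# : ∀ e → # {rational} (rationalAt x e) ≤ costBits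
  rationalAt-# e = nth-All {P = λ r → # {rational} r ≤ costBits} (m≤n+m _ _) (elements (rationals x) (m≤m+n _ _)) e
    where
    elements : ∀ l → # {list rational} l ≤ costBits → All (λ r → # {rational} r ≤ costBits) l
    elements []      _  = []
    elements (r ∷ l) le = ≤-trans (≤-trans (m≤m+n _ _) (n≤1+n _)) le ∷ elements l (≤-trans (m≤n+m _ (1 + # {rational} r)) le)

  edgeWeight-Below : ∀ r → # {rational} r ≤ costBits → Below costBits (edgeWeight mode r)
  edgeWeight-Below r@((neg , k) , d) le = lemma mode neg
    where
    below : ∀ {n} → # {nat} n ≤ costBits → n < 2 ^ costBits
    below {n} n≤ = ≤-trans (nat-value n) (^-monoʳ-≤ 2 n≤)
    zero< = m^n>0 2 costBits
    k< = below {k} (≤-trans (≤-trans (m≤n+m _ (1 + # {bool} neg)) (≤-trans (m≤m+n _ (# {nat} d)) (n≤1+n _))) le)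
    d< = below {d} (≤-trans (m≤n+m _ (1 + # {bool ⊗ nat} (neg , k))) le)
    lemma : ∀ mode neg → Below costBits (edgeWeight mode ((neg , k) , d))
    lemma exact    true  = zero< , k< , d<
    lemma exact    false = k< , zero< , d<
    lemma superset true  = zero< , zero< , d<
    lemma superset false = k< , zero< , d<

  extend-Bounded : ∀ {b} e π → Bounded b setSize π → Bounded (suc (costBits + b)) setSize (extend mode o x e π)
  extend-Bounded e nothing        _          = nothing
  extend-Bounded {b} e (just (w , S)) (just W _) =
    just (addWeight-Below costBits b (edgeWeight mode (rationalAt x e)) w (edgeWeight-Below (rationalAt x e) (rationalAt-# e)) W) (set-# _)

  -- All candidates extend entries of the old table and `better` only selects, so the exponent grows
  -- once per round and not once per arc.
  relax-Bounded : ∀ {b} C T → All (Bounded b setSize) T → ∀ v → Bounded (suc (costBits + b)) setSize (relax mode o x C T v)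
  relax-Bounded {b} C T all v = go (rawArcs x o) (nth nothing T v)
      (Bounded-weaken (≤-trans (m≤n+m b costBits) (n≤1+n _)) (nth-All nothing all v))
    where
    candidate-Bounded : ∀ a → Bounded (suc (costBits + b)) setSize (candidate mode o x C T v a)
    candidate-Bounded (e , u , u′) with nth false C e ∧ (u ≡ᵇ v)
    ... | true  = extend-Bounded e _ (nth-All nothing all u′)
    ... | false = nothing
    go : ∀ l π → Bounded (suc (costBits + b)) setSize π →
         Bounded (suc (costBits + b)) setSize (foldl (λ π a → better (candidate mode o x C T v a) π) π l)
    go []      π p = p
    go (a ∷ l) π p = go l _ (better-Bounded (candidate mode o x C T v a) π (candidate-Bounded a) p)

  initialTable-Bounded : All (Bounded 1 setSize) (initialTable x)
  initialTable-Bounded = map-All entry (vertexIndices x)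
    where
    entry : ∀ v → Bounded 1 setSize (if v ≡ᵇ target x then just ((0 , 0 , 1) , emptyBits x) else nothing)
    entry v with v ≡ᵇ target x
    ... | true  = just (s≤s z≤n , s≤s z≤n , s≤s (s≤s z≤n)) (set-# _)
    ... | false = nothing

  rounds-Bounded : ∀ {A : Set} {b} C T → All (Bounded b setSize) T → length T ≡ vertexCount x → ∀ (l : List A) →
    let T′ = foldl (λ T _ → relaxAll mode o x C T) T l in
    All (Bounded (length l * suc costBits + b) setSize) T′ × length T′ ≡ vertexCount x
  rounds-Bounded C T all len []      = all , len
  rounds-Bounded {A} {b} C T all len (y ∷ l) =
    let all′ , len′ = rounds-Bounded C (relaxAll mode o x C T) (map-All (relax-Bounded C T all) (vertexIndices x))
                        (trans (length-map _ (vertexIndices x)) (length-upTo (vertexCount x))) l in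
    subst (λ k → All (Bounded k setSize) (foldl (λ T _ → relaxAll mode o x C T) T (y ∷ l))) (lemma (length l) costBits b) all′ , len′
    where lemma : ∀ n c b → n * suc c + suc (c + b) ≡ suc n * suc c + b
          lemma = solve-∀

  tableBound : ℕ
  tableBound = 1 + vertexCount x * (1 + partialPathBound (vertexCount x * suc costBits + 1) setSize)

  prefix-table-# : ∀ C (l₁ l₂ : List ℕ) → l₁ ++ l₂ ≡ vertexIndices x →
    # {list (maybe partialPath)} (foldl (λ T _ → relaxAll mode o x C T) (initialTable x) l₁) ≤ tableBound
  prefix-table-# C l₁ l₂ eq =
    let all , len = rounds-Bounded C (initialTable x) initialTable-Bounded (trans (length-map _ (vertexIndices x)) (length-upTo (vertexCount x))) l₁ in
    ≤-trans (All-# {maybe partialPath} (weaken all)) (≤-reflexive (cong (λ k → 1 + k * (1 + partialPathBound (vertexCount x * suc costBits + 1) setSize)) len))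
    where
    l₁≤ : length l₁ ≤ vertexCount x
    l₁≤ = ≤-trans (m≤m+n _ (length l₂)) (≤-reflexive (trans (sym (length-++ l₁)) (trans (cong length eq) (length-upTo (vertexCount x)))))
    weaken : ∀ {T} → All (Bounded (length l₁ * suc costBits + 1) setSize) T →
             All (λ π → # {maybe partialPath} π ≤ partialPathBound (vertexCount x * suc costBits + 1) setSize) T
    weaken []       = []
    weaken (p ∷ ps) = Bounded-# (Bounded-weaken (+-monoˡ-≤ 1 (*-monoˡ-≤ (suc costBits) l₁≤)) p) ∷ weaken ps

module _ (mode : Mode) (o : Orientation) where

  module _ {Γ : Ty} {x : ⟦ Γ ⟧ → RawInstance} (X : PolyTime {Γ} {instanceTy} x) where

    extendP : ∀ {e π} → PolyTime {Γ} {unary} e → PolyTime {Γ} {maybe partialPath} π →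
              PolyTime {Γ} {maybe partialPath} λ γ → extend mode o (x γ) (e γ) (π γ)
    extendP E Π = maybeP (justP (addWeightP (↑ edgeWeightP mode (rationalAtP X E)) (fstP varP₀) ,P insertBitsP (↑ X) (↑ E) (sndP varP₀)))
                    (constP nothing) Π

  module _ {Γ : Ty} {x : ⟦ Γ ⟧ → RawInstance} (X : PolyTime {Γ} {instanceTy} x) where

    candidateP : ∀ {C T v a} → PolyTime {Γ} {list bool} C → PolyTime {Γ} {list (maybe partialPath)} T →
                 PolyTime {Γ} {unary} v → PolyTime {Γ} {unary ⊗ unary ⊗ unary} a →
                 PolyTime {Γ} {maybe partialPath} λ γ → candidate mode o (x γ) (C γ) (T γ) (v γ) (a γ)
    candidateP C T V A = ifP (andP (nthP (constP false) C (fstP A)) (≡ᵇP (fstP (sndP A)) V))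
      (extendP X (fstP A) (nthP (constP nothing) T (sndP (sndP A)))) (constP nothing)

  module _ {Γ : Ty} {x : ⟦ Γ ⟧ → RawInstance} (X : PolyTime {Γ} {instanceTy} x) where

    relaxP : ∀ {C T v} → PolyTime {Γ} {list bool} C → PolyTime {Γ} {list (maybe partialPath)} T → PolyTime {Γ} {unary} v →
             PolyTime {Γ} {maybe partialPath} λ γ → relax mode o (x γ) (C γ) (T γ) (v γ)
    relaxP {C′} {T′} {v′} C T V = foldAdditiveP
      -- The increment is the size of the candidate itself, since `better` returns one of its two
      -- arguments.
      {T = λ (γ , a) → # {maybe partialPath} (candidate mode o (x γ) (C′ γ) (T′ γ) (v′ γ) a)}
      (output-size (computable A))
      (λ γ a π → better-# (candidate mode o (x γ) (C′ γ) (T′ γ) (v′ γ) a) π)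
      (betterP (A ∘P (fstP varP ,P fstP (sndP varP))) (sndP (sndP varP)))
      (nthP (constP nothing) T V) (rawArcsP X o)
      where
      A = candidateP (↑ X) (↑ C) (↑ T) (↑ V) varP₀
      better-# : ∀ π ρ → # {maybe partialPath} (better π ρ) ≤ # {maybe partialPath} ρ + # {maybe partialPath} π
      better-# π ρ with cheaper π ρ
      ... | true  = m≤n+m _ _
      ... | false = m≤m+n _ _

  module _ {Γ : Ty} {x : ⟦ Γ ⟧ → RawInstance} (X : PolyTime {Γ} {instanceTy} x) where

    relaxAllP : ∀ {C T} → PolyTime {Γ} {list bool} C → PolyTime {Γ} {list (maybe partialPath)} T →
                PolyTime {Γ} {list (maybe partialPath)} λ γ → relaxAll mode o (x γ) (C γ) (T γ)
    relaxAllP C T = mapP (vertexIndicesP X) (relaxP (↑ X) (↑ C) (↑ T) varP₀)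

  module _ {Γ : Ty} {x : ⟦ Γ ⟧ → RawInstance} (X : PolyTime {Γ} {instanceTy} x) where

    -- An entry may be replaced by the extension of a much larger one, so the growth in a round
    -- depends on the table. The size condition comes from the bounds on bit lengths in
    -- `prefix-table-#`.
    tableP : ∀ {C} → PolyTime {Γ} {list bool} C → PolyTime {Γ} {list (maybe partialPath)} λ γ → table mode o (x γ) (C γ)
    tableP {C′} C = foldP (relaxAllP (↑ X) (↑ C) (sndP varP₀)) (initialTableP X) (vertexIndicesP X)
      (≼-≤ (λ (γ , l₁ , l₂ , eq) → prefix-table-# mode o (x γ) (C′ γ) l₁ l₂ eq) (≼-reindex {T = λ γ → tableBound mode o (x γ)} proj₁ bounded))
      where
      N : (λ γ → vertexCount (x γ)) ≼ # {Γ}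
      N = ≼-≤ (λ γ → ≤-trans (≤-trans (m≤m+n _ _) (n≤1+n _)) (≤-reflexive (sym (unary-# (vertexCount (x γ)))))) (output-size (computable (vertexCountP X)))
      K : (λ γ → costBits mode o (x γ)) ≼ # {Γ}
      K = ≼-+ (output-size (computable (rationalsP X))) (≼-const _)
      S : (λ γ → setSize mode o (x γ)) ≼ # {Γ}
      S = ≼-+ (≼-const 1) (≼-* (≼-≤ (λ γ → length-# {unary ⊗ unary} (endpoints (x γ))) (output-size (computable (endpointsP X)))) (≼-const 4))
      B : (λ γ → vertexCount (x γ) * suc (costBits mode o (x γ)) + 1) ≼ # {Γ}
      B = ≼-+ (≼-* N (≼-+ (≼-const 1) K)) (≼-const 1)
      B₄ : (λ γ → 1 + 4 * (vertexCount (x γ) * suc (costBits mode o (x γ)) + 1)) ≼ # {Γ}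
      B₄ = ≼-+ (≼-const 1) (≼-* (≼-const 4) B)
      bounded : (λ γ → tableBound mode o (x γ)) ≼ # {Γ}
      bounded = ≼-+ (≼-const 1) (≼-* N (≼-+ (≼-const 1) (≼-+ (≼-+ (≼-const 1) (≼-+ (≼-+ (≼-const 1) (≼-+ (≼-+ (≼-const 1) B₄) (≼-+ (≼-const 1) (≼-+ B₄ B₄)))) S)) (≼-const 1))))

    shortestP : ∀ {C} → PolyTime {Γ} {list bool} C → PolyTime {Γ} {maybe (list bool)} λ γ → shortest mode o (x γ) (C γ)
    shortestP C = maybeP (justP (sndP varP₀)) (constP nothing) (nthP (constP nothing) (tableP C) (sourceP X))

    fitsP : ∀ {B P} → PolyTime {Γ} {list bool} B → PolyTime {Γ} {list bool} P → PolyTime {Γ} {bool} λ γ → fits mode o (x γ) (B γ) (P γ)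
    fitsP B P = andP (subBitsP X P B) (orP (constP (isSuperset mode)) (subBitsP X B P))

  module _ {Γ : Ty} {x : ⟦ Γ ⟧ → RawInstance} (X : PolyTime {Γ} {instanceTy} x) where

    addClassP : ∀ {A C} → PolyTime {Γ} {list bool} A → PolyTime {Γ} {list bool} C → PolyTime {Γ} {list bool} λ γ → addClass mode o (x γ) (A γ) (C γ)
    addClassP A C = ifP (minimalP X C) (maybeP (unionBitsP (↑ X) (↑ A) varP₀) A (shortestP X C)) A

    baseBitsP : PolyTime {Γ} {list bool} λ γ → baseBits mode o (x γ)
    baseBitsP = mapP (edgeIndicesP X) (freeP mode (rationalAtP (↑ X) varP₀))

    feasibleP : ∀ {A} → PolyTime {Γ} {list bool} A → PolyTime {Γ} {bool} λ γ → feasible mode o (x γ) (A γ)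
    feasibleP A = allP (classesP X) (anyP (↑ classesP X) (maybeP
      (fitsP (↑ ↑ ↑ X) (interBitsP (↑ ↑ ↑ X) (↑ ↑ ↑ A) (↑ varP₁)) varP₀) (constP false) (shortestP (↑ ↑ X) varP₀)))

  module _ {Γ : Ty} {x : ⟦ Γ ⟧ → RawInstance} (X : PolyTime {Γ} {instanceTy} x) where

    solutionP : PolyTime {Γ} {list bool} λ γ → solution mode o (x γ)
    solutionP = foldAdditiveP {T = λ (γ , C) → setSize mode o (x γ)} S
      (λ γ C A → addClass-# (x γ) A C)
      (addClassP (↑ X) (sndP varP₀) (fstP varP₀)) (baseBitsP X) (classesP X)
      where
      S : (λ ((γ , C) : ⟦ Γ ⊗ list bool ⟧) → setSize mode o (x γ)) ≼ # {Γ ⊗ list bool}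
      S = ≼-+ (≼-const 1) (≼-* (≼-≤ (λ (γ , C) → length-# {unary ⊗ unary} (endpoints (x γ))) (output-size (computable (endpointsP (↑ X))))) (≼-const 4))
      addClass-# : ∀ y A C → # {list bool} (addClass mode o y A C) ≤ # {list bool} A + setSize mode o y
      addClass-# y A C with minimal y C
      ... | false = m≤m+n _ _
      ... | true with shortest mode o y C
      ...   | nothing = m≤m+n _ _
      ...   | just P  = ≤-trans (set-# mode o y _) (m≤n+m _ _)

  solveP : PolyTime {instanceTy} {maybe (list bool)} (solve mode o)
  solveP = ifP (feasibleP varP (solutionP varP)) (justP (solutionP varP)) (constP nothing)

-- Sums of costs along lists

sumBy : ∀ {A : Set} → (A → ℚ) → List A → ℚ
sumBy c es = foldr ℚ._+_ 0ℚ (map c es)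

sumBy-++ : ∀ {A : Set} (c : A → ℚ) es fs → sumBy c (es ++ fs) ≡ sumBy c es ℚ.+ sumBy c fs
sumBy-++ c []       fs = sym (ℚ.+-identityˡ _)
sumBy-++ c (e ∷ es) fs = trans (cong (c e ℚ.+_) (sumBy-++ c es fs)) (sym (ℚ.+-assoc (c e) _ _))

sumBy-nonNegative : ∀ {A : Set} {c : A → ℚ} → (∀ e → 0ℚ ℚ.≤ c e) → ∀ es → 0ℚ ℚ.≤ sumBy c es
sumBy-nonNegative c≥0 []       = ℚ.≤-refl
sumBy-nonNegative {c = c} c≥0 (e ∷ es) = subst (ℚ._≤ sumBy c (e ∷ es)) (ℚ.+-identityˡ 0ℚ) (ℚ.+-mono-≤ (c≥0 e) (sumBy-nonNegative c≥0 es))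

-- Walks

module _ {G : Graph} {o : Orientation} where
  open Graph G

  record Split {u v} (x : Vertex) (w : Walk G o u v) : Set where
    field
      before     : Walk G o u x
      after      : Walk G o x v
      edges≡     : edges w ≡ edges before ++ edges after
      departures≡ : departures w ≡ departures before ++ departures after
      -- Cutting at the first visit makes the cycle that `reduce` closes there simple.
      first      : x ∉ departures before

  split : ∀ {u v x} (w : Walk G o u v) → x ∈ vertices w → Split x w
  split stop (here refl) = record { before = stop ; after = stop ; edges≡ = refl ; departures≡ = refl ; first = λ () }
  split {x = x} (step {u = u} e j w) x∈ with x ≟ᶠ u
  ... | yes refl = record { before = stop ; after = step e j w ; edges≡ = refl ; departures≡ = refl ; first = λ () }
  ... | no x≢u   = record
    { before = step e j S.before ; after = S.after
    ; edges≡ = cong (e ∷_) S.edges≡ ; departures≡ = cong (u ∷_) S.departures≡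
    ; first = λ { (here x≡u) → x≢u x≡u ; (there x∈) → S.first x∈ } }
    where
    later : ∀ {ys} → x ∈ u ∷ ys → x ∈ ys
    later (here x≡u) = contradiction x≡u x≢u
    later (there x∈) = x∈
    module S = Split (split w (later x∈))

  record Detour {u v} (w : Walk G o u v) : Set where
    field
      shortcut  : Walk G o u v
      {base}    : Vertex
      cycle     : Walk G o base base
      nonempty  : edges cycle ≢ []
      simple    : Unique (departures cycle)
      shorter   : length (edges shortcut) < length (edges w)
      subwalk   : ∀ {e} → e ∈ edges shortcut → e ∈ edges w
      total≡    : ∀ c → sumBy c (edges w) ≡ sumBy c (edges cycle) ℚ.+ sumBy c (edges shortcut)

  Unique-++ˡ : ∀ {A : Set} (xs : List A) {ys} → Unique (xs ++ ys) → Unique xs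
  Unique-++ˡ []       _        = []
  Unique-++ˡ (x ∷ xs) (p ∷ ps) = All.++⁻ˡ xs p ∷ Unique-++ˡ xs ps

  ∉⇒All≢ : ∀ {A : Set} {x : A} xs → x ∉ xs → All (x ≢_) xs
  ∉⇒All≢ []       x∉ = []
  ∉⇒All≢ (y ∷ xs) x∉ = (λ x≡y → x∉ (here x≡y)) ∷ ∉⇒All≢ xs (x∉ ∘ there)

  All≢⇒∉ : ∀ {A : Set} {x : A} {xs} → All (x ≢_) xs → x ∉ xs
  All≢⇒∉ (p ∷ ps) (here x≡y) = p x≡y
  All≢⇒∉ (p ∷ ps) (there x∈) = All≢⇒∉ ps x∈

  -- A shortest subwalk that returns to its start is a simple cycle.
  reduce : ∀ {u v} (w : Walk G o u v) → IsPath w ⊎ Detour w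
  reduce stop = inj₁ ([] ∷ [])
  reduce (step {u = u} e j w) with reduce w
  ... | inj₂ d = inj₂ record
    { shortcut = step e j D.shortcut ; cycle = D.cycle ; nonempty = D.nonempty ; simple = D.simple
    ; shorter = s≤s D.shorter ; subwalk = λ { (here eq) → here eq ; (there e∈) → there (D.subwalk e∈) }
    ; total≡ = λ c → trans (cong (c e ℚ.+_) (D.total≡ c)) (exchange (c e) (sumBy c (edges D.cycle)) (sumBy c (edges D.shortcut))) }
    where
    module D = Detour d
    exchange : ∀ x y z → x ℚ.+ (y ℚ.+ z) ≡ y ℚ.+ (x ℚ.+ z)
    exchange x y z = trans (sym (ℚ.+-assoc x y z)) (trans (cong (ℚ._+ z) (ℚ.+-comm x y)) (ℚ.+-assoc y x z))
  ... | inj₁ path with u ∈? vertices w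
    where open import Data.List.Membership.DecPropositional (_≟ᶠ_ {Graph.n G}) using (_∈?_)
  ...   | no  u∉ = inj₁ (∉⇒All≢ (vertices w) u∉ ∷ path)
  ...   | yes u∈ = inj₂ record
    { shortcut = S.after ; cycle = step e j S.before ; nonempty = λ ()
    ; simple = ∉⇒All≢ (departures S.before) S.first ∷
        Unique-++ˡ (departures S.before) (subst Unique S.departures≡ (Unique-++ˡ (departures w) path))
    ; shorter = s≤s (≤-trans (m≤n+m _ (length (edges S.before))) (≤-reflexive (sym (trans (cong length S.edges≡) (length-++ (edges S.before))))))
    ; subwalk = λ e∈ → there (subst (_ ∈_) (sym S.edges≡) (∈-++⁺ʳ (edges S.before) e∈))
    ; total≡ = λ c → trans (cong (c e ℚ.+_) (trans (cong (sumBy c) S.edges≡) (sumBy-++ c (edges S.before) _))) (sym (ℚ.+-assoc (c e) _ _)) }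
    where module S = Split (split w u∈)

  length-departures : ∀ {u v} (w : Walk G o u v) → length (departures w) ≡ length (edges w)
  length-departures stop         = refl
  length-departures (step _ _ w) = cong suc (length-departures w)

  path-length : ∀ {u v} (w : Walk G o u v) → IsPath w → length (edges w) ≤ n
  path-length w path = ≤-trans (≤-reflexive (sym (length-departures w)))
    (injective⇒≤ {f = List.lookup (departures w)} (lookup-injective (Unique-++ˡ (departures w) path)))
    where
    lookup-injective : ∀ {A : Set} {xs : List A} → Unique xs → ∀ {i j} → List.lookup xs i ≡ List.lookup xs j → i ≡ j
    lookup-injective (p ∷ ps) {zero}  {zero}  _  = refl
    lookup-injective (p ∷ ps) {zero}  {suc j} eq = contradiction eq (All.lookup p (∈-lookup j))
    lookup-injective (p ∷ ps) {suc i} {zero}  eq = contradiction (sym eq) (All.lookup p (∈-lookup i))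
    lookup-injective (p ∷ ps) {suc i} {suc j} eq = cong suc (lookup-injective ps eq)

  start∈ : ∀ {u v} (w : Walk G o u v) → u ∈ vertices w
  start∈ stop         = here refl
  start∈ (step _ _ _) = here refl

  end∈ : ∀ {u v} (w : Walk G o u v) → v ∈ vertices w
  end∈ stop         = here refl
  end∈ (step _ _ w) = there (end∈ w)

  ends-visited : ∀ {u v e x y} (w : Walk G o u v) → e ∈ edges w → Joins G o e x y → x ∈ vertices w
  ends-visited {x = x} {y} (step {u = u} {v} e j w) (here refl) j′ = member o j j′
    where
    member : ∀ o → Joins G o e u v → Joins G o e x y → x ∈ u ∷ vertices w
    member directed   j        j′        = here (,-injectiveˡ (trans (sym j′) j))
    member undirected (inj₁ j) (inj₁ j′) = here (,-injectiveˡ (trans (sym j′) j))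
    member undirected (inj₂ j) (inj₂ j′) = here (,-injectiveʳ (trans (sym j′) j))
    member undirected (inj₁ j) (inj₂ j′) = there (subst (_∈ vertices w) (,-injectiveʳ (trans (sym j) j′)) (start∈ w))
    member undirected (inj₂ j) (inj₁ j′) = there (subst (_∈ vertices w) (,-injectiveˡ (trans (sym j) j′)) (start∈ w))
  ends-visited (step e j w) (there e∈) j′ = there (ends-visited w e∈ j′)

  -- Using an edge again would bring the walk back to the vertex where it first left along that
  -- edge. Without repetitions, the cost of a path as a list is its cost as a set of edges.
  path-edges-unique : ∀ {u v} (w : Walk G o u v) → IsPath w → Unique (edges w)
  path-edges-unique stop         _          = []
  path-edges-unique (step e j w) (u∉ ∷ path) =
    ∉⇒All≢ (edges w) (λ e∈ → All≢⇒∉ u∉ (ends-visited w e∈ j)) ∷ path-edges-unique w path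

  Joins-functional : ∀ {e u v v′} → Joins G o e u v → Joins G o e u v′ → v ≡ v′
  Joins-functional {e} {u} {v} {v′} j j′ = functional o j j′
    where
    functional : ∀ o → Joins G o e u v → Joins G o e u v′ → v ≡ v′
    functional directed   j        j′        = ,-injectiveʳ (trans (sym j) j′)
    functional undirected (inj₁ j) (inj₁ j′) = ,-injectiveʳ (trans (sym j) j′)
    functional undirected (inj₂ j) (inj₂ j′) = ,-injectiveˡ (trans (sym j) j′)
    functional undirected (inj₁ j) (inj₂ j′) = trans (,-injectiveʳ (trans (sym j) j′)) (,-injectiveˡ (trans (sym j) j′))
    functional undirected (inj₂ j) (inj₁ j′) = trans (,-injectiveˡ (trans (sym j) j′)) (,-injectiveʳ (trans (sym j) j′))

  -- The first edge of `p` is an edge of `q` at the common start. As `q` visits its start only once,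
  -- this is also the first edge of `q`, and it leads to the same vertex. The other edges of `p`
  -- differ from it, since `p` does not return either, so the argument repeats.
  path⊆path : ∀ {u v} (p q : Walk G o u v) → IsPath p → IsPath q →
              (∀ {e} → e ∈ edges p → e ∈ edges q) → edges p ≡ edges q
  path⊆path stop stop _ _ _ = refl
  path⊆path stop (step e j q) _ (u∉ ∷ _) _ = contradiction (end∈ q) (All≢⇒∉ u∉)
  path⊆path (step e j p) stop _ _ p⊆q = contradiction (p⊆q (here refl)) λ ()
  path⊆path (step e j p) (step e′ j′ q) (u∉p ∷ path) (u∉q ∷ path′) p⊆q with p⊆q (here refl)
  ... | there e∈q = contradiction (ends-visited q e∈q j) (All≢⇒∉ u∉q)
  ... | here refl with Joins-functional j j′
  ...   | refl = cong (e ∷_) (path⊆path p q path path′ rest)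
    where
    rest : ∀ {f} → f ∈ edges p → f ∈ edges q
    rest f∈ with p⊆q (there f∈)
    ... | there f∈q = f∈q
    ... | here refl = contradiction (ends-visited p f∈ j) (All≢⇒∉ u∉p)

-- The Bellman–Ford algorithm, with walks in the table

module BellmanFord (G : Graph) (o : Orientation) (t : Graph.Vertex G) (C : Graph.Edge G → Bool)
  (c : Graph.Edge G → ℚ) (less : List (Graph.Edge G) → List (Graph.Edge G) → Bool)
  (less-sound    : ∀ es fs → less es fs ≡ true → sumBy c es ℚ.< sumBy c fs)
  (less-complete : ∀ es fs → less es fs ≡ false → sumBy c fs ℚ.≤ sumBy c es) where

  open Graph G

  Within-C : ∀ {u v} → Walk G o u v → Set
  Within-C w = All (λ e → C e ≡ true) (edges w)

  walkCost : ∀ {u v} → Walk G o u v → ℚ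
  walkCost w = sumBy c (edges w)

  Arc : Set
  Arc = ∃ λ e → ∃₂ λ u v → Joins G o e u v

  forward backward : ∀ o → Edge → ∃ λ e → ∃₂ λ u v → Joins G o e u v
  forward directed   e = e , proj₁ (lookup ends e) , proj₂ (lookup ends e) , refl
  forward undirected e = e , proj₁ (lookup ends e) , proj₂ (lookup ends e) , inj₁ refl
  backward directed   e = forward directed e
  backward undirected e = e , proj₂ (lookup ends e) , proj₁ (lookup ends e) , inj₂ refl

  arcs : ∀ o → List (∃ λ e → ∃₂ λ u v → Joins G o e u v)
  arcs directed   = map (forward directed) (allFin m)
  arcs undirected = map (forward undirected) (allFin m) ++ map (backward undirected) (allFin m)

  arcs-complete : ∀ o {e u v} (j : Joins G o e u v) → ∃ λ j′ → (e , u , v , j′) ∈ arcs o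
  arcs-complete directed {e} refl = refl , ∈-map⁺ (forward directed) (∈-allFin e)
  arcs-complete undirected {e} (inj₁ refl) = inj₁ refl , ∈-++⁺ˡ (∈-map⁺ (forward undirected) (∈-allFin e))
  arcs-complete undirected {e} (inj₂ refl) = inj₂ refl , ∈-++⁺ʳ (map (forward undirected) (allFin m)) (∈-map⁺ (backward undirected) (∈-allFin e))

  module _ {v : Vertex} where

    improves : Maybe (Walk G o v t) → Maybe (Walk G o v t) → Bool
    improves π ρ = maybe′ (λ p → maybe′ (λ r → less (edges p) (edges r)) true ρ) false π

    improve : Maybe (Walk G o v t) → Maybe (Walk G o v t) → Maybe (Walk G o v t)
    improve π ρ = if improves π ρ then π else ρ

    infix 4 _≤∞_ _<∞_
    -- An absent walk has infinite cost: `nothing` satisfies neither relation.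
    _≤∞_ _<∞_ : Maybe (Walk G o v t) → ℚ → Set
    π ≤∞ q = ∃ λ w → π ≡ just w × walkCost w ℚ.≤ q
    π <∞ q = ∃ λ w → π ≡ just w × walkCost w ℚ.< q

    improve-spec : ∀ π ρ → (∀ {q} → π ≤∞ q → improve π ρ ≤∞ q) × (∀ {q} → ρ ≤∞ q → improve π ρ ≤∞ q) ×
      (improve π ρ ≡ ρ ⊎ (improve π ρ ≡ π × (∀ {q} → ρ ≤∞ q → π <∞ q)))
    improve-spec nothing  ρ        = (λ ()) , id , inj₁ refl
    improve-spec (just p) nothing  = id , (λ ()) , inj₂ (refl , λ ())
    improve-spec (just p) (just r) with less (edges p) (edges r) in eq
    ... | true  = id , (λ { (_ , refl , r≤q) → p , refl , ℚ.≤-trans (ℚ.<⇒≤ p<r) r≤q }) ,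
                  inj₂ (refl , λ { (_ , refl , r≤q) → p , refl , ℚ.<-≤-trans p<r r≤q })
      where p<r = less-sound (edges p) (edges r) eq
    ... | false = (λ { (_ , refl , p≤q) → r , refl , ℚ.≤-trans (less-complete (edges p) (edges r) eq) p≤q }) , id , inj₁ refl

    module _ {A : Set} (f : A → Maybe (Walk G o v t)) where

      fold-improve : List A → Maybe (Walk G o v t) → Maybe (Walk G o v t)
      fold-improve as π = foldl (λ π a → improve (f a) π) π as

      fold-≤-init : ∀ as {π q} → π ≤∞ q → fold-improve as π ≤∞ q
      fold-≤-init []       le = le
      fold-≤-init (a ∷ as) {π} le = fold-≤-init as (proj₁ (proj₂ (improve-spec (f a) π)) le)

      fold-≤ : ∀ {a as π q} → a ∈ as → f a ≤∞ q → fold-improve as π ≤∞ q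
      fold-≤ {a} {as = _ ∷ as} {π} (here refl) le = fold-≤-init as (proj₁ (improve-spec (f a) π) le)
      fold-≤ (there a∈) le = fold-≤ a∈ le

      fold-cases : ∀ as π → fold-improve as π ≡ π ⊎
        ∃ λ a → fold-improve as π ≡ f a × (∀ {q} → π ≤∞ q → f a <∞ q)
      fold-cases []       π = inj₁ refl
      fold-cases (a ∷ as) π with improve-spec (f a) π | fold-cases as (improve (f a) π)
      ... | _ , keep , inj₁ eq          | inj₁ eq′             = inj₁ (trans eq′ eq)
      ... | _ , keep , inj₂ (eq , lt)   | inj₁ eq′             = inj₂ (a , trans eq′ eq , lt)
      ... | _ , keep , _                | inj₂ (a′ , eq′ , lt) = inj₂ (a′ , eq′ , λ le → lt (keep le))

  candidateWalk : (∀ u → Maybe (Walk G o u t)) → ∀ v → Arc → Maybe (Walk G o v t)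
  candidateWalk T v (e , u , u′ , j) with u ≟ᶠ v
  ... | yes refl = if C e then maybe′ (λ w → just (step e j w)) nothing (T u′) else nothing
  ... | no  _    = nothing

  best : ℕ → ∀ v → Maybe (Walk G o v t)
  best zero v with v ≟ᶠ t
  ... | yes refl = just stop
  ... | no  _    = nothing
  best (suc i) v = fold-improve (candidateWalk (best i) v) (arcs o) (best i v)

  candidateWalk-just : ∀ T v a {w : Walk G o v t} → candidateWalk T v a ≡ just w →
    ∃₂ λ e u′ → Σ (Joins G o e v u′) λ j → ∃ λ w′ → T u′ ≡ just w′ × C e ≡ true × w ≡ step e j w′
  candidateWalk-just T v (e , u , u′ , j) eq with u ≟ᶠ v
  ... | yes refl with C e in Ce | T u′ in Tu′
  candidateWalk-just T v (e , u , u′ , j) refl | yes refl | true | just w′ = e , u′ , j , w′ , Tu′ , Ce , refl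

  candidateWalk-step : ∀ T {v e u′} j {w} → T u′ ≡ just w → C e ≡ true →
    candidateWalk T v (e , v , u′ , j) ≡ just (step e j w)
  candidateWalk-step T {v} {e} {u′} j Tu′ Ce with v ≟ᶠ v
  ... | no v≢v = contradiction refl v≢v
  ... | yes refl rewrite Ce | Tu′ = refl

  best-optimal : ∀ i v (w : Walk G o v t) → Within-C w → length (edges w) ≤ i → best i v ≤∞ walkCost w
  best-optimal zero v stop _ _ with t ≟ᶠ t
  ... | yes refl = stop , refl , ℚ.≤-refl
  ... | no t≢t   = contradiction refl t≢t
  best-optimal (suc i) v stop p _ = fold-≤-init (candidateWalk (best i) v) (arcs o) (best-optimal i v stop p z≤n)
  best-optimal (suc i) v (step {v = u} e j w) (Ce ∷ p) (s≤s len) =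
    let w′ , eq , le = best-optimal i u w p len
        j′ , a∈ = arcs-complete o j in
    fold-≤ (candidateWalk (best i) v) a∈ (step e j′ w′ , candidateWalk-step (best i) j′ eq Ce , ℚ.+-monoʳ-≤ (c e) le)

  best-sound : ∀ i v {w : Walk G o v t} → best i v ≡ just w → Within-C w × length (edges w) ≤ i
  best-sound zero v eq with v ≟ᶠ t
  best-sound zero v refl | yes refl = [] , z≤n
  best-sound (suc i) v {w} eq with fold-cases (candidateWalk (best i) v) (arcs o) (best i v)
  ... | inj₁ eq′ = let p , len = best-sound i v (trans (sym eq′) eq) in p , ≤-trans len (n≤1+n i)
  ... | inj₂ (a , eq′ , _) with candidateWalk-just (best i) v a (trans (sym eq′) eq)
  ...   | e , u′ , j , w′ , eq″ , Ce , refl = let p , len = best-sound i u′ eq″ in Ce ∷ p , s≤s len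

  -- A walk is replaced by strictly cheaper ones only, so that the walks in the
  -- table have as few edges as possible among the cheapest ones.
  best-shortest : ∀ i v {w : Walk G o v t} → best i v ≡ just w → ∀ (w′ : Walk G o v t) → Within-C w′ →
    length (edges w′) < length (edges w) → walkCost w ℚ.< walkCost w′
  best-shortest zero v eq w′ p lt with v ≟ᶠ t
  best-shortest zero v refl w′ p () | yes refl
  best-shortest (suc i) v {w} eq w′ p lt with fold-cases (candidateWalk (best i) v) (arcs o) (best i v)
  ... | inj₁ eq′ = best-shortest i v (trans (sym eq′) eq) w′ p lt
  ... | inj₂ (a , eq′ , strict) =
    -- As `w′` has fewer edges than `w`, it has at most `i`, so the previous entry already cost no
    -- more than `w′`; the replacement was strictly cheaper than that entry.
    let w″ , eq″ , w″<w′ = strict (best-optimal i v w′ p (≤-pred (≤-trans lt (proj₂ (best-sound (suc i) v eq))))) in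
    subst (λ z → walkCost z ℚ.< walkCost w′) (just-injective (trans (sym eq″) (trans (sym eq′) eq))) w″<w′

  module _ (cycles≥0 : ∀ {x} (w : Walk G o x x) → edges w ≢ [] → Unique (departures w) → 0ℚ ℚ.≤ walkCost w) where

    best-path : ∀ i v {w : Walk G o v t} → best i v ≡ just w → IsPath w
    best-path i v {w} eq with reduce w
    ... | inj₁ path = path
    ... | inj₂ d = contradiction (ℚ.<-≤-trans (best-shortest i v eq D.shortcut (All.tabulate (All.lookup (proj₁ (best-sound i v eq)) ∘ D.subwalk)) D.shorter)
        (ℚ.≤-trans (ℚ.≤-reflexive (sym (ℚ.+-identityˡ _)))
        (ℚ.≤-trans (ℚ.+-monoˡ-≤ (walkCost D.shortcut) (cycles≥0 D.cycle D.nonempty D.simple)) (ℚ.≤-reflexive (sym (D.total≡ c))))))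
      (ℚ.<-irrefl refl)
      where module D = Detour d

    best-n-optimal : ∀ v (w : Walk G o v t) → IsPath w → Within-C w → best n v ≤∞ walkCost w
    best-n-optimal v w path p = best-optimal n v w p (path-length w path)

-- Sums over subsets

sumFin : ∀ {m} → (Fin m → ℚ) → ℚ
sumFin {zero}  f = 0ℚ
sumFin {suc m} f = f zero ℚ.+ sumFin (f ∘ suc)

sumFin-cong : ∀ {m} {f g : Fin m → ℚ} → (∀ i → f i ≡ g i) → sumFin f ≡ sumFin g
sumFin-cong {zero}  f≗g = refl
sumFin-cong {suc m} f≗g = cong₂ ℚ._+_ (f≗g zero) (sumFin-cong (f≗g ∘ suc))

sumFin-mono : ∀ {m} {f g : Fin m → ℚ} → (∀ i → f i ℚ.≤ g i) → sumFin f ℚ.≤ sumFin g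
sumFin-mono {zero}  f≤g = ℚ.≤-refl
sumFin-mono {suc m} f≤g = ℚ.+-mono-≤ (f≤g zero) (sumFin-mono (f≤g ∘ suc))

sumFin-+ : ∀ {m} (f g : Fin m → ℚ) → sumFin (λ i → f i ℚ.+ g i) ≡ sumFin f ℚ.+ sumFin g
sumFin-+ {zero}  f g = sym (ℚ.+-identityˡ 0ℚ)
sumFin-+ {suc m} f g = trans (cong (f zero ℚ.+ g zero ℚ.+_) (sumFin-+ (f ∘ suc) (g ∘ suc)))
  (interchange (f zero) (g zero) (sumFin (f ∘ suc)) (sumFin (g ∘ suc)))
  where
  interchange : ∀ a b x y → (a ℚ.+ b) ℚ.+ (x ℚ.+ y) ≡ (a ℚ.+ x) ℚ.+ (b ℚ.+ y)
  interchange a b x y = trans (ℚ.+-assoc a b (x ℚ.+ y)) (trans (cong (a ℚ.+_)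
    (trans (sym (ℚ.+-assoc b x y)) (trans (cong (ℚ._+ y) (ℚ.+-comm b x)) (ℚ.+-assoc x b y)))) (sym (ℚ.+-assoc a x (b ℚ.+ y))))

sumFin-0 : ∀ {m} → sumFin {m} (λ _ → 0ℚ) ≡ 0ℚ
sumFin-0 {zero}  = refl
sumFin-0 {suc m} = trans (ℚ.+-identityˡ _) (sumFin-0 {m})

part : ∀ {m} → (Fin m → ℚ) → (Fin m → Bool) → Fin m → ℚ
part c S e = if S e then c e else 0ℚ

part-∨ : ∀ {m} (c : Fin m → ℚ) (S S′ : Fin m → Bool) e → (S e ≡ true → ¬ S′ e ≡ true) →
  part c (λ e → S e ∨ S′ e) e ≡ part c S e ℚ.+ part c S′ e
part-∨ c S S′ e disjoint with S e | S′ e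
... | true  | true  = contradiction refl (disjoint refl)
... | true  | false = sym (ℚ.+-identityʳ _)
... | false | _     = sym (ℚ.+-identityˡ _)

part-mono : ∀ {m} {c : Fin m → ℚ} {S S′ : Fin m → Bool} e → 0ℚ ℚ.≤ c e → (S e ≡ true → S′ e ≡ true) → part c S e ℚ.≤ part c S′ e
part-mono {S = S} {S′} e c≥0 S⊆S′ with S e | S′ e
... | true  | true  = ℚ.≤-refl
... | true  | false = contradiction (S⊆S′ refl) λ ()
... | false | true  = c≥0
... | false | false = ℚ.≤-refl

sumBy-filter : ∀ {m k} (c : Fin m → ℚ) (S : Subset m) (f : Fin k → Fin m) →
  sumBy c (filter (_∈ˢ? S) (tabulate f)) ≡ sumFin (part c (lookup S) ∘ f)
sumBy-filter {k = zero}  c S f = refl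
sumBy-filter {k = suc k} c S f with f zero ∈ˢ? S | lookup S (f zero) in eq
... | yes _  | true  = cong (c (f zero) ℚ.+_) (sumBy-filter c S (f ∘ suc))
... | yes e∈ | false = contradiction (trans (sym eq) ([]=⇒lookup e∈)) λ ()
... | no e∉  | true  = contradiction (lookup⇒[]= _ S eq) e∉
... | no _   | false = trans (sumBy-filter c S (f ∘ suc)) (sym (ℚ.+-identityˡ _))

sumFin-singleton : ∀ {m} (c : Fin m → ℚ) e → sumFin (part c (lookup ⁅ e ⁆)) ≡ c e
sumFin-singleton {suc m} c zero = trans (cong (c zero ℚ.+_) (trans (sumFin-cong empty) (sumFin-0 {m}))) (ℚ.+-identityʳ _)
  where
  lookup-∅ : ∀ {m} (i : Fin m) → lookup ∅ i ≡ false
  lookup-∅ zero    = refl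
  lookup-∅ (suc i) = lookup-∅ i
  empty : ∀ i → part (c ∘ suc) (lookup ∅) i ≡ 0ℚ
  empty i rewrite lookup-∅ i = refl
sumFin-singleton {suc m} c (suc e) = trans (ℚ.+-identityˡ _) (sumFin-singleton (c ∘ suc) e)

setOf : ∀ {m} → List (Fin m) → Subset m
setOf es = ⋃ (map ⁅_⁆ es)

∈-setOf⁺ : ∀ {m} {e : Fin m} {es} → e ∈ es → e ∈ˢ setOf es
∈-setOf⁺ {e = e} (here refl) = x∈p∪q⁺ (inj₁ (x∈⁅x⁆ e))
∈-setOf⁺ (there e∈)          = x∈p∪q⁺ (inj₂ (∈-setOf⁺ e∈))

∈-setOf⁻ : ∀ {m} {e : Fin m} es → e ∈ˢ setOf es → e ∈ es
∈-setOf⁻ []       e∈ = contradiction e∈ ∉⊥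
∈-setOf⁻ (f ∷ es) e∈ with x∈p∪q⁻ ⁅ f ⁆ (setOf es) e∈
... | inj₁ e∈f  = here (x∈⁅y⁆⇒x≡y f e∈f)
... | inj₂ e∈es = there (∈-setOf⁻ es e∈es)

sumBy-setOf : ∀ {m} (c : Fin m → ℚ) es → Unique es → sumBy c es ≡ sumFin (part c (lookup (setOf es)))
sumBy-setOf {m} c []       _        = sym (trans (sumFin-cong empty) (sumFin-0 {m}))
  where
  empty : ∀ i → part c (lookup ∅) i ≡ 0ℚ
  empty i with lookup ∅ i in eq
  ... | true  = contradiction (lookup⇒[]= i ∅ eq) ∉⊥
  ... | false = refl
sumBy-setOf c (e ∷ es) (e∉ ∷ u) = sym (trans (sumFin-cong separate)
  (trans (sumFin-+ (part c (lookup ⁅ e ⁆)) (part c (lookup (setOf es))))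
    (cong₂ ℚ._+_ (sumFin-singleton c e) (sym (sumBy-setOf c es u)))))
  where
  separate : ∀ i → part c (lookup (⁅ e ⁆ ∪ setOf es)) i ≡ part c (lookup ⁅ e ⁆) i ℚ.+ part c (lookup (setOf es)) i
  separate i = trans (cong (λ b → if b then c i else 0ℚ) (lookup-zipWith _∨_ i ⁅ e ⁆ (setOf es)))
    (part-∨ c (lookup ⁅ e ⁆) (lookup (setOf es)) i λ i∈e i∈es →
      contradiction (sym (x∈⁅y⁆⇒x≡y e (lookup⇒[]= i _ i∈e))) (All.lookup e∉ (∈-setOf⁻ es (lookup⇒[]= i _ i∈es))))

-- Boolean quantifiers over lists

any-true : ∀ {A : Set} (p : A → Bool) {x xs} → x ∈ xs → p x ≡ true → any p xs ≡ true
any-true p {xs = x ∷ xs} (here refl) eq rewrite eq = refl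
any-true p {xs = x ∷ xs} (there x∈)  eq with p x
... | true  = refl
... | false = any-true p x∈ eq

any-true⁻ : ∀ {A : Set} (p : A → Bool) xs → any p xs ≡ true → ∃ λ x → x ∈ xs × p x ≡ true
any-true⁻ p (x ∷ xs) eq with p x in px
... | true  = x , here refl , px
... | false = let y , y∈ , py = any-true⁻ p xs eq in y , there y∈ , py

all-true : ∀ {A : Set} (p : A → Bool) xs → (∀ {x} → x ∈ xs → p x ≡ true) → all p xs ≡ true
all-true p []       _  = refl
all-true p (x ∷ xs) ps rewrite ps (here refl) = all-true p xs (ps ∘ there)

all-true⁻ : ∀ {A : Set} (p : A → Bool) xs → all p xs ≡ true → ∀ {x} → x ∈ xs → p x ≡ true
all-true⁻ p (x ∷ xs) eq x∈ with p x in px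
all-true⁻ p (x ∷ xs) eq (here refl) | true = px
all-true⁻ p (x ∷ xs) eq (there x∈)  | true = all-true⁻ p xs eq x∈

-- Laminar families

module _ {m : ℕ} (Cs : List (Subset m))
  (laminar : ∀ {C D} → C ∈ Cs → D ∈ Cs → Nonempty (C ∩ D) → C ⊆ D ⊎ D ⊆ C) where

  -- Classes may be repeated. Stated by inclusions, minimality holds for all copies of a minimal
  -- set.
  Minimal : Subset m → Set
  Minimal C = ∀ {D} → D ∈ Cs → D ⊆ C → C ⊆ D

  minimal-below : ∀ {C} → C ∈ Cs → ∃ λ D → D ∈ Cs × D ⊆ C × Minimal D
  minimal-below {C} C∈ = go C∈ (<-wellFounded ∣ C ∣)
    where
    smaller? : ∀ C Ds → (∃ λ D → D ∈ Ds × D ⊆ C × ¬ C ⊆ D) ⊎ (∀ {D} → D ∈ Ds → D ⊆ C → C ⊆ D)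
    smaller? C []       = inj₂ λ ()
    smaller? C (D ∷ Ds) with D ⊆? C | C ⊆? D | smaller? C Ds
    ... | yes D⊆C | no C⊈D | _                       = inj₁ (D , here refl , D⊆C , C⊈D)
    ... | _       | _      | inj₁ (E , E∈ , E⊆C , ne) = inj₁ (E , there E∈ , E⊆C , ne)
    ... | no D⊈C  | _      | inj₂ min = inj₂ λ { (here refl) D⊆C → contradiction (λ {x} → D⊆C {x}) D⊈C ; (there E∈) → min E∈ }
    ... | yes _   | yes C⊆D | inj₂ min = inj₂ λ { (here refl) _ → C⊆D ; (there E∈) → min E∈ }
    witness : ∀ {k} (p q : Subset k) → ¬ p ⊆ q → ∃ λ x → x ∈ˢ p × x ∉ˢ q
    witness p q p⊈q with ¬∀⟶∃¬ _ (λ x → x ∈ˢ p → x ∈ˢ q) (λ x → (x ∈ˢ? p) →-dec (x ∈ˢ? q)) (λ f → p⊈q (λ {x} → f x))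
    ... | x , ¬imp = x , decidable-stable (x ∈ˢ? p) (λ x∉p → ¬imp (λ x∈p → contradiction x∈p x∉p)) , λ x∈q → ¬imp (λ _ → x∈q)
    go : ∀ {C} → C ∈ Cs → Acc _<_ ∣ C ∣ → ∃ λ D → D ∈ Cs × D ⊆ C × Minimal D
    go {C} C∈ (acc rec) with smaller? C Cs
    ... | inj₂ min = C , C∈ , ⊆-refl , min
    ... | inj₁ (D , D∈ , D⊆C , C⊈D) =
      let E , E∈ , E⊆D , min = go D∈ (rec (p⊂q⇒∣p∣<∣q∣ (D⊆C , witness C D C⊈D))) in
      E , E∈ , ⊆-trans E⊆D D⊆C , min

  minimal-meet : ∀ {C D e} → C ∈ Cs → D ∈ Cs → Minimal C → Minimal D → e ∈ˢ C → e ∈ˢ D → C ≡ D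
  minimal-meet C∈ D∈ minC minD e∈C e∈D with laminar C∈ D∈ (_ , x∈p∩q⁺ (e∈C , e∈D))
  ... | inj₁ C⊆D = ⊆-antisym C⊆D (minD C∈ C⊆D)
  ... | inj₂ D⊆C = ⊆-antisym (minC D∈ D⊆C) D⊆C

  module _ (c : Fin m → ℚ) (P : Subset m → Fin m → Bool) (B : Fin m → Bool)
    (P⊆ : ∀ {C e} → C ∈ Cs → P C e ≡ true → e ∈ˢ C)
    (cheap : ∀ {C} → C ∈ Cs → sumFin (part c (P C)) ℚ.≤ sumFin (part c (λ e → B e ∧ lookup C e))) where

    private
      Q : Subset m → Fin m → Bool
      Q C e = B e ∧ lookup C e

      Q⊆ : ∀ {C e} → C ∈ Cs → Q C e ≡ true → e ∈ˢ C
      Q⊆ {C} {e} _ eq with B e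
      ... | true = lookup⇒[]= e C eq

    -- Two minimal classes are equal or disjoint, so that the sum over a union
    -- splits along the classes.
    minimal-sum : ∀ Ds → (∀ {D} → D ∈ Ds → D ∈ Cs × Minimal D) →
      sumFin (part c (λ e → any (λ D → P D e) Ds)) ℚ.≤ sumFin (part c (λ e → any (λ D → Q D e) Ds))
    minimal-sum []       _    = ℚ.≤-refl
    minimal-sum (D ∷ Ds) mins with D ∈ᴸ? Ds
      where open import Data.List.Membership.DecPropositional (≡ᵛ-dec {n = m} _≟ᵇ_) renaming (_∈?_ to _∈ᴸ?_)
    -- A further copy of a class adds nothing to either union, so it is dropped on both sides.
    ... | yes D∈ = subst₂ ℚ._≤_ (sym (absorb P)) (sym (absorb Q)) (minimal-sum Ds (mins ∘ there))
      where
      absorb : ∀ (R : Subset m → Fin m → Bool) → sumFin (part c (λ e → R D e ∨ any (λ E → R E e) Ds)) ≡ sumFin (part c (λ e → any (λ E → R E e) Ds))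
      absorb R = sumFin-cong λ e → cong (λ b → if b then c e else 0ℚ) (pointwise e)
        where
        pointwise : ∀ e → (R D e ∨ any (λ E → R E e) Ds) ≡ any (λ E → R E e) Ds
        pointwise e with R D e in eq
        ... | true  = sym (any-true (λ E → R E e) D∈ eq)
        ... | false = refl
    ... | no D∉ = subst₂ ℚ._≤_ (sym (additive P P⊆)) (sym (additive Q Q⊆))
        (ℚ.+-mono-≤ (cheap (proj₁ (mins (here refl)))) (minimal-sum Ds (mins ∘ there)))
      where
      additive : ∀ (R : Subset m → Fin m → Bool) → (∀ {C e} → C ∈ Cs → R C e ≡ true → e ∈ˢ C) →
        sumFin (part c (λ e → R D e ∨ any (λ E → R E e) Ds)) ≡ sumFin (part c (R D)) ℚ.+ sumFin (part c (λ e → any (λ E → R E e) Ds))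
      additive R R⊆ = trans (sumFin-cong λ e → part-∨ c (R D) (λ e → any (λ E → R E e) Ds) e (disjoint e)) (sumFin-+ (part c (R D)) _)
        where
        disjoint : ∀ e → R D e ≡ true → ¬ any (λ E → R E e) Ds ≡ true
        disjoint e inD inDs =
          let E , E∈ , inE = any-true⁻ (λ E → R E e) Ds inDs
              D∈Cs , minD = mins (here refl)
              E∈Cs , minE = mins (there E∈) in
          contradiction (subst (_∈ Ds) (sym (minimal-meet D∈Cs E∈Cs minD minE (R⊆ D∈Cs inD) (R⊆ E∈Cs inE))) E∈) D∉

-- Rational costs

rawℤ : ℤ → Bool × ℕ
rawℤ (pos n)    = false , n
rawℤ -[1+ n ] = true , suc n

rawℚ : ℚ → ⟦ rational ⟧
rawℚ r = rawℤ (↥ r) , ↧ₙ r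

rawℚ-encode : ∀ r → enc rational (rawℚ r) ≡ encodeℚ r
rawℚ-encode (mkℚ (pos n) d _)    = refl
rawℚ-encode (mkℚ -[1+ n ] d _) = refl

-- Equality of unnormalised fractions: weights are never reduced, so adding them needs no greatest
-- common divisors. `k` is the predecessor of the denominator, as `mkℚᵘ` stores it.
Represents : Weight → ℚ → Set
Represents (p , q , d) r = ∃ λ k → d ≡ suc k × toℚᵘ r ≃ᵘ mkℚᵘ (pos p ℤ.- pos q) k

isNegative : ℚ → Bool
isNegative r = proj₁ (rawℤ (↥ r))

modeCost : Mode → ℚ → ℚ
modeCost exact    r = r
modeCost superset r = if isNegative r then 0ℚ else r

edgeWeight-Represents : ∀ mode r → Represents (edgeWeight mode (rawℚ r)) (modeCost mode r)
edgeWeight-Represents exact    (mkℚ (pos n) d _)    = d , refl , ℚᵘ.≃-reflexive (cong (λ z → mkℚᵘ z d) (sym (ℤ.+-identityʳ (pos n))))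
edgeWeight-Represents exact    (mkℚ -[1+ n ] d _) = d , refl , ℚᵘ.≃-refl
edgeWeight-Represents superset (mkℚ (pos n) d _)    = d , refl , ℚᵘ.≃-reflexive (cong (λ z → mkℚᵘ z d) (sym (ℤ.+-identityʳ (pos n))))
edgeWeight-Represents superset (mkℚ -[1+ n ] d _) = d , refl , *≡* refl

0-Represents : Represents (0 , 0 , 1) 0ℚ
0-Represents = 0 , refl , ℚᵘ.≃-refl

private
  numerator : ∀ p q p′ q′ d d′ → pos (p ℕ.* d′ ℕ.+ p′ ℕ.* d) ℤ.- pos (q ℕ.* d′ ℕ.+ q′ ℕ.* d) ≡
    (pos p ℤ.- pos q) ℤ.* pos d′ ℤ.+ (pos p′ ℤ.- pos q′) ℤ.* pos d
  numerator p q p′ q′ d d′ = trans (cong₂ ℤ._-_ (expand p p′) (expand q q′)) (regroup (pos p) (pos q) (pos p′) (pos q′) (pos d) (pos d′))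
    where
    expand : ∀ x y → pos (x ℕ.* d′ ℕ.+ y ℕ.* d) ≡ pos x ℤ.* pos d′ ℤ.+ pos y ℤ.* pos d
    expand x y = trans (ℤ.pos-+ (x ℕ.* d′) (y ℕ.* d)) (cong₂ ℤ._+_ (ℤ.pos-* x d′) (ℤ.pos-* y d))
    regroup : ∀ p q p′ q′ d d′ → (p ℤ.* d′ ℤ.+ p′ ℤ.* d) ℤ.- (q ℤ.* d′ ℤ.+ q′ ℤ.* d) ≡ (p ℤ.- q) ℤ.* d′ ℤ.+ (p′ ℤ.- q′) ℤ.* d
    regroup = ℤSolver.solve-∀

addWeight-Represents : ∀ w w′ {r r′} → Represents w r → Represents w′ r′ → Represents (addWeight w w′) (r ℚ.+ r′)
addWeight-Represents (p , q , _) (p′ , q′ , _) {r} {r′} (k , refl , eq) (k′ , refl , eq′) =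
  _ , refl , ℚᵘ.≃-trans (ℚ.toℚᵘ-homo-+ r r′) (ℚᵘ.≃-trans (ℚᵘ.+-cong eq eq′)
    (ℚᵘ.≃-reflexive (cong (λ z → mkℚᵘ z _) (sym (numerator p q p′ q′ (suc k) (suc k′))))))

lessWeight-⇔ : ∀ w w′ {r r′} → Represents w r → Represents w′ r′ →
  (T (lessWeight w w′) → r ℚ.< r′) × (r ℚ.< r′ → T (lessWeight w w′))
lessWeight-⇔ (p , q , _) (p′ , q′ , _) {r} {r′} (k , refl , eq) (k′ , refl , eq′) = to , from
  where
  d  = suc k
  d′ = suc k′
  a = p ℕ.* d′ ℕ.+ q′ ℕ.* d
  b = p′ ℕ.* d ℕ.+ q ℕ.* d′
  x = (pos p ℤ.- pos q) ℤ.* pos d′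
  y = (pos p′ ℤ.- pos q′) ℤ.* pos d
  -- Adding `z` to the cross products `x` and `y` cancels the subtractions and leaves the two
  -- natural numbers that `lessWeight` compares.
  z = pos (q ℕ.* d′ ℕ.+ q′ ℕ.* d)
  expand : ∀ i j m n → pos (i ℕ.* m ℕ.+ j ℕ.* n) ≡ pos i ℤ.* pos m ℤ.+ pos j ℤ.* pos n
  expand i j m n = trans (ℤ.pos-+ (i ℕ.* m) (j ℕ.* n)) (cong₂ ℤ._+_ (ℤ.pos-* i m) (ℤ.pos-* j n))
  a≡ : x ℤ.+ z ≡ pos a
  a≡ = trans (cong (λ v → x ℤ.+ v) (expand q q′ d′ d)) (trans (lemma (pos p) (pos q) (pos q′) (pos d) (pos d′)) (sym (expand p q′ d′ d)))
    where lemma : ∀ p q q′ d d′ → (p ℤ.- q) ℤ.* d′ ℤ.+ (q ℤ.* d′ ℤ.+ q′ ℤ.* d) ≡ p ℤ.* d′ ℤ.+ q′ ℤ.* d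
          lemma = ℤSolver.solve-∀
  b≡ : y ℤ.+ z ≡ pos b
  b≡ = trans (cong (λ v → y ℤ.+ v) (expand q q′ d′ d)) (trans (lemma (pos p′) (pos q) (pos q′) (pos d) (pos d′)) (sym (expand p′ q d d′)))
    where lemma : ∀ p′ q q′ d d′ → (p′ ℤ.- q′) ℤ.* d ℤ.+ (q ℤ.* d′ ℤ.+ q′ ℤ.* d) ≡ p′ ℤ.* d ℤ.+ q ℤ.* d′
          lemma = ℤSolver.solve-∀
  to : T (a <ᵇ b) → r ℚ.< r′
  to t = ℚ.toℚᵘ-cancel-< (ℚᵘ.<-respˡ-≃ (ℚᵘ.≃-sym eq) (ℚᵘ.<-respʳ-≃ (ℚᵘ.≃-sym eq′) (*<* (ℤ.≰⇒> λ y≤x →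
    ℤ.<⇒≱ (ℤ.+<+ (ℕ.<ᵇ⇒< a b t)) (subst₂ ℤ._≤_ b≡ a≡ (ℤ.+-monoˡ-≤ z y≤x))))))
  from : r ℚ.< r′ → T (a <ᵇ b)
  from r<r′ with ℚᵘ.<-respˡ-≃ eq (ℚᵘ.<-respʳ-≃ eq′ (ℚ.toℚᵘ-mono-< r<r′))
  ... | *<* x<y = ℕ.<⇒<ᵇ (ℤ.drop‿+<+ (subst₂ ℤ._<_ a≡ b≡ (ℤ.+-monoˡ-< z x<y)))

lessWeight-true : ∀ w w′ {r r′} → Represents w r → Represents w′ r′ → lessWeight w w′ ≡ true → r ℚ.< r′
lessWeight-true w w′ R R′ eq = proj₁ (lessWeight-⇔ w w′ R R′) (subst T (sym eq) tt)

lessWeight-false : ∀ w w′ {r r′} → Represents w r → Represents w′ r′ → lessWeight w w′ ≡ false → r′ ℚ.≤ r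
lessWeight-false w w′ R R′ eq = ℚ.≮⇒≥ λ r<r′ → subst T eq (proj₂ (lessWeight-⇔ w w′ R R′) r<r′)

isNegative-true : ∀ r → isNegative r ≡ true → r ℚ.≤ 0ℚ
isNegative-true (mkℚ -[1+ n ] d _) _ = ℚ.*≤* ℤ.-≤+

isNegative-false : ∀ r → isNegative r ≡ false → 0ℚ ℚ.≤ r
isNegative-false (mkℚ (pos n) d _) _ = ℚ.*≤* (ℤ.≤-trans (ℤ.+≤+ ℕ.z≤n) (ℤ.≤-reflexive (sym (ℤ.*-identityʳ (pos n)))))

modeCost-nonNegative : ∀ r → 0ℚ ℚ.≤ modeCost superset r
modeCost-nonNegative r with isNegative r in eq
... | true  = ℚ.≤-refl
... | false = isNegative-false r eq

-- Correctness of the shortest path computation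

nth-toList : ∀ {A B : Set} {k} d (f : A → B) (v : Vec A k) i → nth d (map f (toList v)) (toℕ i) ≡ f (lookup v i)
nth-toList d f (x Vec.∷ v) zero    = refl
nth-toList d f (x Vec.∷ v) (suc i) = nth-toList d f v i

nth-lookup : ∀ {A : Set} {k} d (v : Vec A k) i → nth d (toList v) (toℕ i) ≡ lookup v i
nth-lookup d (x Vec.∷ v) zero    = refl
nth-lookup d (x Vec.∷ v) (suc i) = nth-lookup d v i

nth-upTo : ∀ {A : Set} {k} d (f : ℕ → A) (i : Fin k) → nth d (map f (upTo k)) (toℕ i) ≡ f (toℕ i)
nth-upTo {k = k} d f i rewrite map-upTo f k = go f i
  where
  go : ∀ {k} f (i : Fin k) → nth d (applyUpTo f k) (toℕ i) ≡ f (toℕ i)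
  go f zero    = refl
  go f (suc i) = go (f ∘ suc) i

map-upTo-allFin : ∀ {A : Set} k (f : ℕ → A) → map f (upTo k) ≡ map (f ∘ toℕ) (allFin k)
map-upTo-allFin k f = trans (map-upTo f k) (trans (go k f) (sym (map-tabulate id (f ∘ toℕ))))
  where
  go : ∀ k f → applyUpTo f k ≡ tabulate {n = k} (f ∘ toℕ)
  go zero    f = refl
  go (suc k) f = cong (f 0 ∷_) (go k (f ∘ suc))

map-upTo-toList : ∀ {A : Set} {k} (f : ℕ → A) (v : Vec A k) → (∀ i → f (toℕ i) ≡ lookup v i) → map f (upTo k) ≡ toList v
map-upTo-toList {k = k} f v f≗v = trans (map-upTo f k) (go f v f≗v)
  where
  go : ∀ {k} f (v : Vec _ k) → (∀ i → f (toℕ i) ≡ lookup v i) → applyUpTo f k ≡ toList v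
  go f Vec.[]        _   = refl
  go f (x Vec.∷ v) f≗v = cong₂ _∷_ (f≗v zero) (go (f ∘ suc) v (f≗v ∘ suc))

≡ᵇ-refl : ∀ n → (n ≡ᵇ n) ≡ true
≡ᵇ-refl zero    = refl
≡ᵇ-refl (suc n) = ≡ᵇ-refl n

≢⇒≡ᵇ : ∀ {m n} → m ≢ n → (m ≡ᵇ n) ≡ false
≢⇒≡ᵇ {m} {n} m≢n with m ≡ᵇ n in eq
... | true  = contradiction (≡ᵇ⇒≡ m n (subst T (sym eq) tt)) m≢n
... | false = refl

encodeList-map : ∀ {A B : Set} {encB : B → Tree} {encA : A → Tree} (f : A → B) → (∀ x → encB (f x) ≡ encA x) →
  ∀ l → encodeList encB (map f l) ≡ encodeList encA l
encodeList-map f eq []      = refl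
encodeList-map f eq (x ∷ l) = cong₂ cons (eq x) (encodeList-map f eq l)

rawInstance : Input → RawInstance
rawInstance I = n , map (λ (u , v) → toℕ u , toℕ v) (toList ends) , map toList (toList colour) ,
                toℕ s , toℕ t , map rawℚ (toList cost) , tt
  where open Input I

rawInstance-encode : ∀ I → enc instanceTy (rawInstance I) ≡ encodeInput I
rawInstance-encode I = cong (cons (encodeUnary n)) (cong₂ cons (encodeList-map _ (λ _ → refl) (toList ends))
  (cong₂ cons (encodeList-map toList (λ _ → refl) (toList colour))
  (cong (cons (encodeFin s)) (cong (cons (encodeFin t)) (cong₂ cons (encodeList-map rawℚ rawℚ-encode (toList cost)) refl)))))
  where open Input I

module Bridge (mode : Mode) (o : Orientation) (I : Input) where
  open Input I

  x : RawInstance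
  x = rawInstance I

  edgeIndices≡ : edgeIndices x ≡ upTo m
  edgeIndices≡ = cong upTo (trans (length-map _ (toList ends)) (length-toList ends))
    where
    length-toList : ∀ {A : Set} {k} (v : Vec A k) → length (toList v) ≡ k
    length-toList Vec.[]      = refl
    length-toList (_ Vec.∷ v) = cong suc (length-toList v)

  map-edges : ∀ {A : Set} (f : ℕ → A) (v : Vec A m) → (∀ i → f (toℕ i) ≡ lookup v i) → map f (edgeIndices x) ≡ toList v
  map-edges f v f≗v = trans (cong (map f) edgeIndices≡) (map-upTo-toList f v f≗v)

  emptyBits-correct : emptyBits x ≡ toList {n = m} ∅
  emptyBits-correct = map-edges _ ∅ λ i → sym (lookup-replicate i false)

  unionBits-correct : ∀ (S S′ : Subset m) → unionBits x (toList S) (toList S′) ≡ toList (S ∪ S′)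
  unionBits-correct S S′ = map-edges _ (S ∪ S′) λ i →
    trans (cong₂ _∨_ (nth-lookup false S i) (nth-lookup false S′ i)) (sym (lookup-zipWith _∨_ i S S′))

  interBits-correct : ∀ (S S′ : Subset m) → interBits x (toList S) (toList S′) ≡ toList (S ∩ S′)
  interBits-correct S S′ = map-edges _ (S ∩ S′) λ i →
    trans (cong₂ _∧_ (nth-lookup false S i) (nth-lookup false S′ i)) (sym (lookup-zipWith _∧_ i S S′))

  insertBits-correct : ∀ e (S : Subset m) → insertBits x (toℕ e) (toList S) ≡ toList (⁅ e ⁆ ∪ S)
  insertBits-correct e S = map-edges _ (⁅ e ⁆ ∪ S) λ i →
    trans (cong₂ _∨_ (singleton i) (nth-lookup false S i)) (sym (lookup-zipWith _∨_ i ⁅ e ⁆ S))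
    where
    singleton : ∀ i → (toℕ e ≡ᵇ toℕ i) ≡ lookup ⁅ e ⁆ i
    singleton i with i ≟ᶠ e
    ... | yes refl = trans (≡ᵇ-refl (toℕ e)) (sym ([]=⇒lookup (x∈⁅x⁆ e)))
    ... | no  i≢e with lookup ⁅ e ⁆ i in eq
    ...   | true  = contradiction (x∈⁅y⁆⇒x≡y e (lookup⇒[]= i _ eq)) i≢e
    ...   | false = ≢⇒≡ᵇ λ e≡i → i≢e (sym (toℕ-injective e≡i))

  subBits-true⁺ : ∀ {S S′ : Subset m} → S ⊆ S′ → subBits x (toList S) (toList S′) ≡ true
  subBits-true⁺ {S} {S′} S⊆S′ = all-true _ (edgeIndices x) λ {k} k∈ →
    let k< = ∈-upTo⁻ (subst (k ∈_) edgeIndices≡ k∈) in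
    subst (λ k → (not (nth false (toList S) k) ∨ nth false (toList S′) k) ≡ true) (toℕ-fromℕ< k<) (bit (fromℕ< k<))
    where
    bit : ∀ i → (not (nth false (toList S) (toℕ i)) ∨ nth false (toList S′) (toℕ i)) ≡ true
    bit i rewrite nth-lookup false S i | nth-lookup false S′ i with lookup S i in eq
    ... | true  = []=⇒lookup (S⊆S′ (lookup⇒[]= i S eq))
    ... | false = refl

  subBits-true⁻ : ∀ {S S′ : Subset m} → subBits x (toList S) (toList S′) ≡ true → S ⊆ S′
  subBits-true⁻ {S} {S′} eq {i} i∈S = lookup⇒[]= i S′ (bit (all-true⁻ _ (edgeIndices x) eq
      (subst (toℕ i ∈_) (sym edgeIndices≡) (∈-upTo⁺ (toℕ<n i)))))
    where
    bit : (not (nth false (toList S) (toℕ i)) ∨ nth false (toList S′) (toℕ i)) ≡ true → lookup S′ i ≡ true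
    bit rewrite nth-lookup false S i | nth-lookup false S′ i | []=⇒lookup i∈S = id

  Cs : List (Subset m)
  Cs = toList colour

  minimal-true⁺ : ∀ {C} → (∀ {D} → D ∈ Cs → D ⊆ C → C ⊆ D) → minimal x (toList C) ≡ true
  minimal-true⁺ {C} min = all-true _ (classes x) λ D∈ → go D∈
    where
    go : ∀ {l} → l ∈ classes x → (not (subBits x l (toList C)) ∨ subBits x (toList C) l) ≡ true
    go l∈ with ∈-map⁻ toList l∈
    ... | D , D∈ , refl with subBits x (toList D) (toList C) in eq
    ...   | false = refl
    ...   | true  = subBits-true⁺ {C} {D} (min D∈ (subBits-true⁻ {D} {C} eq))

  minimal-true⁻ : ∀ {C} → minimal x (toList C) ≡ true → ∀ {D} → D ∈ Cs → D ⊆ C → C ⊆ D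
  minimal-true⁻ {C} eq {D} D∈ D⊆C = subBits-true⁻ {C} {D}
    (subst (λ b → (not b ∨ subBits x (toList C) (toList D)) ≡ true) (subBits-true⁺ {D} {C} D⊆C)
      (all-true⁻ _ (classes x) eq (∈-map⁺ toList D∈)))

  c : Edge → ℚ
  c e = modeCost mode (lookup cost e)

  weightOf : List Edge → Weight
  weightOf = foldr (λ e → addWeight (edgeWeight mode (rawℚ (lookup cost e)))) (0 , 0 , 1)

  weightOf-Represents : ∀ es → Represents (weightOf es) (sumBy c es)
  weightOf-Represents []       = 0-Represents
  weightOf-Represents (e ∷ es) = addWeight-Represents (edgeWeight mode (rawℚ (lookup cost e))) (weightOf es)
    (edgeWeight-Represents mode (lookup cost e)) (weightOf-Represents es)

  less : List Edge → List Edge → Bool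
  less es fs = lessWeight (weightOf es) (weightOf fs)

  module _ (C : Subset m) where
    open BellmanFord graph o t (lookup C) c less
      (λ es fs → lessWeight-true (weightOf es) (weightOf fs) (weightOf-Represents es) (weightOf-Represents fs))
      (λ es fs → lessWeight-false (weightOf es) (weightOf fs) (weightOf-Represents es) (weightOf-Represents fs))
      public

  module _ (C : Subset m) where

    -- The simulation map: of a walk in `best`, the table of the algorithm keeps only the weight and
    -- the edge set. `less` compares walks by their weights, so that improving and extending commute
    -- with `entry`.
    entry : ∀ {v} → Maybe (Walk graph o v t) → Maybe PartialPath
    entry = maybe′ (λ w → just (weightOf (edges w) , toList (edgeSet w))) nothing

    better-entry : ∀ {v} (π ρ : Maybe (Walk graph o v t)) → better (entry π) (entry ρ) ≡ entry (improve C π ρ)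
    better-entry nothing  ρ        = refl
    better-entry (just p) nothing  = refl
    better-entry (just p) (just r) with less (edges p) (edges r)
    ... | true  = refl
    ... | false = refl

    extend-entry : ∀ {v u′} e (j : Joins graph o e v u′) π →
      extend mode o x (toℕ e) (entry π) ≡ entry (maybe′ (λ w → just (step e j w)) nothing π)
    extend-entry e j nothing  = refl
    extend-entry e j (just w) = cong just (cong₂ _,_
      (cong (λ r → addWeight (edgeWeight mode r) (weightOf (edges w))) (nth-toList _ rawℚ cost e))
      (insertBits-correct e (edgeSet w)))

    rawArc : (∃ λ e → ∃₂ λ u v → Joins graph o e u v) → RawArc
    rawArc (e , u , v , _) = toℕ e , toℕ u , toℕ v

    candidate-entry : ∀ {T} {T′ : ∀ u → Maybe (Walk graph o u t)} → (∀ u → nth nothing T (toℕ u) ≡ entry (T′ u)) →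
      ∀ v a → candidate mode o x (toList C) T (toℕ v) (rawArc a) ≡ entry (candidateWalk C T′ v a)
    candidate-entry {T} {T′} T≡ v (e , u , u′ , j) with u ≟ᶠ v
    ... | no u≢v rewrite ≢⇒≡ᵇ (u≢v ∘ toℕ-injective) | ∧-zeroʳ (nth false (toList C) (toℕ e)) = refl
    ... | yes refl rewrite ≡ᵇ-refl (toℕ u) | ∧-identityʳ (nth false (toList C) (toℕ e)) | nth-lookup false C e | T≡ u′ with lookup C e
    ...   | true  = extend-entry e j (T′ u′)
    ...   | false = refl

    endpoint≡ : ∀ e → nth (0 , 0) (endpoints x) (toℕ e) ≡ (toℕ (proj₁ (lookup ends e)) , toℕ (proj₂ (lookup ends e)))
    endpoint≡ e = nth-toList (0 , 0) (λ (u , v) → toℕ u , toℕ v) ends e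

  rawArcs≡ : ∀ C o → rawArcs x o ≡ map (λ (e , u , v , _) → toℕ e , toℕ u , toℕ v) (arcs C o)
  rawArcs≡ C directed = trans (cong (map _) edgeIndices≡) (trans (map-upTo-allFin m _)
    (trans (map-cong (λ e → cong (toℕ e ,_) (endpoint≡ C e)) (allFin m)) (map-∘ (allFin m))))
  rawArcs≡ C undirected = trans (cong₂ _++_
      (trans (cong (map _) edgeIndices≡) (trans (map-upTo-allFin m _)
        (trans (map-cong (λ e → cong (toℕ e ,_) (endpoint≡ C e)) (allFin m)) (map-∘ (allFin m)))))
      (trans (cong (map _) edgeIndices≡) (trans (map-upTo-allFin m _)
        (trans (map-cong (λ e → cong (λ p → toℕ e , swap p) (endpoint≡ C e)) (allFin m)) (map-∘ (allFin m))))))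
    (sym (map-++ _ (map (forward C undirected) (allFin m)) (map (backward C undirected) (allFin m))))

  module _ (C : Subset m) where

    relax-entry : ∀ {T i} → (∀ u → nth nothing T (toℕ u) ≡ entry C (best C i u)) →
      ∀ v → relax mode o x (toList C) T (toℕ v) ≡ entry C (best C (suc i) v)
    relax-entry {T} {i} T≡ v = trans (cong₂ (foldl (λ π a → better (candidate mode o x (toList C) T (toℕ v) a) π)) (T≡ v) (rawArcs≡ C o))
      (trans (foldl-map _ (rawArc C) _ (arcs C o)) (go (arcs C o) (best C i v)))
      where
      go : ∀ as π → foldl (λ π a → better (candidate mode o x (toList C) T (toℕ v) (rawArc C a)) π) (entry C π) as ≡
                    entry C (fold-improve C (candidateWalk C (best C i) v) as π)
      go []       π = refl
      go (a ∷ as) π = trans (cong (λ z → foldl (λ π a → better (candidate mode o x (toList C) T (toℕ v) (rawArc C a)) π) z as)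
          (trans (cong (λ z → better z (entry C π)) (candidate-entry C T≡ v a)) (better-entry C (candidateWalk C (best C i) v a) π)))
        (go as (improve C (candidateWalk C (best C i) v a) π))

    rounds-entry : ∀ {A : Set} (l : List A) {T i} → (∀ u → nth nothing T (toℕ u) ≡ entry C (best C i u)) →
      ∀ u → nth nothing (foldl (λ T _ → relaxAll mode o x (toList C) T) T l) (toℕ u) ≡ entry C (best C (length l + i) u)
    rounds-entry []      T≡ u = T≡ u
    rounds-entry (_ ∷ l) {T} {i} T≡ u = trans (rounds-entry l {relaxAll mode o x (toList C) T} {suc i}
        (λ v → trans (nth-upTo nothing (relax mode o x (toList C) T) v) (relax-entry {T} {i} T≡ v)) u)
      (cong (λ k → entry C (best C k u)) (+-suc (length l) i))

    initial-entry : ∀ u → nth nothing (initialTable x) (toℕ u) ≡ entry C (best C 0 u)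
    initial-entry u = trans (nth-upTo nothing _ u) (go u)
      where
      go : ∀ u → (if toℕ u ≡ᵇ toℕ t then just ((0 , 0 , 1) , emptyBits x) else nothing) ≡ entry C (best C 0 u)
      go u with u ≟ᶠ t
      ... | yes refl rewrite ≡ᵇ-refl (toℕ u) = cong (λ S → just ((0 , 0 , 1) , S)) emptyBits-correct
      ... | no u≢t rewrite ≢⇒≡ᵇ (u≢t ∘ toℕ-injective) = refl

    P : Maybe (Subset m)
    P = maybe′ (λ w → just (edgeSet w)) nothing (best C n s)

    shortest≡ : shortest mode o x (toList C) ≡ Maybe.map toList P
    shortest≡ = trans (cong (maybe′ (λ π → just (proj₂ π)) nothing) (trans (rounds-entry (vertexIndices x) {initialTable x} {0} initial-entry s)
        (cong (λ k → entry C (best C k s)) (trans (+-identityʳ _) (length-upTo n)))))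
      (go (best C n s))
      where
      go : ∀ π → maybe′ (λ π → just (proj₂ π)) nothing (entry C π) ≡ Maybe.map toList (maybe′ (λ w → just (edgeSet w)) nothing π)
      go nothing  = refl
      go (just w) = refl

-- Correctness of the algorithm

∈-⋃⁻ : ∀ {m} {e : Fin m} Ss → e ∈ˢ ⋃ Ss → ∃ λ S → S ∈ Ss × e ∈ˢ S
∈-⋃⁻ []       e∈ = contradiction e∈ ∉⊥
∈-⋃⁻ (S ∷ Ss) e∈ with x∈p∪q⁻ S (⋃ Ss) e∈
... | inj₁ e∈S  = S , here refl , e∈S
... | inj₂ e∈Ss = let S′ , S′∈ , e∈S′ = ∈-⋃⁻ Ss e∈Ss in S′ , there S′∈ , e∈S′

∈-filterᵇ⁺ : ∀ {A : Set} (p : A → Bool) {y l} → y ∈ l → p y ≡ true → y ∈ filterᵇ p l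
∈-filterᵇ⁺ p y∈ eq = ∈-filter⁺ (T? ∘ p) y∈ (subst T (sym eq) tt)

∈-filterᵇ⁻ : ∀ {A : Set} (p : A → Bool) {y} l → y ∈ filterᵇ p l → y ∈ l × p y ≡ true
∈-filterᵇ⁻ p l y∈ = let y∈l , py = ∈-filter⁻ (T? ∘ p) {xs = l} y∈ in y∈l , T⇒≡ py
  where
  T⇒≡ : ∀ {b} → T b → b ≡ true
  T⇒≡ {true} _ = refl

true-extensional : ∀ {a b} → (a ≡ true → b ≡ true) → (b ≡ true → a ≡ true) → a ≡ b
true-extensional {true}  {b}     f _ = sym (f refl)
true-extensional {false} {true}  _ g = g refl
true-extensional {false} {false} _ _ = refl

module Correctness (mode : Mode) (o : Orientation) (I : Input) (costs : CostAssumption o I) (lam : Laminar I) where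
  open Input I
  open Bridge mode o I

  class-index : ∀ {C} → C ∈ Cs → ∃ λ i → lookup colour i ≡ C
  class-index C∈ = let C∈colour = ∈-toList⁻ C∈ in Vec.index C∈colour , sym (Vec.lookup-index C∈colour)

  laminar : ∀ {C D} → C ∈ Cs → D ∈ Cs → Nonempty (C ∩ D) → C ⊆ D ⊎ D ⊆ C
  laminar C∈ D∈ meet with class-index C∈ | class-index D∈
  ... | i , refl | j , refl = lam i j meet

  Min : Subset m → Set
  Min = Minimal Cs laminar

  cycles≥0 : ∀ mode o → CostAssumption o I → ∀ {v} (w : Walk graph o v v) → edges w ≢ [] → Unique (departures w) →
    0ℚ ℚ.≤ sumBy (λ e → modeCost mode (lookup cost e)) (edges w)
  cycles≥0 exact    directed   costs w ne simple = costs w (ne , simple)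
  cycles≥0 exact    undirected costs w _  _      = sumBy-nonNegative costs (edges w)
  cycles≥0 superset _          _     w _  _      = sumBy-nonNegative (λ e → modeCost-nonNegative (lookup cost e)) (edges w)

  record ShortestPath (C S : Subset m) : Set where
    field
      walk     : Walk graph o s t
      path     : IsPath walk
      set≡     : S ≡ edgeSet walk
      inside   : S ⊆ C
      minimum  : ∀ (q : Walk graph o s t) → IsPath q → edgeSet q ⊆ C → sumBy c (edges walk) ℚ.≤ sumBy c (edges q)

  ⊆-class : ∀ {C} (q : Walk graph o s t) → edgeSet q ⊆ C → Within-C C q
  ⊆-class q q⊆ = All.tabulate λ e∈ → []=⇒lookup (q⊆ (∈-setOf⁺ e∈))

  P-sound : ∀ C {S} → P C ≡ just S → ShortestPath C S
  P-sound C {S} eq with best C n s in best≡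
  P-sound C {S} refl | just w = record
    { walk = w ; path = best-path C (cycles≥0 mode o costs) n s best≡ ; set≡ = refl
    ; inside = λ {e} e∈ → lookup⇒[]= e C (All.lookup (proj₁ (best-sound C n s best≡)) (∈-setOf⁻ (edges w) e∈))
    ; minimum = λ q qpath q⊆ → let w′ , eq′ , le = best-n-optimal C (cycles≥0 mode o costs) s q qpath (⊆-class q q⊆) in
        subst (λ z → sumBy c (edges z) ℚ.≤ sumBy c (edges q)) (just-injective (trans (sym eq′) best≡)) le }

  P-complete : ∀ C (q : Walk graph o s t) → IsPath q → edgeSet q ⊆ C → ∃ λ S → P C ≡ just S
  P-complete C q qpath q⊆ = let w , eq , _ = best-n-optimal C (cycles≥0 mode o costs) s q qpath (⊆-class q q⊆) in
    edgeSet w , cong (maybe′ (λ w → just (edgeSet w)) nothing) eq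

  chosen : Subset m → Edge → Bool
  chosen C e = maybe′ (λ S → lookup S e) false (P C)

  chosen-⊆ : ∀ {C e} → chosen C e ≡ true → e ∈ˢ C
  chosen-⊆ {C} {e} eq with P C in P≡
  ... | just S = ShortestPath.inside (P-sound C P≡) (lookup⇒[]= e S eq)

  isMinimal : Subset m → Bool
  isMinimal C = minimal x (toList C)

  minimals : List (Subset m)
  minimals = filterᵇ isMinimal Cs

  base : Subset m
  base = Vec.tabulate λ e → free mode (rawℚ (lookup cost e))

  add : Subset m → Subset m → Subset m
  add A C = if isMinimal C then maybe′ (A ∪_) A (P C) else A

  answer : Subset m
  answer = foldl add base Cs

  answer-lookup : ∀ e → lookup answer e ≡ free mode (rawℚ (lookup cost e)) ∨ any (λ C → chosen C e) minimals
  answer-lookup e = trans (go base Cs) (cong (_∨ any (λ C → chosen C e) minimals) (lookup∘tabulate _ e))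
    where
    go : ∀ A Ds → lookup (foldl add A Ds) e ≡ lookup A e ∨ any (λ C → chosen C e) (filterᵇ isMinimal Ds)
    go A []       = sym (∨-identityʳ _)
    go A (D ∷ Ds) with isMinimal D
    ... | false = go A Ds
    ... | true with P D
    ...   | nothing = go A Ds
    ...   | just S  = trans (go (A ∪ S) Ds) (trans (cong (_∨ any (λ C → chosen C e) (filterᵇ isMinimal Ds)) (lookup-zipWith _∨_ e A S))
                        (∨-assoc (lookup A e) (lookup S e) _))

  solution≡ : solution mode o x ≡ toList answer
  solution≡ = trans (cong (λ A → foldl (addClass mode o x) A (classes x)) (map-edges _ base λ e →
      trans (cong (free mode) (nth-toList _ rawℚ cost e)) (sym (lookup∘tabulate _ e)))) (go base Cs)
    where
    step≡ : ∀ A D → addClass mode o x (toList A) (toList D) ≡ toList (add A D)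
    step≡ A D with minimal x (toList D)
    ... | false = refl
    ... | true rewrite shortest≡ D with P D
    ...   | nothing = refl
    ...   | just S  = unionBits-correct A S
    go : ∀ A Ds → foldl (addClass mode o x) (toList A) (map toList Ds) ≡ toList (foldl add A Ds)
    go A []       = refl
    go A (D ∷ Ds) = trans (cong (λ z → foldl (addClass mode o x) z (map toList Ds)) (step≡ A D)) (go (add A D) Ds)

  fits-true⁻ : ∀ mode {B S : Subset m} → fits mode o x (toList B) (toList S) ≡ true → Fits mode B S
  fits-true⁻ mode {B} {S} eq with subBits x (toList S) (toList B) in S⊆B | mode
  ... | true | exact    = ⊆-antisym (subBits-true⁻ {B} {S} eq) (subBits-true⁻ {S} {B} S⊆B)
  ... | true | superset = subBits-true⁻ {S} {B} S⊆B

  fits-true⁺ : ∀ {B S : Subset m} → S ⊆ B → (mode ≡ exact → B ⊆ S) → fits mode o x (toList B) (toList S) ≡ true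
  fits-true⁺ {B} {S} S⊆B B⊆S rewrite subBits-true⁺ {S} {B} S⊆B = go mode B⊆S
    where
    go : ∀ mode → (mode ≡ exact → B ⊆ S) → (isSuperset mode ∨ subBits x (toList B) (toList S)) ≡ true
    go exact    B⊆S = subBits-true⁺ {B} {S} (B⊆S refl)
    go superset _   = refl

  feasible-sound : feasible mode o x (toList answer) ≡ true → Feasible mode o I answer
  feasible-sound eq i =
    let l , l∈ , ok = any-true⁻ _ (classes x) (all-true⁻ _ (classes x) eq (∈-map⁺ toList (∈-toList⁺ (Vec.∈-lookup i colour))))
        D , D∈ , l≡ = ∈-map⁻ toList l∈ in
    go D (subst (λ l → test l ≡ true) l≡ ok)
    where
    C = lookup colour i
    test : List Bool → Bool
    test l = maybe′ (fits mode o x (interBits x (toList answer) (toList C))) false (shortest mode o x l)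
    go : ∀ D → test (toList D) ≡ true → Σ (Walk graph o s t) λ w → IsPath w × Fits mode (answer ∩ C) (edgeSet w)
    go D ok rewrite shortest≡ D | interBits-correct answer C with P D in P≡
    ... | just S = let open ShortestPath (P-sound D P≡) in
      walk , path , subst (Fits mode (answer ∩ C)) set≡ (fits-true⁻ mode {answer ∩ C} {S} ok)

  isNegative-free : ∀ e → free mode (rawℚ (lookup cost e)) ≡ true → lookup cost e ℚ.≤ 0ℚ × c e ≡ 0ℚ
  isNegative-free e = go mode
    where
    go : ∀ mode → free mode (rawℚ (lookup cost e)) ≡ true → lookup cost e ℚ.≤ 0ℚ × modeCost mode (lookup cost e) ≡ 0ℚ
    go superset eq = isNegative-true (lookup cost e) eq , cong (λ b → if b then 0ℚ else lookup cost e) eq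

  not-free : ∀ e → free mode (rawℚ (lookup cost e)) ≡ false → c e ≡ lookup cost e
  not-free e = go mode
    where
    go : ∀ mode → free mode (rawℚ (lookup cost e)) ≡ false → modeCost mode (lookup cost e) ≡ lookup cost e
    go exact    _  = refl
    go superset eq = cong (λ b → if b then 0ℚ else lookup cost e) eq

  module _ {B : Subset m} (B-feasible : Feasible mode o I B) where

    pathIn : ∀ {C} → C ∈ Cs → Σ (Walk graph o s t) λ q → IsPath q × Fits mode (B ∩ C) (edgeSet q)
    pathIn C∈ with class-index C∈
    ... | i , refl = B-feasible i

    Fits⇒⊆ : ∀ mode {S P : Subset m} → Fits mode S P → P ⊆ S
    Fits⇒⊆ exact    refl = ⊆-refl
    Fits⇒⊆ superset P⊆S  = P⊆S

    path⊆B∩C : ∀ {C} (C∈ : C ∈ Cs) → edgeSet (proj₁ (pathIn C∈)) ⊆ B ∩ C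
    path⊆B∩C C∈ = Fits⇒⊆ mode (proj₂ (proj₂ (pathIn C∈)))

    path⊆C : ∀ {C} (C∈ : C ∈ Cs) → edgeSet (proj₁ (pathIn C∈)) ⊆ C
    path⊆C {C} C∈ e∈ = proj₂ (x∈p∩q⁻ B C (path⊆B∩C C∈ e∈))

    P-exists : ∀ {C} → C ∈ Cs → ∃ λ S → P C ≡ just S
    P-exists {C} C∈ = P-complete C (proj₁ (pathIn C∈)) (proj₁ (proj₂ (pathIn C∈))) (path⊆C C∈)

    exact-≡ : mode ≡ exact → ∀ {C} (C∈ : C ∈ Cs) → B ∩ C ≡ edgeSet (proj₁ (pathIn C∈))
    exact-≡ refl C∈ = proj₂ (proj₂ (pathIn C∈))

    -- An s-t path contains no other s-t path, so nested classes meet an exact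
    -- solution in the same edges.
    exact-nested : mode ≡ exact → ∀ {C D} → C ∈ Cs → D ∈ Cs → D ⊆ C → B ∩ C ⊆ D
    exact-nested ex {C} {D} C∈ D∈ D⊆C {e} e∈ = proj₂ (x∈p∩q⁻ B D (subst (e ∈ˢ_) (sym eqD)
        (∈-setOf⁺ (subst (e ∈_) (sym same) (∈-setOf⁻ (edges qC) (subst (e ∈ˢ_) eqC e∈))))))
      where
      qC = proj₁ (pathIn C∈)
      qD = proj₁ (pathIn D∈)
      eqC = exact-≡ ex C∈
      eqD = exact-≡ ex D∈
      same : edges qD ≡ edges qC
      same = path⊆path qD qC (proj₁ (proj₂ (pathIn D∈))) (proj₁ (proj₂ (pathIn C∈))) λ {f} f∈ →
        let f∈B , f∈D = x∈p∩q⁻ B D (subst (f ∈ˢ_) (sym eqD) (∈-setOf⁺ f∈)) in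
        ∈-setOf⁻ (edges qC) (subst (f ∈ˢ_) eqC (x∈p∩q⁺ (f∈B , D⊆C f∈D)))

    -- As s and t differ, the path of `B` inside `C` has an edge. It is the witness that two minimal
    -- classes inside one class meet.
    some-edge : ∀ {C} → C ∈ Cs → ∃ λ e → e ∈ˢ B ∩ C
    some-edge C∈ with pathIn C∈ | path⊆B∩C C∈
    ... | stop       , _ | _  = contradiction refl s≢t
    ... | step e j w , _ | q⊆ = e , q⊆ (∈-setOf⁺ {es = edges (step e j w)} (here refl))

    chosen⇒minimal : ∀ {e} → any (λ C → chosen C e) minimals ≡ true → ∃₂ λ C S → C ∈ Cs × Min C × P C ≡ just S × e ∈ˢ S
    chosen⇒minimal {e} eq with any-true⁻ (λ C → chosen C e) minimals eq
    ... | C , C∈ , inC with ∈-filterᵇ⁻ isMinimal Cs C∈ | P C in P≡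
    ...   | C∈Cs , minC | just S = C , S , C∈Cs , minimal-true⁻ {C} minC , P≡ , lookup⇒[]= e S inC

    -- For a class `C`, the certificate is the path chosen for a minimal class `D` below it. In the
    -- exact case, an edge of the answer in `C` was chosen for some minimal class `E`; laminarity
    -- relates `E` to `C`, and either way `E` turns out to be `D`.
    feasible-complete : feasible mode o x (toList answer) ≡ true
    feasible-complete = all-true _ (classes x) λ l∈ → class l∈
      where
      class : ∀ {l} → l ∈ classes x →
        any (λ l′ → maybe′ (fits mode o x (interBits x (toList answer) l)) false (shortest mode o x l′)) (classes x) ≡ true
      class l∈ with ∈-map⁻ toList l∈
      ... | C , C∈ , refl with minimal-below Cs laminar C∈
      ...   | D , D∈ , D⊆C , minD = any-true _ (∈-map⁺ toList D∈) test
        where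
        S  = proj₁ (P-exists D∈)
        P≡ = proj₂ (P-exists D∈)
        D∈minimals : D ∈ minimals
        D∈minimals = ∈-filterᵇ⁺ isMinimal D∈ (minimal-true⁺ {D} minD)
        S⊆ : S ⊆ answer ∩ C
        S⊆ {e} e∈S = x∈p∩q⁺ (lookup⇒[]= e answer in-answer , D⊆C (ShortestPath.inside (P-sound D P≡) e∈S))
          where
          in-answer : lookup answer e ≡ true
          in-answer rewrite answer-lookup e
            | any-true (λ C → chosen C e) D∈minimals (trans (cong (maybe′ (λ S → lookup S e) false) P≡) ([]=⇒lookup e∈S))
            with free mode (rawℚ (lookup cost e))
          ... | true  = refl
          ... | false = refl
        ⊆S : mode ≡ exact → answer ∩ C ⊆ S
        ⊆S ex {e} e∈ = let e∈answer , e∈C = x∈p∩q⁻ answer C e∈ in in-some-minimal e∈C (drop-free ex ([]=⇒lookup e∈answer))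
          where
          drop-free : mode ≡ exact → lookup answer e ≡ true → any (λ C → chosen C e) minimals ≡ true
          drop-free refl eq = trans (sym (answer-lookup e)) eq
          in-some-minimal : e ∈ˢ C → any (λ C → chosen C e) minimals ≡ true → e ∈ˢ S
          in-some-minimal e∈C eq with chosen⇒minimal eq
          ... | E , S′ , E∈ , minE , P≡′ , e∈S′ = subst (e ∈ˢ_) (just-injective (trans (sym P≡′) (trans (cong P E≡D) P≡))) e∈S′
            where
            e∈E = ShortestPath.inside (P-sound E P≡′) e∈S′
            E≡D : E ≡ D
            E≡D with laminar E∈ C∈ (e , x∈p∩q⁺ (e∈E , e∈C))
            ... | inj₂ C⊆E = ⊆-antisym (minE D∈ (⊆-trans D⊆C C⊆E)) (⊆-trans D⊆C C⊆E)
            -- Now `D` and `E` both lie in `C`. An edge of `B` in `E` belongs to `B ∩ C`, hence by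
            -- `exact-nested` to `D`, so the two minimal classes meet.
            ... | inj₁ E⊆C with some-edge E∈
            ...   | f , f∈ = let f∈B , f∈E = x∈p∩q⁻ B E f∈ in
              minimal-meet Cs laminar E∈ D∈ minE minD f∈E (exact-nested ex C∈ D∈ D⊆C (x∈p∩q⁺ (f∈B , E⊆C f∈E)))
        test : maybe′ (fits mode o x (interBits x (toList answer) (toList C))) false (shortest mode o x (toList D)) ≡ true
        test rewrite shortest≡ D | P≡ | interBits-correct answer C = fits-true⁺ {answer ∩ C} {S} S⊆ ⊆S

    -- `B` contains an s-t path inside `C`, which competes with the chosen one. In the exact case
    -- `B ∩ C` is this path, so negative costs do no harm; in the superset case the edges beyond the
    -- path have nonnegative modified cost.
    cheap : ∀ {C} → C ∈ Cs → sumFin (part c (chosen C)) ℚ.≤ sumFin (part c (λ e → lookup B e ∧ lookup C e))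
    cheap {C} C∈ = subst (λ p → sumFin (part c (λ e → maybe′ (λ S → lookup S e) false p)) ℚ.≤ rest) (sym P≡)
      (subst (λ S → sumFin (part c (lookup S)) ℚ.≤ rest) (sym set≡)
      (ℚ.≤-trans (ℚ.≤-reflexive (sym (sumBy-setOf c (edges walk) (path-edges-unique walk path))))
      (ℚ.≤-trans (minimum q q-path (path⊆C C∈))
      (ℚ.≤-trans (ℚ.≤-reflexive (sumBy-setOf c (edges q) (path-edges-unique q q-path))) (grow mode refl)))))
      where
      rest = sumFin (part c (λ e → lookup B e ∧ lookup C e))
      P≡ = proj₂ (P-exists C∈)
      open ShortestPath (P-sound C P≡)
      q = proj₁ (pathIn C∈)
      q-path = proj₁ (proj₂ (pathIn C∈))
      ∩-lookup : ∀ e → lookup (B ∩ C) e ≡ lookup B e ∧ lookup C e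
      ∩-lookup e = lookup-zipWith _∧_ e B C
      grow : ∀ mode′ → mode ≡ mode′ → sumFin (part c (lookup (edgeSet q))) ℚ.≤ sumFin (part c (λ e → lookup B e ∧ lookup C e))
      grow exact    ex   = ℚ.≤-reflexive (sumFin-cong λ e → cong (λ b → if b then c e else 0ℚ)
        (trans (cong (λ S → lookup S e) (sym (exact-≡ ex C∈))) (∩-lookup e)))
      grow superset refl = sumFin-mono λ e → part-mono {c = c} {lookup (edgeSet q)} {λ e → lookup B e ∧ lookup C e} e
        (modeCost-nonNegative (lookup cost e)) λ e∈ →
          trans (sym (∩-lookup e)) ([]=⇒lookup (path⊆B∩C C∈ (lookup⇒[]= e (edgeSet q) e∈)))

    covered : Edge → Bool
    covered e = any (λ C → lookup B e ∧ lookup C e) minimals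

    covered⇒B : ∀ e → covered e ≡ true → lookup B e ≡ true
    covered⇒B e eq with any-true⁻ (λ C → lookup B e ∧ lookup C e) minimals eq
    ... | _ , _ , both with lookup B e
    ...   | true = refl

    -- The classes cover all edges, and an edge of `B` in a class already lies in the minimal
    -- classes below it. So the cost of an exact solution is the cost of its paths in the minimal
    -- classes, with no remainder of unknown sign.
    exact-covered : mode ≡ exact → ∀ e → lookup B e ≡ true → covered e ≡ true
    exact-covered ex e e∈B with ∈-⋃⁻ Cs (subst (e ∈ˢ_) (sym colour-⋃) ∈⊤)
    ... | C , C∈ , e∈C with minimal-below Cs laminar C∈
    ...   | D , D∈ , D⊆C , minD = any-true (λ C → lookup B e ∧ lookup C e) (∈-filterᵇ⁺ isMinimal D∈ (minimal-true⁺ {D} minD))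
      (trans (cong (_∧ lookup D e) e∈B) ([]=⇒lookup (exact-nested ex C∈ D∈ D⊆C (x∈p∩q⁺ (lookup⇒[]= e B e∈B , e∈C)))))

    -- The cost of the edges that are bought anyway.
    offset : Edge → ℚ
    offset e = if free mode (rawℚ (lookup cost e)) then lookup cost e else 0ℚ

    answer-part : ∀ e → part (lookup cost) (lookup answer) e ≡ offset e ℚ.+ part c (λ e → any (λ C → chosen C e) minimals) e
    answer-part e rewrite answer-lookup e with free mode (rawℚ (lookup cost e)) in eq
    ... | true  = trans (sym (ℚ.+-identityʳ _)) (cong (λ q → lookup cost e ℚ.+ q) (sym (vanish (any (λ C → chosen C e) minimals))))
      where
      vanish : ∀ b → (if b then c e else 0ℚ) ≡ 0ℚ
      vanish true  = proj₂ (isNegative-free e eq)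
      vanish false = refl
    ... | false = trans (cong (λ q → if any (λ C → chosen C e) minimals then q else 0ℚ) (sym (not-free e eq))) (sym (ℚ.+-identityˡ _))

    -- A free edge has cost at most 0, so buying it is no dearer than what `B` does, and its
    -- modified cost is 0. On other edges `c` is the true cost; there `covered` is all of `B` in the
    -- exact case, and a part of `B` with nonnegative costs in the superset case.
    B-part : ∀ e → offset e ℚ.+ part c covered e ℚ.≤ part (lookup cost) (lookup B) e
    B-part e with free mode (rawℚ (lookup cost e)) in eq
    ... | true  = ℚ.≤-trans (ℚ.≤-reflexive (trans (cong (λ q → lookup cost e ℚ.+ q) (vanish (covered e))) (ℚ.+-identityʳ _))) (bought (lookup B e))
      where
      vanish : ∀ b → (if b then c e else 0ℚ) ≡ 0ℚ
      vanish true  = proj₂ (isNegative-free e eq)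
      vanish false = refl
      bought : ∀ b → lookup cost e ℚ.≤ (if b then lookup cost e else 0ℚ)
      bought true  = ℚ.≤-refl
      bought false = proj₁ (isNegative-free e eq)
    ... | false = ℚ.≤-trans (ℚ.≤-reflexive (ℚ.+-identityˡ _))
      (subst (λ q → (if covered e then c e else 0ℚ) ℚ.≤ (if lookup B e then q else 0ℚ)) (not-free e eq) (go mode refl))
      where
      go : ∀ mode′ → mode ≡ mode′ → (if covered e then c e else 0ℚ) ℚ.≤ (if lookup B e then c e else 0ℚ)
      go exact    ex = ℚ.≤-reflexive (cong (λ b → if b then c e else 0ℚ)
        (true-extensional (covered⇒B e) (exact-covered ex e)))
      go superset refl = part-mono {c = c} {covered} {lookup B} e (modeCost-nonNegative (lookup cost e)) (covered⇒B e)

    -- The offset is the same for the answer and for `B`; what remains is compared class by class,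
    -- over the minimal classes.
    optimal : totalˢ answer ℚ.≤ totalˢ B
    optimal = subst₂ ℚ._≤_ (sym (sumBy-filter (lookup cost) answer id)) (sym (sumBy-filter (lookup cost) B id))
      (ℚ.≤-trans (ℚ.≤-reflexive (trans (sumFin-cong answer-part) (sumFin-+ offset _)))
      (ℚ.≤-trans (ℚ.+-monoʳ-≤ (sumFin offset) (minimal-sum Cs laminar c chosen (lookup B) (λ _ → chosen-⊆) cheap minimals
        λ D∈ → let D∈Cs , minD = ∈-filterᵇ⁻ isMinimal Cs D∈ in D∈Cs , minimal-true⁻ minD))
      (ℚ.≤-trans (ℚ.≤-reflexive (sym (sumFin-+ offset (part c covered)))) (sumFin-mono B-part))))

  output : Maybe (Subset m)
  output = if feasible mode o x (toList answer) then just answer else nothing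

  output-solves : Solves mode o I output
  output-solves with feasible mode o x (toList answer) in eq
  ... | true  = feasible-sound eq , λ B B-feasible → optimal B-feasible
  ... | false = λ B B-feasible → contradiction (trans (sym eq) (feasible-complete B-feasible)) λ ()

  solve≡ : enc (maybe (list bool)) (solve mode o x) ≡ encodeMaybe encodeSubset output
  solve≡ rewrite solution≡ with feasible mode o x (toList answer)
  ... | true  = refl
  ... | false = refl

-- From computations to polynomial-time solvability

power-* : ∀ a b d → (a * b) ^ d ≡ a ^ d * b ^ d
power-* a b zero    = refl
power-* a b (suc d) = trans (cong (a * b *_) (power-* a b d)) (lemma a b (a ^ d) (b ^ d))
  where
  lemma : ∀ a b x y → a * b * (x * y) ≡ a * x * (b * y)
  lemma = solve-∀

-- Started with an empty stack, the program takes time at most `(3 + size) ^ d`, where `size` is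
-- that of the input. A tree has size at least 1, so this is at most `(4 * size) ^ d`, whence the
-- constants `4 ^ d` and `d`.
computable⇒solvable : ∀ P (answer : ∀ x → Problem.Answer P x) → (∀ x → Problem.Correct P x (answer x)) →
  Computable (Problem.encode P) (λ x → Problem.encodeᵃ P (answer x)) → PolynomialTimeSolvable P
computable⇒solvable P answer correct F = (3 , code F) , 4 ^ d , d , λ x →
  let _ , _ , t , r , t≤ = run F x nil nil nil in
  answer x , correct x , t , (_ , r , refl) , ℕ.≤-trans t≤ (ℕ.≤-trans (bound (time-poly F) (x , nil)) (scale (encode x)))
  where
  open Problem P
  d = degree (time-poly F)
  scale : ∀ y → (2 + (size y + 1)) ^ d ≤ 4 ^ d * size y ^ d
  scale y = ℕ.≤-trans (ℕ.^-monoˡ-≤ d (ℕ.≤-trans (ℕ.≤-reflexive (cong (2 +_) (ℕ.+-comm (size y) 1)))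
      (ℕ.≤-trans (ℕ.+-monoˡ-≤ (size y) (ℕ.*-monoʳ-≤ 3 (size-positive y))) (ℕ.≤-reflexive (ℕ.+-comm (3 * size y) (size y))))))
    (ℕ.≤-reflexive (power-* 4 (size y) d))

simultaneousPaths-solvable : ∀ mode o → PolynomialTimeSolvable (SimultaneousProblem mode o restrictedTo LaminarColours)
simultaneousPaths-solvable mode o = computable⇒solvable (SimultaneousProblem mode o restrictedTo LaminarColours)
  (λ ((I , costs) , lam) → Correctness.output mode o I costs lam)
  (λ ((I , costs) , lam) → Correctness.output-solves mode o I costs lam)
  (extC (λ ((I , _) , _) → rawInstance-encode I) (λ ((I , costs) , lam) → Correctness.solve≡ mode o I costs lam)
    (reindexC (λ ((I , _) , _) → rawInstance I) (PolyTime.computable (solveP mode o))))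

theorem3p7 :
    PolynomialTimeSolvable (ExactSimultaneousDipaths restrictedTo LaminarColours)
    × PolynomialTimeSolvable (ExactSimultaneousPaths restrictedTo LaminarColours)
    × PolynomialTimeSolvable (SupersetSimultaneousDipaths restrictedTo LaminarColours)
    × PolynomialTimeSolvable (SupersetSimultaneousPaths restrictedTo LaminarColours)
theorem3p7 = simultaneousPaths-solvable exact directed , simultaneousPaths-solvable exact undirected ,
  simultaneousPaths-solvable superset directed , simultaneousPaths-solvable superset undirected
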